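{- For every integer $c\in[6,36]\setminus\{7,29\}$, there exists a quantum Latin square of order $6$ with cardinality $c$. Moreover, no quantum Latin square of order $6$ has cardinality $7$.
   Context: A quantum Latin square of order $n$, denoted $\mathrm{QLS}(n)$, is an $n\times n$ array $(\phi_{ij})_{0\le i,j\le n-1}$ of unit vectors in $\mathbb{C}^n$ such that every row and every column forms an orthonormal basis of $\mathbb{C}^n$. Two unit vectors $u,v$ are phase equivalent, $u\sim v$, if $u=e^{i\alpha}v$ for some $\alpha\in\mathbb{R}$. The cardinality of a quantum Latin square is the number of distinct phase-equivalence classes among its $n^2$ entries. -}

module Defs where

open import Algebra.Bundles.Raw using (RawRing)
import Algebra.Definitions.RawSemiring as RawSemiringDefinitions
open import Data.Fin.Base using (Fin; toℕ)
open import Data.Integer.Base using (+_)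
open import Data.Nat.Base as ℕ using (ℕ; _!)
import Data.Nat.Properties as ℕ
open import Data.Product.Base using (∃; ∃₂; _×_; _,_; proj₁; proj₂)
open import Data.Rational.Base as ℚ using (ℚ; 0ℚ; 1ℚ; ½; ∣_∣)
import Data.Rational.Properties as ℚ
open import Data.Rational.Solver using (module +-*-Solver)
open import Data.Vec.Functional using (Vector)
open import Function.Definitions using (Congruent; Bijective)
open import Level using (0ℓ)
open import Relation.Binary.Core using (Rel)
open import Relation.Binary.PropositionalEquality
  using (_≡_; _≢_; refl; sym; trans; cong; cong₂; subst)

------------------------------------------------------------------------
-- Real numbers, as Cauchy sequences of rationals.
-- Operations are pointwise; equality is the setoid relation _≈ℝ_.

IsCauchy : (ℕ → ℚ) → Set
IsCauchy x = ∀ ε → 0ℚ ℚ.< ε →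
  ∃ λ N → ∀ m n → N ℕ.≤ m → N ℕ.≤ n → ∣ x m ℚ.- x n ∣ ℚ.≤ ε

record ℝ : Set where
  constructor mkℝ
  field
    seq    : ℕ → ℚ
    cauchy : IsCauchy seq

open ℝ public

private
  split-sum : ∀ p q r s → (p ℚ.+ q) ℚ.- (r ℚ.+ s) ≡ (p ℚ.- r) ℚ.+ (q ℚ.- s)
  split-sum = solve 4 (λ p q r s →
    (p :+ q) :- (r :+ s) := (p :- r) :+ (q :- s)) refl
    where open +-*-Solver

  split-product : ∀ p q r s →
    (p ℚ.* q) ℚ.- (r ℚ.* s) ≡ p ℚ.* (q ℚ.- s) ℚ.+ (p ℚ.- r) ℚ.* s
  split-product = solve 4 (λ p q r s →
    (p :* q) :- (r :* s) := p :* (q :- s) :+ (p :- r) :* s) refl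
    where open +-*-Solver

  split-neg : ∀ p q → (ℚ.- p) ℚ.- (ℚ.- q) ≡ ℚ.- (p ℚ.- q)
  split-neg = solve 2 (λ p q → (:- p) :- (:- q) := :- (p :- q)) refl
    where open +-*-Solver

  cancel-mid : ∀ p q → p ≡ (p ℚ.- q) ℚ.+ q
  cancel-mid = solve 2 (λ p q → p := (p :- q) :+ q) refl
    where open +-*-Solver

  half+half : ∀ ε → ½ ℚ.* ε ℚ.+ ½ ℚ.* ε ≡ ε
  half+half ε = trans (sym (ℚ.*-distribʳ-+ ε ½ ½)) (ℚ.*-identityˡ ε)

  0<p*q : ∀ {p q} → 0ℚ ℚ.< p → 0ℚ ℚ.< q → 0ℚ ℚ.< p ℚ.* q
  0<p*q {p} {q} 0<p 0<q = ℚ.positive⁻¹ (p ℚ.* q)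
    {{ℚ.pos*pos⇒pos p {{ℚ.positive 0<p}} q {{ℚ.positive 0<q}}}}

  0<½ : 0ℚ ℚ.< ½
  0<½ = ℚ.positive⁻¹ ½

  0<1 : 0ℚ ℚ.< 1ℚ
  0<1 = ℚ.positive⁻¹ 1ℚ

  *-mono-≤-abs : ∀ {p q B δ} → ∣ p ∣ ℚ.≤ B → ∣ q ∣ ℚ.≤ δ → ∣ p ℚ.* q ∣ ℚ.≤ B ℚ.* δ
  *-mono-≤-abs {p} {q} {B} {δ} p≤B q≤δ = begin
    ∣ p ℚ.* q ∣      ≡⟨ ℚ.∣p*q∣≡∣p∣*∣q∣ p q ⟩
    ∣ p ∣ ℚ.* ∣ q ∣  ≤⟨ ℚ.*-monoʳ-≤-nonNeg ∣ q ∣ {{ℚ.∣-∣-nonNeg q}} p≤B ⟩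
    B ℚ.* ∣ q ∣      ≤⟨ ℚ.*-monoˡ-≤-nonNeg B
                          {{ℚ.nonNegative (ℚ.≤-trans (ℚ.0≤∣p∣ p) p≤B)}} q≤δ ⟩
    B ℚ.* δ          ∎
    where open ℚ.≤-Reasoning

  -- abstract, so that the moduli are never unfolded during type checking
  abstract
    const-cauchy : ∀ q → IsCauchy (λ _ → q)
    const-cauchy q ε 0<ε = 0 , λ _ _ _ _ →
      subst (λ p → ∣ p ∣ ℚ.≤ ε) (sym (ℚ.+-inverseʳ q)) (ℚ.<⇒≤ 0<ε)

    +-cauchy : ∀ {x y} → IsCauchy x → IsCauchy y → IsCauchy (λ n → x n ℚ.+ y n)
    +-cauchy {x} {y} cx cy ε 0<ε =
      let 0<ε/2  = 0<p*q 0<½ 0<ε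
          M , hx = cx (½ ℚ.* ε) 0<ε/2
          N , hy = cy (½ ℚ.* ε) 0<ε/2
      in M ℕ.⊔ N , λ m n ≤m ≤n → begin
        ∣ (x m ℚ.+ y m) ℚ.- (x n ℚ.+ y n) ∣
          ≡⟨ cong ∣_∣ (split-sum (x m) (y m) (x n) (y n)) ⟩
        ∣ (x m ℚ.- x n) ℚ.+ (y m ℚ.- y n) ∣
          ≤⟨ ℚ.∣p+q∣≤∣p∣+∣q∣ (x m ℚ.- x n) (y m ℚ.- y n) ⟩
        ∣ x m ℚ.- x n ∣ ℚ.+ ∣ y m ℚ.- y n ∣
          ≤⟨ ℚ.+-mono-≤ (hx m n (ℕ.m⊔n≤o⇒m≤o M N ≤m) (ℕ.m⊔n≤o⇒m≤o M N ≤n))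
                        (hy m n (ℕ.m⊔n≤o⇒n≤o M N ≤m) (ℕ.m⊔n≤o⇒n≤o M N ≤n)) ⟩
        ½ ℚ.* ε ℚ.+ ½ ℚ.* ε
          ≡⟨ half+half ε ⟩
        ε ∎
      where open ℚ.≤-Reasoning

    neg-cauchy : ∀ {x} → IsCauchy x → IsCauchy (λ n → ℚ.- x n)
    neg-cauchy {x} cx ε 0<ε =
      let N , hx = cx ε 0<ε
      in N , λ m n ≤m ≤n → subst (ℚ._≤ ε)
           (sym (trans (cong ∣_∣ (split-neg (x m) (x n))) (ℚ.∣-p∣≡∣p∣ (x m ℚ.- x n))))
           (hx m n ≤m ≤n)

    eventually-bounded : ∀ {x} → IsCauchy x →
      ∃₂ λ B N → 0ℚ ℚ.< B × (∀ n → N ℕ.≤ n → ∣ x n ∣ ℚ.≤ B)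
    eventually-bounded {x} cx =
      let N , hx = cx 1ℚ 0<1
      in 1ℚ ℚ.+ ∣ x N ∣ , N , ℚ.+-mono-<-≤ 0<1 (ℚ.0≤∣p∣ (x N)) , λ n N≤n → begin
        ∣ x n ∣                        ≡⟨ cong ∣_∣ (cancel-mid (x n) (x N)) ⟩
        ∣ (x n ℚ.- x N) ℚ.+ x N ∣      ≤⟨ ℚ.∣p+q∣≤∣p∣+∣q∣ (x n ℚ.- x N) (x N) ⟩
        ∣ x n ℚ.- x N ∣ ℚ.+ ∣ x N ∣    ≤⟨ ℚ.+-monoˡ-≤ ∣ x N ∣ (hx n N N≤n ℕ.≤-refl) ⟩
        1ℚ ℚ.+ ∣ x N ∣                 ∎
      where open ℚ.≤-Reasoning

    divide : ∀ {ε B} → 0ℚ ℚ.< ε → 0ℚ ℚ.< B → ∃ λ δ → 0ℚ ℚ.< δ × B ℚ.* δ ≡ ε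
    divide {ε} {B} 0<ε 0<B = B⁻¹ ℚ.* ε , 0<p*q 0<B⁻¹ 0<ε ,
      trans (sym (ℚ.*-assoc B B⁻¹ ε))
            (trans (cong (ℚ._* ε) (ℚ.*-inverseʳ B)) (ℚ.*-identityˡ ε))
      where
      instance
        B-pos : ℚ.Positive B
        B-pos = ℚ.positive 0<B
        B-nonZero : ℚ.NonZero B
        B-nonZero = ℚ.pos⇒nonZero B
      B⁻¹ : ℚ
      B⁻¹ = ℚ.1/ B
      0<B⁻¹ : 0ℚ ℚ.< B⁻¹
      0<B⁻¹ = ℚ.positive⁻¹ B⁻¹ {{ℚ.1/pos⇒pos B}}

    *-cauchy : ∀ {x y} → IsCauchy x → IsCauchy y → IsCauchy (λ n → x n ℚ.* y n)
    *-cauchy {x} {y} cx cy ε 0<ε =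
      let B , K , 0<B , x≤B = eventually-bounded cx
          C , L , 0<C , y≤C = eventually-bounded cy
          δ , 0<δ , [B+C]δ≡ε = divide 0<ε (ℚ.+-mono-< 0<B 0<C)
          M , hx = cx δ 0<δ
          N , hy = cy δ 0<δ
      in (K ℕ.⊔ L) ℕ.⊔ (M ℕ.⊔ N) , λ m n ≤m ≤n →
        let KL≤m = ℕ.m⊔n≤o⇒m≤o (K ℕ.⊔ L) (M ℕ.⊔ N) ≤m
            KL≤n = ℕ.m⊔n≤o⇒m≤o (K ℕ.⊔ L) (M ℕ.⊔ N) ≤n
            MN≤m = ℕ.m⊔n≤o⇒n≤o (K ℕ.⊔ L) (M ℕ.⊔ N) ≤m
            MN≤n = ℕ.m⊔n≤o⇒n≤o (K ℕ.⊔ L) (M ℕ.⊔ N) ≤n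
        in begin
        ∣ (x m ℚ.* y m) ℚ.- (x n ℚ.* y n) ∣
          ≡⟨ cong ∣_∣ (split-product (x m) (y m) (x n) (y n)) ⟩
        ∣ x m ℚ.* (y m ℚ.- y n) ℚ.+ (x m ℚ.- x n) ℚ.* y n ∣
          ≤⟨ ℚ.∣p+q∣≤∣p∣+∣q∣ (x m ℚ.* (y m ℚ.- y n)) ((x m ℚ.- x n) ℚ.* y n) ⟩
        ∣ x m ℚ.* (y m ℚ.- y n) ∣ ℚ.+ ∣ (x m ℚ.- x n) ℚ.* y n ∣
          ≤⟨ ℚ.+-mono-≤
               (*-mono-≤-abs {x m} {y m ℚ.- y n} (x≤B m (ℕ.m⊔n≤o⇒m≤o K L KL≤m))
                 (hy m n (ℕ.m⊔n≤o⇒n≤o M N MN≤m) (ℕ.m⊔n≤o⇒n≤o M N MN≤n)))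
               (*-mono-≤-abs {x m ℚ.- x n} {y n}
                 (hx m n (ℕ.m⊔n≤o⇒m≤o M N MN≤m) (ℕ.m⊔n≤o⇒m≤o M N MN≤n))
                 (y≤C n (ℕ.m⊔n≤o⇒n≤o K L KL≤n))) ⟩
        B ℚ.* δ ℚ.+ δ ℚ.* C
          ≡⟨ cong (B ℚ.* δ ℚ.+_) (ℚ.*-comm δ C) ⟩
        B ℚ.* δ ℚ.+ C ℚ.* δ
          ≡⟨ sym (ℚ.*-distribʳ-+ δ B C) ⟩
        (B ℚ.+ C) ℚ.* δ
          ≡⟨ [B+C]δ≡ε ⟩
        ε ∎
      where open ℚ.≤-Reasoning

-- Eventual closeness of representatives.  It implies ∣ x - y ∣ ≤ ε and is
-- implied by ∣ x - y ∣ < ε, so quantifying it over all ε > 0 gives the usual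
-- notions of equality and convergence.
infix 4 _≈ℝ[_]_ _≈ℝ_

_≈ℝ[_]_ : ℝ → ℚ → ℝ → Set
x ≈ℝ[ ε ] y = ∃ λ N → ∀ n → N ℕ.≤ n → ∣ seq x n ℚ.- seq y n ∣ ℚ.≤ ε

record _≈ℝ_ (x y : ℝ) : Set where
  constructor mk≈ℝ
  field
    close : ∀ ε → 0ℚ ℚ.< ε → x ≈ℝ[ ε ] y

open _≈ℝ_ public

infixl 6 _+ℝ_ _-ℝ_
infixl 7 _*ℝ_
infix  8 -ℝ_

fromℚ : ℚ → ℝ
fromℚ q = mkℝ (λ _ → q) (const-cauchy q)

0ℝ 1ℝ : ℝ
0ℝ = fromℚ 0ℚ
1ℝ = fromℚ 1ℚ

_+ℝ_ _*ℝ_ : ℝ → ℝ → ℝ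
x +ℝ y = mkℝ (λ n → seq x n ℚ.+ seq y n) (+-cauchy {seq x} {seq y} (cauchy x) (cauchy y))
x *ℝ y = mkℝ (λ n → seq x n ℚ.* seq y n) (*-cauchy {seq x} {seq y} (cauchy x) (cauchy y))

-ℝ_ : ℝ → ℝ
-ℝ x = mkℝ (λ n → ℚ.- seq x n) (neg-cauchy {seq x} (cauchy x))

_-ℝ_ : ℝ → ℝ → ℝ
x -ℝ y = x +ℝ (-ℝ y)

------------------------------------------------------------------------
-- Complex numbers

infixl 6 _+_
infixl 7 _*_
infix  8 -_
infix  4 _≈_

record ℂ : Set where
  constructor _+i_
  field
    re im : ℝ

open ℂ public

record _≈_ (w z : ℂ) : Set where
  constructor _,≈_
  field
    re-≈ : re w ≈ℝ re z
    im-≈ : im w ≈ℝ im z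

open _≈_ public

0ℂ 1ℂ : ℂ
0ℂ = 0ℝ +i 0ℝ
1ℂ = 1ℝ +i 0ℝ

_+_ _*_ : ℂ → ℂ → ℂ
w + z = (re w +ℝ re z) +i (im w +ℝ im z)
w * z = (re w *ℝ re z -ℝ im w *ℝ im z) +i (re w *ℝ im z +ℝ im w *ℝ re z)

-_ : ℂ → ℂ
- z = (-ℝ re z) +i (-ℝ im z)

conj : ℂ → ℂ
conj z = re z +i (-ℝ im z)

ℂ-rawRing : RawRing 0ℓ 0ℓ
ℂ-rawRing = record
  { Carrier = ℂ
  ; _≈_     = _≈_
  ; _+_     = _+_
  ; _*_     = _*_
  ; -_      = -_
  ; 0#      = 0ℂ
  ; 1#      = 1ℂ
  }

open RawSemiringDefinitions (RawRing.rawSemiring ℂ-rawRing) public using (sum; _^_)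

infix 4 _⟶_

_⟶_ : (ℕ → ℂ) → ℂ → Set
s ⟶ z = ∀ ε → 0ℚ ℚ.< ε → ∃ λ N → ∀ n → N ℕ.≤ n →
  re (s n) ≈ℝ[ ε ] re z × im (s n) ≈ℝ[ ε ] im z

1/_! : ℕ → ℚ
1/ k ! = (+ 1 ℚ./ (k !)) {{k ℕ.!≢0}}

expPartialSum : ℂ → ℕ → ℂ
expPartialSum z m = sum {m} λ k → (fromℚ (1/ toℕ k !) +i 0ℝ) * z ^ toℕ k

infix 4 _≈exp_

-- w ≈exp z : w is the value at z of the exponential series.
_≈exp_ : ℂ → ℂ → Set
w ≈exp z = expPartialSum z ⟶ w

------------------------------------------------------------------------
-- The inner product space ℂⁿ

ℂ^_ : ℕ → Set
ℂ^ n = Vector ℂ n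

⟨_,_⟩ : ∀ {n} → ℂ^ n → ℂ^ n → ℂ
⟨ u , v ⟩ = sum λ k → conj (u k) * v k

IsUnit : ∀ {n} → ℂ^ n → Set
IsUnit v = ⟨ v , v ⟩ ≈ 1ℂ

record IsOrthonormalBasis {n} (b : Fin n → ℂ^ n) : Set where
  field
    unit       : ∀ i → IsUnit (b i)
    orthogonal : ∀ i j → i ≢ j → ⟨ b i , b j ⟩ ≈ 0ℂ
    spanning   : ∀ (v : ℂ^ n) → ∃ λ (a : Fin n → ℂ) →
                 ∀ k → v k ≈ sum λ i → a i * b i k

infix 4 _∼_

-- u = e^{iα} v for some real α
_∼_ : ∀ {n} → Rel (ℂ^ n) 0ℓ
u ∼ v = ∃₂ λ (α : ℝ) (w : ℂ) → w ≈exp (0ℝ +i α) × (∀ k → u k ≈ w * v k)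

------------------------------------------------------------------------
-- Quantum Latin squares

record QLS (n : ℕ) : Set where
  field
    entry  : Fin n → Fin n → ℂ^ n
    unit   : ∀ i j → IsUnit (entry i j)
    row    : ∀ i → IsOrthonormalBasis (λ j → entry i j)
    column : ∀ j → IsOrthonormalBasis (λ i → entry i j)

EntryEquiv : ∀ {n} → QLS n → Rel (Fin n × Fin n) 0ℓ
EntryEquiv Φ (i , j) (k , l) = QLS.entry Φ i j ∼ QLS.entry Φ k l

-- The quotient of the n² positions by phase equivalence of their entries is
-- in bijection with Fin c.
HasCardinality : ∀ {n} → QLS n → ℕ → Set
HasCardinality {n} Φ c = ∃ λ (class : Fin n × Fin n → Fin c) →
  Congruent (EntryEquiv Φ) _≡_ class × Bijective (EntryEquiv Φ) _≡_ class

{-# OPTIONS --safe #-}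

-- If a quantum Latin square of order n has n + 1 classes, then every row omits
-- exactly one of them.  The class x omitted by row 0 occurs in some row i.
-- Row i meets all the rays of row 0 except at most one, so its entry of class x
-- is orthogonal to these and lies on the remaining ray of row 0, which makes x
-- the class of that ray.  As phase equivalence asks for an angle, proportional
-- unit vectors are equivalent only because every w of modulus 1 is e^{iα} for
-- some α.  This angle is found by iteration: rotating z by - im z brings it
-- closer to 1 by a constant factor, and α is the sum of the angles used.
--
-- The squares come from a computer search for orthogonal bases among vectors of
-- Gaussian integers of equal norm.  Their defining properties are decidable,
-- since parallelism of such vectors can be tested by cross products.

module Submission where

open import Defs
open import Algebra.Bundles using (CommutativeRing)
import Algebra.Properties.CommutativeSemigroup as CommutativeSemigroupProperties
import Algebra.Properties.Group as GroupProperties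
import Algebra.Properties.Semiring.Sum as SemiringSum
import Algebra.Solver.Ring.AlmostCommutativeRing as ACR
import Algebra.Solver.Ring.Simple as RingSolver
open import Algebra.Structures using (IsCommutativeRing)
open import Data.Bool.Base using (if_then_else_)
open import Data.Empty using (⊥)
open import Data.Fin.Base using (Fin; zero; suc; punchOut; toℕ)
open import Data.Fin.Properties as Fin using (_≟_; any?; all?; punchOut-injective; injective⇒≤)
open import Data.Integer.Base as ℤ using (+_; ℤ; 0ℤ; 1ℤ)
import Data.Integer.Properties as ℤ
open import Data.List.Base using (List; []; _∷_)
open import Data.List.Membership.Propositional using (_∈_)
open import Data.List.Relation.Unary.All as All using (All; []; _∷_)
open import Data.Nat.Base as ℕ using (ℕ; zero; suc; _!; _≤_; s≤s)
open import Data.Nat.DivMod using (_mod_)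
import Data.Nat.Properties as ℕ
open import Data.Product.Base using (∃; ∃₂; _×_; _,_; proj₁; proj₂)
open import Data.Product.Properties using (≡-dec)
open import Data.Rational.Base as ℚ using (ℚ; 0ℚ; 1ℚ; ½; ∣_∣)
import Data.Rational.Properties as ℚ
open import Data.Rational.Solver using (module +-*-Solver)
import Data.Rational.Unnormalised.Base as ℚᵘ
import Data.Rational.Unnormalised.Properties as ℚᵘ
open import Data.Sum.Base using (inj₁; inj₂; _⊎_; [_,_]′)
open import Data.Vec.Base as Vec using (Vec; []; _∷_; lookup)
open import Function.Base using (_∘_; flip)
open import Function.Definitions using (Congruent) renaming (Injective to Injectiveₛ)
open import Level using (0ℓ)
open import Relation.Binary.PropositionalEquality as ≡
  using (_≡_; refl; sym; trans; cong; cong₂; subst; isEquivalence; _≢_; subst₂; module ≡-Reasoning)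
open import Relation.Nullary.Decidable
  using (Dec; yes; no; ¬?; decidable-stable; from-no; from-yes; does; True; toWitness; map′;
    dec-true; dec-false; _×-dec_; _⊎-dec_; _→-dec_)
open import Relation.Nullary.Negation using (¬_; contradiction)
open import Data.List.Membership.DecPropositional ℕ._≟_ using (_∈?_)

-- Neither the sign of a Cauchy real nor the equality of two of them can be decided, which shapes
-- the whole argument. Case distinctions are made on classes, which are finite in number, or on
-- single rational terms of a sequence with room left for the error.
--
-- The value e^{iα} is formed along a diagonal: its `n`-th term is the `n`-th partial sum of the
-- series at the `n`-th term of `α`. Since the argument moves with the index, every estimate for the
-- series has to be uniform on a ball of rational arguments. Each rotation uses a rational angle,
-- one term of the sequence of `- im z`, so that the partial sums of the angles are themselves the
-- rational sequence representing the final angle. The price is an error in modulus and in angle at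
-- each step, which the contraction factor absorbs.
--
-- For the explicit squares only the angle 0 is used: equal classes carry the same vector, and
-- different classes are separated by a nonvanishing cross product. The squared norm is a perfect
-- square, so normalised coordinates are rational and every condition is an identity between
-- integers.

-- Inequalities between rationals

½*ε+½*ε≡ε : ∀ ε → ½ ℚ.* ε ℚ.+ ½ ℚ.* ε ≡ ε
½*ε+½*ε≡ε ε = trans (sym (ℚ.*-distribʳ-+ ε ½ ½)) (ℚ.*-identityˡ ε)

0<p*q : ∀ {p q} → 0ℚ ℚ.< p → 0ℚ ℚ.< q → 0ℚ ℚ.< p ℚ.* q
0<p*q {p} {q} 0<p 0<q = ℚ.positive⁻¹ (p ℚ.* q)
  {{ℚ.pos*pos⇒pos p {{ℚ.positive 0<p}} q {{ℚ.positive 0<q}}}}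

0<½*ε : ∀ {ε} → 0ℚ ℚ.< ε → 0ℚ ℚ.< ½ ℚ.* ε
0<½*ε = 0<p*q (ℚ.positive⁻¹ ½)

*-mono-≤-∣∣ : ∀ {p q B δ} → ∣ p ∣ ℚ.≤ B → ∣ q ∣ ℚ.≤ δ → ∣ p ℚ.* q ∣ ℚ.≤ B ℚ.* δ
*-mono-≤-∣∣ {p} {q} {B} {δ} p≤B q≤δ = begin
  ∣ p ℚ.* q ∣      ≡⟨ ℚ.∣p*q∣≡∣p∣*∣q∣ p q ⟩
  ∣ p ∣ ℚ.* ∣ q ∣  ≤⟨ ℚ.*-monoʳ-≤-nonNeg ∣ q ∣ {{ℚ.∣-∣-nonNeg q}} p≤B ⟩
  B ℚ.* ∣ q ∣      ≤⟨ ℚ.*-monoˡ-≤-nonNeg B {{ℚ.nonNegative (ℚ.≤-trans (ℚ.0≤∣p∣ p) p≤B)}} q≤δ ⟩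
  B ℚ.* δ          ∎
  where open ℚ.≤-Reasoning

abstract
  ∃-divide : ∀ {ε B} → 0ℚ ℚ.< ε → 0ℚ ℚ.< B → ∃ λ δ → 0ℚ ℚ.< δ × B ℚ.* δ ≡ ε
  ∃-divide {ε} {B} 0<ε 0<B = B⁻¹ ℚ.* ε , 0<p*q (ℚ.positive⁻¹ B⁻¹ {{ℚ.1/pos⇒pos B}}) 0<ε ,
    trans (sym (ℚ.*-assoc B B⁻¹ ε)) (trans (cong (ℚ._* ε) (ℚ.*-inverseʳ B)) (ℚ.*-identityˡ ε))
    where
    instance
      B-pos : ℚ.Positive B
      B-pos = ℚ.positive 0<B
      B-nonZero : ℚ.NonZero B
      B-nonZero = ℚ.pos⇒nonZero B
    B⁻¹ : ℚ
    B⁻¹ = ℚ.1/ B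

∣p-q∣≡∣q-p∣ : ∀ p q → ∣ p ℚ.- q ∣ ≡ ∣ q ℚ.- p ∣
∣p-q∣≡∣q-p∣ p q = trans (cong ∣_∣ (solve 2 (λ p q → p :- q := :- (q :- p)) refl p q)) (ℚ.∣-p∣≡∣p∣ (q ℚ.- p))
  where open +-*-Solver

∣p∣≤∣p-q∣+∣q∣ : ∀ p q → ∣ p ∣ ℚ.≤ ∣ p ℚ.- q ∣ ℚ.+ ∣ q ∣
∣p∣≤∣p-q∣+∣q∣ p q = subst (λ r → ∣ r ∣ ℚ.≤ ∣ p ℚ.- q ∣ ℚ.+ ∣ q ∣)
  (solve 2 (λ p q → (p :- q) :+ q := p) refl p q) (ℚ.∣p+q∣≤∣p∣+∣q∣ (p ℚ.- q) q)
  where open +-*-Solver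

-- Equality of Cauchy reals

≈ℝ-pointwise : ∀ {x y} → (∀ n → seq x n ≡ seq y n) → x ≈ℝ y
≈ℝ-pointwise {x} {y} x≡y = mk≈ℝ λ ε 0<ε → 0 , λ n _ →
  subst (ℚ._≤ ε) (sym (cong ∣_∣ (trans (cong (ℚ._- seq y n) (x≡y n)) (ℚ.+-inverseʳ (seq y n)))))
    (ℚ.<⇒≤ 0<ε)

≈ℝ-refl : ∀ {x} → x ≈ℝ x
≈ℝ-refl {x} = ≈ℝ-pointwise {x} {x} λ _ → refl

≈ℝ-sym : ∀ {x y} → x ≈ℝ y → y ≈ℝ x
≈ℝ-sym {x} {y} (mk≈ℝ x≈y) = mk≈ℝ λ ε 0<ε →
  let N , h = x≈y ε 0<ε in N , λ n N≤n → subst (ℚ._≤ ε) (∣p-q∣≡∣q-p∣ (seq x n) (seq y n)) (h n N≤n)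

≈ℝ-trans : ∀ {x y z} → x ≈ℝ y → y ≈ℝ z → x ≈ℝ z
≈ℝ-trans {x} {y} {z} (mk≈ℝ x≈y) (mk≈ℝ y≈z) = mk≈ℝ λ ε 0<ε →
  let M , h = x≈y (½ ℚ.* ε) (0<½*ε 0<ε)
      N , k = y≈z (½ ℚ.* ε) (0<½*ε 0<ε)
  in M ℕ.⊔ N , λ n ≤n → begin
    ∣ seq x n ℚ.- seq z n ∣
      ≡⟨ cong ∣_∣ (solve 3 (λ p q r → p :- r := (p :- q) :+ (q :- r)) refl (seq x n) (seq y n) (seq z n)) ⟩
    ∣ (seq x n ℚ.- seq y n) ℚ.+ (seq y n ℚ.- seq z n) ∣
      ≤⟨ ℚ.∣p+q∣≤∣p∣+∣q∣ (seq x n ℚ.- seq y n) (seq y n ℚ.- seq z n) ⟩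
    ∣ seq x n ℚ.- seq y n ∣ ℚ.+ ∣ seq y n ℚ.- seq z n ∣
      ≤⟨ ℚ.+-mono-≤ (h n (ℕ.m⊔n≤o⇒m≤o M N ≤n)) (k n (ℕ.m⊔n≤o⇒n≤o M N ≤n)) ⟩
    ½ ℚ.* ε ℚ.+ ½ ℚ.* ε
      ≡⟨ ½*ε+½*ε≡ε ε ⟩
    ε ∎
  where open ℚ.≤-Reasoning
        open +-*-Solver

-ℝ-cong : ∀ {x y} → x ≈ℝ y → -ℝ x ≈ℝ -ℝ y
-ℝ-cong {x} {y} (mk≈ℝ x≈y) = mk≈ℝ λ ε 0<ε →
  let N , h = x≈y ε 0<ε in N , λ n N≤n → subst (ℚ._≤ ε)
    (trans (∣p-q∣≡∣q-p∣ (seq x n) (seq y n)) (cong ∣_∣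
      (solve 2 (λ p q → q :- p := :- p :- :- q) refl (seq x n) (seq y n)))) (h n N≤n)
  where open +-*-Solver

+ℝ-cong : ∀ {x x′ y y′} → x ≈ℝ x′ → y ≈ℝ y′ → x +ℝ y ≈ℝ x′ +ℝ y′
+ℝ-cong {x} {x′} {y} {y′} (mk≈ℝ x≈x′) (mk≈ℝ y≈y′) = mk≈ℝ λ ε 0<ε →
  let M , h = x≈x′ (½ ℚ.* ε) (0<½*ε 0<ε)
      N , k = y≈y′ (½ ℚ.* ε) (0<½*ε 0<ε)
  in M ℕ.⊔ N , λ n ≤n → begin
    ∣ (seq x n ℚ.+ seq y n) ℚ.- (seq x′ n ℚ.+ seq y′ n) ∣
      ≡⟨ cong ∣_∣ (solve 4 (λ p q r s → (p :+ q) :- (r :+ s) := (p :- r) :+ (q :- s)) refl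
           (seq x n) (seq y n) (seq x′ n) (seq y′ n)) ⟩
    ∣ (seq x n ℚ.- seq x′ n) ℚ.+ (seq y n ℚ.- seq y′ n) ∣
      ≤⟨ ℚ.∣p+q∣≤∣p∣+∣q∣ (seq x n ℚ.- seq x′ n) (seq y n ℚ.- seq y′ n) ⟩
    ∣ seq x n ℚ.- seq x′ n ∣ ℚ.+ ∣ seq y n ℚ.- seq y′ n ∣
      ≤⟨ ℚ.+-mono-≤ (h n (ℕ.m⊔n≤o⇒m≤o M N ≤n)) (k n (ℕ.m⊔n≤o⇒n≤o M N ≤n)) ⟩
    ½ ℚ.* ε ℚ.+ ½ ℚ.* ε
      ≡⟨ ½*ε+½*ε≡ε ε ⟩
    ε ∎
  where open ℚ.≤-Reasoning
        open +-*-Solver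

abstract
  eventually-bounded : ∀ x → ∃₂ λ B N → 0ℚ ℚ.< B × (∀ n → N ℕ.≤ n → ∣ seq x n ∣ ℚ.≤ B)
  eventually-bounded x =
    let N , h = cauchy x 1ℚ (ℚ.positive⁻¹ 1ℚ)
    in 1ℚ ℚ.+ ∣ seq x N ∣ , N , ℚ.+-mono-<-≤ (ℚ.positive⁻¹ 1ℚ) (ℚ.0≤∣p∣ (seq x N)) ,
       λ n N≤n → ℚ.≤-trans (∣p∣≤∣p-q∣+∣q∣ (seq x n) (seq x N))
         (ℚ.+-monoˡ-≤ ∣ seq x N ∣ (h n N N≤n ℕ.≤-refl))

*ℝ-cong : ∀ {x x′ y y′} → x ≈ℝ x′ → y ≈ℝ y′ → x *ℝ y ≈ℝ x′ *ℝ y′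
*ℝ-cong {x} {x′} {y} {y′} (mk≈ℝ x≈x′) (mk≈ℝ y≈y′) = mk≈ℝ λ ε 0<ε →
  let B , K , 0<B , x≤B  = eventually-bounded x
      C , L , 0<C , y′≤C = eventually-bounded y′
      δ , 0<δ , [B+C]δ≡ε = ∃-divide 0<ε (ℚ.+-mono-< 0<B 0<C)
      M , h = x≈x′ δ 0<δ
      N , k = y≈y′ δ 0<δ
  in (K ℕ.⊔ L) ℕ.⊔ (M ℕ.⊔ N) , λ n ≤n →
    let KL≤n = ℕ.m⊔n≤o⇒m≤o (K ℕ.⊔ L) (M ℕ.⊔ N) ≤n
        MN≤n = ℕ.m⊔n≤o⇒n≤o (K ℕ.⊔ L) (M ℕ.⊔ N) ≤n
    in begin
    ∣ (seq x n ℚ.* seq y n) ℚ.- (seq x′ n ℚ.* seq y′ n) ∣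
      ≡⟨ cong ∣_∣ (solve 4 (λ p q r s → (p :* q) :- (r :* s) := p :* (q :- s) :+ (p :- r) :* s) refl
           (seq x n) (seq y n) (seq x′ n) (seq y′ n)) ⟩
    ∣ seq x n ℚ.* (seq y n ℚ.- seq y′ n) ℚ.+ (seq x n ℚ.- seq x′ n) ℚ.* seq y′ n ∣
      ≤⟨ ℚ.∣p+q∣≤∣p∣+∣q∣ (seq x n ℚ.* (seq y n ℚ.- seq y′ n)) ((seq x n ℚ.- seq x′ n) ℚ.* seq y′ n) ⟩
    ∣ seq x n ℚ.* (seq y n ℚ.- seq y′ n) ∣ ℚ.+ ∣ (seq x n ℚ.- seq x′ n) ℚ.* seq y′ n ∣
      ≤⟨ ℚ.+-mono-≤
           (*-mono-≤-∣∣ {seq x n} (x≤B n (ℕ.m⊔n≤o⇒m≤o K L KL≤n)) (k n (ℕ.m⊔n≤o⇒n≤o M N MN≤n)))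
           (*-mono-≤-∣∣ {seq x n ℚ.- seq x′ n} (h n (ℕ.m⊔n≤o⇒m≤o M N MN≤n)) (y′≤C n (ℕ.m⊔n≤o⇒n≤o K L KL≤n))) ⟩
    B ℚ.* δ ℚ.+ δ ℚ.* C
      ≡⟨ solve 3 (λ b c d → b :* d :+ d :* c := (b :+ c) :* d) refl B C δ ⟩
    (B ℚ.+ C) ℚ.* δ
      ≡⟨ [B+C]δ≡ε ⟩
    ε ∎
  where open ℚ.≤-Reasoning
        open +-*-Solver

-- Gaussian rationals.  A complex number is a sequence of them, and the
-- operations of ℂ act termwise.

ℚ[i] : Set
ℚ[i] = ℚ × ℚ

infixl 6 _⊕_
infixl 7 _⊗_
infix  8 ⊖_

_⊕_ _⊗_ : ℚ[i] → ℚ[i] → ℚ[i]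
(a , b) ⊕ (c , d) = a ℚ.+ c , b ℚ.+ d
(a , b) ⊗ (c , d) = a ℚ.* c ℚ.- b ℚ.* d , a ℚ.* d ℚ.+ b ℚ.* c

⊖_ conjᵢ : ℚ[i] → ℚ[i]
⊖ (a , b) = ℚ.- a , ℚ.- b
conjᵢ (a , b) = a , ℚ.- b

0ᵢ 1ᵢ : ℚ[i]
0ᵢ = 0ℚ , 0ℚ
1ᵢ = 1ℚ , 0ℚ

ℚ[i]-isCommutativeRing : IsCommutativeRing _≡_ _⊕_ _⊗_ ⊖_ 0ᵢ 1ᵢ
ℚ[i]-isCommutativeRing = record
  { isRing = record
    { +-isAbelianGroup = record
      { isGroup = record
        { isMonoid = record
          { isSemigroup = record
            { isMagma = record { isEquivalence = isEquivalence ; ∙-cong = cong₂ _⊕_ }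
            ; assoc = λ (a , b) (c , d) (e , f) → cong₂ _,_ (ℚ.+-assoc a c e) (ℚ.+-assoc b d f)
            }
          ; identity = (λ (a , b) → cong₂ _,_ (ℚ.+-identityˡ a) (ℚ.+-identityˡ b))
                     , (λ (a , b) → cong₂ _,_ (ℚ.+-identityʳ a) (ℚ.+-identityʳ b))
          }
        ; inverse = (λ (a , b) → cong₂ _,_ (ℚ.+-inverseˡ a) (ℚ.+-inverseˡ b))
                  , (λ (a , b) → cong₂ _,_ (ℚ.+-inverseʳ a) (ℚ.+-inverseʳ b))
        ; ⁻¹-cong = cong ⊖_
        }
      ; comm = λ (a , b) (c , d) → cong₂ _,_ (ℚ.+-comm a c) (ℚ.+-comm b d)
      }
    ; *-cong = cong₂ _⊗_
    ; *-assoc = λ (a , b) (c , d) (e , f) → cong₂ _,_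
        (solve 6 (λ a b c d e f → (a :* c :- b :* d) :* e :- (a :* d :+ b :* c) :* f
                                := a :* (c :* e :- d :* f) :- b :* (c :* f :+ d :* e)) refl a b c d e f)
        (solve 6 (λ a b c d e f → (a :* c :- b :* d) :* f :+ (a :* d :+ b :* c) :* e
                                := a :* (c :* f :+ d :* e) :+ b :* (c :* e :- d :* f)) refl a b c d e f)
    ; *-identity = (λ (a , b) → cong₂ _,_
                     (solve 2 (λ a b → con 1ℚ :* a :- con 0ℚ :* b := a) refl a b)
                     (solve 2 (λ a b → con 1ℚ :* b :+ con 0ℚ :* a := b) refl a b))
                 , (λ (a , b) → cong₂ _,_
                     (solve 2 (λ a b → a :* con 1ℚ :- b :* con 0ℚ := a) refl a b)
                     (solve 2 (λ a b → a :* con 0ℚ :+ b :* con 1ℚ := b) refl a b))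
    ; distrib = (λ (a , b) (c , d) (e , f) → cong₂ _,_
                  (solve 6 (λ a b c d e f → a :* (c :+ e) :- b :* (d :+ f)
                                          := (a :* c :- b :* d) :+ (a :* e :- b :* f)) refl a b c d e f)
                  (solve 6 (λ a b c d e f → a :* (d :+ f) :+ b :* (c :+ e)
                                          := (a :* d :+ b :* c) :+ (a :* f :+ b :* e)) refl a b c d e f))
              , (λ (a , b) (c , d) (e , f) → cong₂ _,_
                  (solve 6 (λ a b c d e f → (c :+ e) :* a :- (d :+ f) :* b
                                          := (c :* a :- d :* b) :+ (e :* a :- f :* b)) refl a b c d e f)
                  (solve 6 (λ a b c d e f → (c :+ e) :* b :+ (d :+ f) :* a
                                          := (c :* b :+ d :* a) :+ (e :* b :+ f :* a)) refl a b c d e f))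
    }
  ; *-comm = λ (a , b) (c , d) → cong₂ _,_
      (solve 4 (λ a b c d → a :* c :- b :* d := c :* a :- d :* b) refl a b c d)
      (solve 4 (λ a b c d → a :* d :+ b :* c := c :* b :+ d :* a) refl a b c d)
  }
  where open +-*-Solver

ℚ[i]-commutativeRing : CommutativeRing 0ℓ 0ℓ
ℚ[i]-commutativeRing = record { isCommutativeRing = ℚ[i]-isCommutativeRing }

-- The commutative ring of complex numbers

at : ℕ → ℂ → ℚ[i]
at n z = seq (re z) n , seq (im z) n

≈-pointwise : ∀ {z w} → (∀ n → at n z ≡ at n w) → z ≈ w
≈-pointwise z≡w = ≈ℝ-pointwise (λ n → cong proj₁ (z≡w n)) ,≈ ≈ℝ-pointwise (λ n → cong proj₂ (z≡w n))

-- Every ring law already holds term by term, as an equation between Gaussian rationals; limits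
-- enter only through the equivalence and the congruences.
ℂ-isCommutativeRing : IsCommutativeRing _≈_ _+_ _*_ -_ 0ℂ 1ℂ
ℂ-isCommutativeRing = record
  { isRing = record
    { +-isAbelianGroup = record
      { isGroup = record
        { isMonoid = record
          { isSemigroup = record
            { isMagma = record
              { isEquivalence = record
                { refl  = ≈ℝ-refl ,≈ ≈ℝ-refl
                ; sym   = λ (p ,≈ q) → ≈ℝ-sym p ,≈ ≈ℝ-sym q
                ; trans = λ (p ,≈ q) (r ,≈ s) → ≈ℝ-trans p r ,≈ ≈ℝ-trans q s
                }
              ; ∙-cong = λ (p ,≈ q) (r ,≈ s) → +ℝ-cong p r ,≈ +ℝ-cong q s
              }
            ; assoc = λ x y z → ≈-pointwise λ n → C.+-assoc (at n x) (at n y) (at n z)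
            }
          ; identity = (λ x → ≈-pointwise λ n → C.+-identityˡ (at n x))
                     , (λ x → ≈-pointwise λ n → C.+-identityʳ (at n x))
          }
        ; inverse = (λ x → ≈-pointwise λ n → C.-‿inverseˡ (at n x))
                  , (λ x → ≈-pointwise λ n → C.-‿inverseʳ (at n x))
        ; ⁻¹-cong = λ (p ,≈ q) → -ℝ-cong p ,≈ -ℝ-cong q
        }
      ; comm = λ x y → ≈-pointwise λ n → C.+-comm (at n x) (at n y)
      }
    ; *-cong = λ (p ,≈ q) (r ,≈ s) →
        +ℝ-cong (*ℝ-cong p r) (-ℝ-cong (*ℝ-cong q s)) ,≈ +ℝ-cong (*ℝ-cong p s) (*ℝ-cong q r)
    ; *-assoc = λ x y z → ≈-pointwise λ n → C.*-assoc (at n x) (at n y) (at n z)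
    ; *-identity = (λ x → ≈-pointwise λ n → C.*-identityˡ (at n x))
                 , (λ x → ≈-pointwise λ n → C.*-identityʳ (at n x))
    ; distrib = (λ x y z → ≈-pointwise λ n → C.distribˡ (at n x) (at n y) (at n z))
              , (λ x y z → ≈-pointwise λ n → C.distribʳ (at n x) (at n y) (at n z))
    }
  ; *-comm = λ x y → ≈-pointwise λ n → C.*-comm (at n x) (at n y)
  }
  where module C = CommutativeRing ℚ[i]-commutativeRing

ℂ-commutativeRing : CommutativeRing 0ℓ 0ℓ
ℂ-commutativeRing = record { isCommutativeRing = ℂ-isCommutativeRing }

module ℂᵣ = CommutativeRing ℂ-commutativeRing
module ∑ = SemiringSum ℂᵣ.semiring

conj-cong : ∀ {z w} → z ≈ w → conj z ≈ conj w
conj-cong (p ,≈ q) = p ,≈ -ℝ-cong q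

conj-* : ∀ z w → conj (z * w) ≈ conj z * conj w
conj-* z w = ≈-pointwise λ n → ≡.cong₂ _,_
  (solve 4 (λ a b c d → a :* c :- b :* d := a :* c :- (:- b) :* (:- d)) refl
    (seq (re z) n) (seq (im z) n) (seq (re w) n) (seq (im w) n))
  (solve 4 (λ a b c d → :- (a :* d :+ b :* c) := a :* (:- d) :+ (:- b) :* c) refl
    (seq (re z) n) (seq (im z) n) (seq (re w) n) (seq (im w) n))
  where open import Data.Rational.Solver using (module +-*-Solver)
        open +-*-Solver

0ℂ≉1ℂ : ¬ (0ℂ ≈ 1ℂ)
0ℂ≉1ℂ (0≈1 ,≈ _) =
  let N , h = close 0≈1 ½ (ℚ.positive⁻¹ ½)
  in from-no (1ℚ ℚ.≤? ½) (h N ℕ.≤-refl)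

-- Inner products and orthonormal bases

sum-single : ∀ {m} (i : Fin m) (f : Fin m → ℂ) → (∀ j → j ≢ i → f j ≈ 0ℂ) → sum f ≈ f i
sum-single {suc m} zero f f≈0 = ℂᵣ.trans
  (ℂᵣ.+-congˡ (ℂᵣ.trans (∑.sum-cong-≋ λ j → f≈0 (suc j) λ ()) (∑.sum-replicate-zero m)))
  (ℂᵣ.+-identityʳ (f zero))
sum-single {suc m} (suc i) f f≈0 = ℂᵣ.trans
  (ℂᵣ.+-cong (f≈0 zero λ ()) (sum-single i (f ∘ suc) λ j j≢i → f≈0 (suc j) λ { refl → j≢i refl }))
  (ℂᵣ.+-identityˡ (f (suc i)))

module _ {n : ℕ} where

  open import Relation.Binary.Reasoning.Setoid ℂᵣ.setoid

  ⟨⟩-congˡ : ∀ (t : ℂ^ n) {u v : ℂ^ n} → (∀ k → u k ≈ v k) → ⟨ t , u ⟩ ≈ ⟨ t , v ⟩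
  ⟨⟩-congˡ t u≈v = ∑.sum-cong-≋ λ k → ℂᵣ.*-congˡ (u≈v k)

  ⟨⟩-congʳ : ∀ {t u : ℂ^ n} (v : ℂ^ n) → (∀ k → t k ≈ u k) → ⟨ t , v ⟩ ≈ ⟨ u , v ⟩
  ⟨⟩-congʳ v t≈u = ∑.sum-cong-≋ λ k → ℂᵣ.*-congʳ (conj-cong (t≈u k))

  ⟨⟩-scaleˡ : ∀ (u : ℂ^ n) c (v : ℂ^ n) → ⟨ u , (λ k → c * v k) ⟩ ≈ c * ⟨ u , v ⟩
  ⟨⟩-scaleˡ u c v = ℂᵣ.sym (ℂᵣ.trans (∑.*-distribˡ-sum c (λ k → conj (u k) * v k))
    (∑.sum-cong-≋ λ k → begin
      c * (conj (u k) * v k)  ≈⟨ ℂᵣ.*-assoc c (conj (u k)) (v k) ⟨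
      (c * conj (u k)) * v k  ≈⟨ ℂᵣ.*-congʳ (ℂᵣ.*-comm c (conj (u k))) ⟩
      (conj (u k) * c) * v k  ≈⟨ ℂᵣ.*-assoc (conj (u k)) c (v k) ⟩
      conj (u k) * (c * v k)  ∎))

  ⟨⟩-scaleʳ : ∀ c (u v : ℂ^ n) → ⟨ (λ k → c * u k) , v ⟩ ≈ conj c * ⟨ u , v ⟩
  ⟨⟩-scaleʳ c u v = ℂᵣ.sym (ℂᵣ.trans (∑.*-distribˡ-sum (conj c) (λ k → conj (u k) * v k))
    (∑.sum-cong-≋ λ k → begin
      conj c * (conj (u k) * v k)  ≈⟨ ℂᵣ.*-assoc (conj c) (conj (u k)) (v k) ⟨
      (conj c * conj (u k)) * v k  ≈⟨ ℂᵣ.*-congʳ (conj-* c (u k)) ⟨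
      conj (c * u k) * v k         ∎))

  ⟨⟩-sum : ∀ {m} (u : ℂ^ n) (a : Fin m → ℂ) (b : Fin m → ℂ^ n) →
           ⟨ u , (λ k → sum λ i → a i * b i k) ⟩ ≈ sum λ i → a i * ⟨ u , b i ⟩
  ⟨⟩-sum u a b = begin
    (sum λ k → conj (u k) * sum λ i → a i * b i k)
      ≈⟨ ∑.sum-cong-≋ (λ k → ∑.*-distribˡ-sum (conj (u k)) (λ i → a i * b i k)) ⟩
    (sum λ k → sum λ i → conj (u k) * (a i * b i k))
      ≈⟨ ∑.∑-comm (λ k i → conj (u k) * (a i * b i k)) ⟩
    (sum λ i → ⟨ u , (λ k → a i * b i k) ⟩)
      ≈⟨ ∑.sum-cong-≋ (λ i → ⟨⟩-scaleˡ u (a i) (b i)) ⟩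
    (sum λ i → a i * ⟨ u , b i ⟩) ∎

  ⊥-scaleʳ : ∀ {t u v : ℂ^ n} {c} → (∀ k → v k ≈ c * u k) → ⟨ u , t ⟩ ≈ 0ℂ → ⟨ v , t ⟩ ≈ 0ℂ
  ⊥-scaleʳ {t} {u} {v} {c} v≈cu u⊥t = begin
    ⟨ v , t ⟩                    ≈⟨ ⟨⟩-congʳ t v≈cu ⟩
    ⟨ (λ k → c * u k) , t ⟩      ≈⟨ ⟨⟩-scaleʳ c u t ⟩
    conj c * ⟨ u , t ⟩           ≈⟨ ℂᵣ.*-congˡ u⊥t ⟩
    conj c * 0ℂ                  ≈⟨ ℂᵣ.zeroʳ (conj c) ⟩
    0ℂ                           ∎

  -- Orthogonality to `u` would pass from `v` to its multiple `u`, and ⟨ u , u ⟩ would be both 0 and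
  -- 1.
  unit-⊥̸ : ∀ {u v : ℂ^ n} {c} → (∀ k → u k ≈ c * v k) → IsUnit u → ¬ (⟨ v , u ⟩ ≈ 0ℂ)
  unit-⊥̸ u≈cv u-unit v⊥u = 0ℂ≉1ℂ (ℂᵣ.trans (ℂᵣ.sym (⊥-scaleʳ u≈cv v⊥u)) u-unit)

  -- The coefficients of v in an orthonormal basis are the inner products, so
  -- only the p-th one survives.
  parallel : ∀ {b : Fin n → ℂ^ n} → IsOrthonormalBasis b → ∀ {v} p →
             (∀ m → m ≢ p → ⟨ b m , v ⟩ ≈ 0ℂ) → ∃ λ c → ∀ k → v k ≈ c * b p k
  parallel {b} b-onb {v} p v⊥ = a p , λ k → begin
    v k                              ≈⟨ v≈Σ k ⟩
    (sum λ i → a i * b i k)          ≈⟨ sum-single p (λ i → a i * b i k) (λ i i≢p → begin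
      a i * b i k                      ≈⟨ ℂᵣ.*-congʳ (a≈0 i i≢p) ⟩
      0ℂ * b i k                       ≈⟨ ℂᵣ.zeroˡ (b i k) ⟩
      0ℂ                               ∎) ⟩
    a p * b p k                      ∎
    where
    open IsOrthonormalBasis b-onb
    a = proj₁ (spanning v)
    v≈Σ = proj₂ (spanning v)

    -- Multiplying by ⟨ b i , b i ⟩ = 1 turns `a i` into the only surviving term of the expansion of
    -- ⟨ b i , v ⟩.
    a≈0 : ∀ i → i ≢ p → a i ≈ 0ℂ
    a≈0 i i≢p = begin
      a i                             ≈⟨ ℂᵣ.*-identityʳ (a i) ⟨
      a i * 1ℂ                        ≈⟨ ℂᵣ.*-congˡ (unit i) ⟨
      a i * ⟨ b i , b i ⟩             ≈⟨ sum-single i (λ j → a j * ⟨ b i , b j ⟩) (λ j j≢i →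
        ℂᵣ.trans (ℂᵣ.*-congˡ (orthogonal i j (j≢i ∘ ≡.sym))) (ℂᵣ.zeroʳ (a j))) ⟨
      (sum λ j → a j * ⟨ b i , b j ⟩) ≈⟨ ⟨⟩-sum (b i) a b ⟨
      ⟨ b i , (λ k → sum λ j → a j * b j k) ⟩ ≈⟨ ⟨⟩-congˡ (b i) v≈Σ ⟨
      ⟨ b i , v ⟩                     ≈⟨ v⊥ i i≢p ⟩
      0ℂ                              ∎

  -- From 1 = ⟨ u , u ⟩ = |c|² ⟨ v , v ⟩. The squared modulus is written as a product because that
  -- is the form in which the circle is handed to the exponential.
  unit-ratio : ∀ {u v : ℂ^ n} {c} → (∀ k → u k ≈ c * v k) → IsUnit u → IsUnit v → conj c * c ≈ 1ℂ
  unit-ratio {u} {v} {c} u≈cv u-unit v-unit = begin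
    conj c * c                          ≈⟨ ℂᵣ.*-congˡ (ℂᵣ.*-identityʳ c) ⟨
    conj c * (c * 1ℂ)                   ≈⟨ ℂᵣ.*-congˡ (ℂᵣ.*-congˡ v-unit) ⟨
    conj c * (c * ⟨ v , v ⟩)            ≈⟨ ℂᵣ.*-congˡ (⟨⟩-scaleˡ v c v) ⟨
    conj c * ⟨ v , (λ k → c * v k) ⟩    ≈⟨ ⟨⟩-scaleʳ c v _ ⟨
    ⟨ (λ k → c * v k) , (λ k → c * v k) ⟩ ≈⟨ ⟨⟩-congʳ _ u≈cv ⟨
    ⟨ u , (λ k → c * v k) ⟩             ≈⟨ ⟨⟩-congˡ u u≈cv ⟨
    ⟨ u , u ⟩                           ≈⟨ u-unit ⟩
    1ℂ                                  ∎

-- Counting on finite sets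

Injective : ∀ {m n} → (Fin m → Fin n) → Set
Injective f = ∀ {i j} → f i ≡ f j → i ≡ j

-- If every value were attained, a choice of preimages would inject `Fin (suc n)` into `Fin n`.
misses-one : ∀ {n} {f : Fin n → Fin (suc n)} → ∃ λ y → ∀ i → f i ≢ y
misses-one {n} {f} with any? (λ y → all? (λ i → ¬? (f i ≟ y)))
... | yes (y , missed) = y , missed
... | no ¬missed = contradiction (injective⇒≤ preimage-injective) (ℕ.<⇒≱ (ℕ.n<1+n n))
  where
  preimage : ∀ y → ∃ λ i → f i ≡ y
  preimage y = decidable-stable (any? λ i → f i ≟ y)
    λ ∄i → ¬missed (y , λ i fi≡y → ∄i (i , fi≡y))
  preimage-injective : Injective (proj₁ ∘ preimage)
  preimage-injective {y} {z} eq =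
    ≡.trans (≡.sym (proj₂ (preimage y))) (≡.trans (cong f eq) (proj₂ (preimage z)))

-- Two different omitted values could both be punched out of the codomain, which would then be
-- smaller than the domain of the injection `f`.
misses-unique : ∀ {n} {f : Fin n → Fin (suc n)} → Injective f →
                ∀ {y z} → (∀ i → f i ≢ y) → (∀ i → f i ≢ z) → y ≡ z
misses-unique {ℕ.zero} f-inj {zero} {zero} _ _ = refl
misses-unique {suc n} {f} f-inj {y} {z} y-missed z-missed with y ≟ z
... | yes y≡z = y≡z
... | no y≢z = contradiction (injective⇒≤ g-injective) (ℕ.<⇒≱ (ℕ.n<1+n n))
  where
  y≢f : ∀ i → y ≢ f i
  y≢f i = y-missed i ∘ ≡.sym
  z′≢ : ∀ i → punchOut y≢z ≢ punchOut (y≢f i)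
  z′≢ i eq = z-missed i (≡.sym (punchOut-injective y≢z (y≢f i) eq))
  g : Fin (suc n) → Fin n
  g i = punchOut (z′≢ i)
  g-injective : Injective g
  g-injective {i} {j} eq = f-inj (punchOut-injective (y≢f i) (y≢f j) (punchOut-injective (z′≢ i) (z′≢ j) eq))

-- Classes met and omitted by the rows of a square

module _ {n : ℕ} (exp-surjective : ∀ w → conj w * w ≈ 1ℂ → ∃ λ α → w ≈exp (0ℝ +i α))
         (Φ : QLS (suc n)) {c} {class : Fin (suc n) × Fin (suc n) → Fin c}
         (class-cong : Congruent (EntryEquiv Φ) _≡_ class) (class-inj : Injectiveₛ (EntryEquiv Φ) _≡_ class) where

  module Φ = QLS Φ
  module Row i = IsOrthonormalBasis (Φ.row i)

  -- The factor is 1, but an angle for it has to be produced as well.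
  ∼-refl : ∀ (u : ℂ^ suc n) → u ∼ u
  ∼-refl u = let α , e = exp-surjective 1ℂ (ℂᵣ.trans (ℂᵣ.*-identityʳ (conj 1ℂ)) (≈-pointwise {conj 1ℂ} {1ℂ} λ _ → refl)) in
    α , 1ℂ , e , λ k → ℂᵣ.sym (ℂᵣ.*-identityˡ (u k))

  proportional : ∀ {i j k l} → class (i , j) ≡ class (k , l) → ∃ λ c → ∀ m → Φ.entry i j m ≈ c * Φ.entry k l m
  proportional {i} {j} {k} {l} eq = let _ , w , _ , eq′ = class-inj {i , j} {k , l} eq in w , eq′

  -- Entries of one class are proportional, whereas different entries of a row are orthogonal.
  row-injective : ∀ i → Injective (λ j → class (i , j))
  row-injective i {j} {k} same = decidable-stable (j ≟ k) λ j≢k → let w , uj≈wuk = proportional same in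
    unit-⊥̸ {u = Φ.entry i j} {v = Φ.entry i k} {c = w} uj≈wuk (Φ.unit i j) (Row.orthogonal i k j (j≢k ∘ ≡.sym))

  same-ray : ∀ {i j k l} c → (∀ m → Φ.entry i j m ≈ c * Φ.entry k l m) → class (i , j) ≡ class (k , l)
  same-ray {i} {j} {k} {l} c u≈cv =
    let α , e = exp-surjective c (unit-ratio {u = Φ.entry i j} {v = Φ.entry k l} {c = c} u≈cv (Φ.unit i j) (Φ.unit k l))
    in class-cong {i , j} {k , l} (α , c , e , u≈cv)

  -- Surjectivity speaks of all positions equivalent to the preimage; reflexivity recovers the
  -- preimage itself.
  class-self : ∀ {y i j} → (∀ {z} → EntryEquiv Φ z (i , j) → class z ≡ y) → class (i , j) ≡ y
  class-self {y} {i} {j} h = h {i , j} (∼-refl (Φ.entry i j))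

  module _ (unique-omission : ∀ i {y z} → (∀ j → class (i , j) ≢ y) → (∀ j → class (i , j) ≢ z) → y ≡ z)
           (i j k : Fin (suc n)) (unhit : ∀ l → class (k , l) ≢ class (i , j)) where

    private
      hit? : ∀ p → Dec (∃ λ m → class (i , m) ≡ class (k , p))
      hit? p = any? λ m → class (i , m) ≟ class (k , p)

      -- By `unhit` the entry of row `i` on the ray of `(k , p)` stands in a column other than `j`,
      -- hence is orthogonal to the entry at `(i , j)`.
      ⊥-hit : ∀ p → (∃ λ m → class (i , m) ≡ class (k , p)) → ⟨ Φ.entry k p , Φ.entry i j ⟩ ≈ 0ℂ
      ⊥-hit p (m , eq) = let w , u≈wv = proportional (≡.sym eq) in
        ⊥-scaleʳ {t = Φ.entry i j} {u = Φ.entry i m} {v = Φ.entry k p} {c = w} u≈wv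
          (Row.orthogonal i m j λ { refl → unhit p (≡.sym eq) })

    -- Otherwise the entry at (i , j), orthogonal to all rays of row k but
    -- one, would lie on the remaining ray.
    row-not-covered : ⊥
    row-not-covered with any? (λ p → ¬? (hit? p))
    ... | yes (p , p-missed) =
      let c , u≈cv = parallel (Φ.row k) {Φ.entry i j} p λ m m≢p → ⊥-hit m (hit m m≢p)
      in unhit p (≡.sym (same-ray {i} {j} {k} {p} c u≈cv))
      where
      -- Otherwise row `i` would omit the classes of both `(k , m)` and `(k , p)`. These would
      -- coincide, and row `k` would repeat a class.
      hit : ∀ m → m ≢ p → ∃ λ l → class (i , l) ≡ class (k , m)
      hit m m≢p = decidable-stable (hit? m) λ m-missed → m≢p (row-injective k
        (unique-omission i (λ l eq → m-missed (l , eq)) (λ l eq → p-missed (l , eq))))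
    ... | no ¬missed =
      -- If row `i` meets every ray of row `k`, the entry is orthogonal to a whole basis. Column
      -- `zero` is an arbitrary choice of a ray which it is then both parallel and orthogonal to.
      let c , u≈cv = parallel (Φ.row k) {Φ.entry i j} zero λ m _ → ⊥-all m
      in unit-⊥̸ {u = Φ.entry i j} {v = Φ.entry k zero} {c = c} u≈cv (Φ.unit i j) (⊥-all zero)
      where
      ⊥-all : ∀ m → ⟨ Φ.entry k m , Φ.entry i j ⟩ ≈ 0ℂ
      ⊥-all m = ⊥-hit m (decidable-stable (hit? m) λ m-missed → ¬missed (m , m-missed))

-- Each row omits exactly one class, and the class omitted by row 0 occurs in
-- some other row.
no-cardinality-1+n : (∀ w → conj w * w ≈ 1ℂ → ∃ λ α → w ≈exp (0ℝ +i α)) →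
                     ∀ {n} (Φ : QLS (suc n)) → ¬ HasCardinality Φ (suc (suc n))
no-cardinality-1+n exp-surjective {n} Φ (class , class-cong , class-inj , class-surj) =
  let x , x-missed = misses-one {f = λ j → class (zero , j)}
      (i , j) , onto = class-surj x
      class-ij≡x = class-self exp-surjective Φ class-cong class-inj {x} {i} {j} onto
  in row-not-covered exp-surjective Φ class-cong class-inj
       (λ l → misses-unique (row-injective exp-surjective Φ class-cong class-inj l)) i j zero
       (λ l eq → x-missed l (≡.trans eq class-ij≡x))

-- The exponential maps the imaginary axis onto the unit circle

module C = CommutativeRing ℚ[i]-commutativeRing
module C-Solver = RingSolver (ACR.fromCommutativeRing ℚ[i]-commutativeRing) (≡-dec ℚ._≟_ ℚ._≟_)

-- The norm |re| + |im| is submultiplicative and avoids square roots.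

∥_∥ : ℚ[i] → ℚ
∥ a , b ∥ = ∣ a ∣ ℚ.+ ∣ b ∣

0≤∥z∥ : ∀ z → 0ℚ ℚ.≤ ∥ z ∥
0≤∥z∥ (a , b) = ℚ.+-mono-≤ (ℚ.0≤∣p∣ a) (ℚ.0≤∣p∣ b)

∥z⊕w∥≤∥z∥+∥w∥ : ∀ z w → ∥ z ⊕ w ∥ ℚ.≤ ∥ z ∥ ℚ.+ ∥ w ∥
∥z⊕w∥≤∥z∥+∥w∥ (a , b) (c , d) = ℚ.≤-trans
  (ℚ.+-mono-≤ (ℚ.∣p+q∣≤∣p∣+∣q∣ a c) (ℚ.∣p+q∣≤∣p∣+∣q∣ b d))
  (ℚ.≤-reflexive (solve 4 (λ a b c d → (a :+ c) :+ (b :+ d) := (a :+ b) :+ (c :+ d)) refl (∣ a ∣) (∣ b ∣) (∣ c ∣) (∣ d ∣)))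
  where open +-*-Solver

∥z⊗w∥≤∥z∥*∥w∥ : ∀ z w → ∥ z ⊗ w ∥ ℚ.≤ ∥ z ∥ ℚ.* ∥ w ∥
∥z⊗w∥≤∥z∥*∥w∥ (a , b) (c , d) = begin
  ∣ a ℚ.* c ℚ.- b ℚ.* d ∣ ℚ.+ ∣ a ℚ.* d ℚ.+ b ℚ.* c ∣
    ≤⟨ ℚ.+-mono-≤ (ℚ.∣p+q∣≤∣p∣+∣q∣ (a ℚ.* c) (ℚ.- (b ℚ.* d))) (ℚ.∣p+q∣≤∣p∣+∣q∣ (a ℚ.* d) (b ℚ.* c)) ⟩
  (∣ a ℚ.* c ∣ ℚ.+ ∣ ℚ.- (b ℚ.* d) ∣) ℚ.+ (∣ a ℚ.* d ∣ ℚ.+ ∣ b ℚ.* c ∣)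
    ≡⟨ cong₂ ℚ._+_
         (cong₂ ℚ._+_ (ℚ.∣p*q∣≡∣p∣*∣q∣ a c) (trans (ℚ.∣-p∣≡∣p∣ (b ℚ.* d)) (ℚ.∣p*q∣≡∣p∣*∣q∣ b d)))
         (cong₂ ℚ._+_ (ℚ.∣p*q∣≡∣p∣*∣q∣ a d) (ℚ.∣p*q∣≡∣p∣*∣q∣ b c)) ⟩
  (∣ a ∣ ℚ.* ∣ c ∣ ℚ.+ ∣ b ∣ ℚ.* ∣ d ∣) ℚ.+ (∣ a ∣ ℚ.* ∣ d ∣ ℚ.+ ∣ b ∣ ℚ.* ∣ c ∣)
    ≡⟨ solve 4 (λ a b c d → (a :* c :+ b :* d) :+ (a :* d :+ b :* c) := (a :+ b) :* (c :+ d)) refl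
         (∣ a ∣) (∣ b ∣) (∣ c ∣) (∣ d ∣) ⟩
  (∣ a ∣ ℚ.+ ∣ b ∣) ℚ.* (∣ c ∣ ℚ.+ ∣ d ∣) ∎
  where open ℚ.≤-Reasoning
        open +-*-Solver

*-mono-≤ : ∀ {p q r s} → 0ℚ ℚ.≤ r → 0ℚ ℚ.≤ q → p ℚ.≤ q → r ℚ.≤ s → p ℚ.* r ℚ.≤ q ℚ.* s
*-mono-≤ {p} {q} {r} {s} 0≤r 0≤q p≤q r≤s = ℚ.≤-trans
  (ℚ.*-monoʳ-≤-nonNeg r {{ℚ.nonNegative 0≤r}} p≤q) (ℚ.*-monoˡ-≤-nonNeg q {{ℚ.nonNegative 0≤q}} r≤s)

0≤p*q : ∀ {p q} → 0ℚ ℚ.≤ p → 0ℚ ℚ.≤ q → 0ℚ ℚ.≤ p ℚ.* q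
0≤p*q {p} {q} 0≤p 0≤q = subst (ℚ._≤ p ℚ.* q) (ℚ.*-zeroˡ 0ℚ) (*-mono-≤ ℚ.≤-refl 0≤p 0≤p 0≤q)

∥⊗∥-mono : ∀ z w {p q} → ∥ z ∥ ℚ.≤ p → ∥ w ∥ ℚ.≤ q → ∥ z ⊗ w ∥ ℚ.≤ p ℚ.* q
∥⊗∥-mono z w z≤p w≤q = ℚ.≤-trans (∥z⊗w∥≤∥z∥*∥w∥ z w)
  (*-mono-≤ (0≤∥z∥ w) (ℚ.≤-trans (0≤∥z∥ z) z≤p) z≤p w≤q)

∥⊕∥-mono : ∀ z w {p q} → ∥ z ∥ ℚ.≤ p → ∥ w ∥ ℚ.≤ q → ∥ z ⊕ w ∥ ℚ.≤ p ℚ.+ q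
∥⊕∥-mono z w z≤p w≤q = ℚ.≤-trans (∥z⊕w∥≤∥z∥+∥w∥ z w) (ℚ.+-mono-≤ z≤p w≤q)

-- Archimedean estimates

fromℕ : ℕ → ℚ
fromℕ zero    = 0ℚ
fromℕ (suc n) = 1ℚ ℚ.+ fromℕ n

toℚᵘ-fromℕ : ∀ n → ℚ.toℚᵘ (fromℕ n) ℚᵘ.≃ ℚᵘ.mkℚᵘ (+ n) 0
toℚᵘ-fromℕ zero    = ℚᵘ.≃-refl
toℚᵘ-fromℕ (suc n) = ℚᵘ.≃-trans (ℚ.toℚᵘ-homo-+ 1ℚ (fromℕ n))
  (ℚᵘ.≃-trans (ℚᵘ.+-congʳ ℚᵘ.1ℚᵘ (toℚᵘ-fromℕ n))
    (ℚᵘ.*≡* (trans (ℤ.*-identityʳ _) (trans (cong (λ m → ℤ.1ℤ ℤ.+ m) (ℤ.*-identityʳ (+ n))) (sym (ℤ.*-identityʳ (+ suc n)))))))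

abstract
  archimedean : ∀ p → ∃ λ n → p ℚ.≤ fromℕ n
  -- The denominator is at least 1, so the absolute value of the numerator is large enough.
  archimedean p@(ℚ.mkℚ i d _) = ℤ.∣ i ∣ , ℚ.toℚᵘ-cancel-≤ (begin
    ℚᵘ.mkℚᵘ i d              ≤⟨ ℚᵘ.*≤* (ℤ.≤-trans (ℤ.≤-reflexive (ℤ.*-identityʳ i)) (ℤ.≤-trans (i≤∣i∣ i)
                                   (ℤ.≤-trans (ℤ.+≤+ (ℕ.m≤m*n ℤ.∣ i ∣ (suc d))) (ℤ.≤-reflexive (ℤ.pos-* ℤ.∣ i ∣ (suc d)))))) ⟩
    ℚᵘ.mkℚᵘ (+ ℤ.∣ i ∣) 0    ≃⟨ toℚᵘ-fromℕ ℤ.∣ i ∣ ⟨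
    ℚ.toℚᵘ (fromℕ ℤ.∣ i ∣)   ∎)
    where
    open ℚᵘ.≤-Reasoning
    i≤∣i∣ : ∀ i → i ℤ.≤ + ℤ.∣ i ∣
    i≤∣i∣ (+ n)      = ℤ.≤-refl
    i≤∣i∣ ℤ.-[1+ n ] = ℤ.-≤+

0≤1 : 0ℚ ℚ.≤ 1ℚ
0≤1 = ℚ.<⇒≤ (ℚ.positive⁻¹ 1ℚ)

0≤fromℕ : ∀ n → 0ℚ ℚ.≤ fromℕ n
0≤fromℕ zero    = ℚ.≤-refl
0≤fromℕ (suc n) = ℚ.+-mono-≤ 0≤1 (0≤fromℕ n)

fromℕ-mono-≤ : ∀ {m n} → m ℕ.≤ n → fromℕ m ℚ.≤ fromℕ n
fromℕ-mono-≤ {n = n} ℕ.z≤n = 0≤fromℕ n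
fromℕ-mono-≤ (ℕ.s≤s m≤n)   = ℚ.+-monoʳ-≤ 1ℚ (fromℕ-mono-≤ m≤n)

fromℕ-+ : ∀ m n → fromℕ (m ℕ.+ n) ≡ fromℕ m ℚ.+ fromℕ n
fromℕ-+ zero    n = sym (ℚ.+-identityˡ (fromℕ n))
fromℕ-+ (suc m) n = trans (cong (1ℚ ℚ.+_) (fromℕ-+ m n)) (sym (ℚ.+-assoc 1ℚ (fromℕ m) (fromℕ n)))

fromℕ-* : ∀ m n → fromℕ (m ℕ.* n) ≡ fromℕ m ℚ.* fromℕ n
fromℕ-* zero    n = sym (ℚ.*-zeroˡ (fromℕ n))
fromℕ-* (suc m) n = trans (fromℕ-+ n (m ℕ.* n)) (trans (cong (fromℕ n ℚ.+_) (fromℕ-* m n))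
  (solve 2 (λ m n → n :+ m :* n := (con 1ℚ :+ m) :* n) refl (fromℕ m) (fromℕ n)))
  where open +-*-Solver

1/n*n≡1 : ∀ n .{{_ : ℕ.NonZero n}} → (+ 1 ℚ./ n) ℚ.* fromℕ n ≡ 1ℚ
1/n*n≡1 (suc n) = ℚ.toℚᵘ-injective (ℚᵘ.≃-trans (ℚ.toℚᵘ-homo-* (+ 1 ℚ./ suc n) (fromℕ (suc n)))
  (ℚᵘ.≃-trans (ℚᵘ.*-cong (ℚ.toℚᵘ-fromℚᵘ (ℚᵘ.mkℚᵘ (+ 1) n)) (toℚᵘ-fromℕ (suc n)))
    (ℚᵘ.*≡* (ℤ.*-assoc ℤ.1ℤ (+ suc n) ℤ.1ℤ))))

0≤1/n : ∀ n .{{_ : ℕ.NonZero n}} → 0ℚ ℚ.≤ + 1 ℚ./ n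
0≤1/n n = ℚ.nonNegative⁻¹ (+ 1 ℚ./ n) {{ℚ.normalize-nonNeg 1 n}}

pow : ℚ → ℕ → ℚ
pow q zero    = 1ℚ
pow q (suc n) = q ℚ.* pow q n

0≤pow : ∀ {q} → 0ℚ ℚ.≤ q → ∀ n → 0ℚ ℚ.≤ pow q n
0≤pow 0≤q zero    = 0≤1
0≤pow 0≤q (suc n) = 0≤p*q 0≤q (0≤pow 0≤q n)

p-q≤p : ∀ {p q} → 0ℚ ℚ.≤ q → p ℚ.- q ℚ.≤ p
p-q≤p {p} {q} 0≤q = ℚ.≤-trans (ℚ.+-monoʳ-≤ p (ℚ.neg-antimono-≤ 0≤q)) (ℚ.≤-reflexive (ℚ.+-identityʳ p))

p≤p+q : ∀ {p q} → 0ℚ ℚ.≤ q → p ℚ.≤ p ℚ.+ q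
p≤p+q {p} {q} 0≤q = ℚ.≤-trans (ℚ.≤-reflexive (sym (ℚ.+-identityʳ p))) (ℚ.+-monoʳ-≤ p 0≤q)

-- Bernoulli's inequality for 1/(1 - p), multiplied out to avoid division. The induction rests on (1
-- - p)(1 + (n + 1)p) = 1 + np - (n + 1)p².
bernoulli : ∀ {p} → 0ℚ ℚ.≤ p → 0ℚ ℚ.≤ 1ℚ ℚ.- p → ∀ n → pow (1ℚ ℚ.- p) n ℚ.* (1ℚ ℚ.+ fromℕ n ℚ.* p) ℚ.≤ 1ℚ
bernoulli {p} 0≤p 0≤q zero = ℚ.≤-reflexive (solve 1 (λ p → con 1ℚ :* (con 1ℚ :+ con 0ℚ :* p) := con 1ℚ) refl p)
  where open +-*-Solver
bernoulli {p} 0≤p 0≤q (suc n) = begin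
  (q ℚ.* x) ℚ.* (1ℚ ℚ.+ (1ℚ ℚ.+ fromℕ n) ℚ.* p)
    ≡⟨ solve 3 (λ p x m → ((con 1ℚ :- p) :* x) :* (con 1ℚ :+ (con 1ℚ :+ m) :* p)
                        := x :* (con 1ℚ :+ m :* p) :- x :* ((con 1ℚ :+ m) :* (p :* p))) refl p x (fromℕ n) ⟩
  x ℚ.* (1ℚ ℚ.+ fromℕ n ℚ.* p) ℚ.- x ℚ.* ((1ℚ ℚ.+ fromℕ n) ℚ.* (p ℚ.* p))
    ≤⟨ p-q≤p (0≤p*q (0≤pow 0≤q n) (0≤p*q (0≤fromℕ (suc n)) (0≤p*q 0≤p 0≤p))) ⟩
  x ℚ.* (1ℚ ℚ.+ fromℕ n ℚ.* p)
    ≤⟨ bernoulli 0≤p 0≤q n ⟩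
  1ℚ ∎
  where
  open ℚ.≤-Reasoning
  open +-*-Solver
  q = 1ℚ ℚ.- p
  x = pow q n

abstract
  -- With δ = 1/(pε) and n ≥ cδ, the product c(1 - p)ⁿ is at most n p (1 - p)ⁿ ε, and Bernoulli's
  -- inequality bounds this by ε.
  pow-small : ∀ {p} → 0ℚ ℚ.< p → 0ℚ ℚ.≤ 1ℚ ℚ.- p → ∀ {c ε} → 0ℚ ℚ.≤ c → 0ℚ ℚ.< ε →
              ∃ λ N → ∀ n → N ℕ.≤ n → c ℚ.* pow (1ℚ ℚ.- p) n ℚ.≤ ε
  pow-small {p} 0<p 0≤q {c} {ε} 0≤c 0<ε =
    let δ , 0<δ , pεδ≡1 = ∃-divide (ℚ.positive⁻¹ 1ℚ) (0<p*q 0<p 0<ε)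
        N , cδ≤N = archimedean (c ℚ.* δ)
    in N , λ n N≤n → let x = pow (1ℚ ℚ.- p) n; 0≤x = 0≤pow 0≤q n in begin
      c ℚ.* x
        ≡⟨ trans (sym (ℚ.*-identityʳ (c ℚ.* x))) (cong (c ℚ.* x ℚ.*_) (sym pεδ≡1)) ⟩
      (c ℚ.* x) ℚ.* ((p ℚ.* ε) ℚ.* δ)
        ≡⟨ solve 5 (λ c x p e d → (c :* x) :* ((p :* e) :* d) := (c :* d) :* (x :* p :* e)) refl c x p ε δ ⟩
      (c ℚ.* δ) ℚ.* (x ℚ.* p ℚ.* ε)
        ≤⟨ *-mono-≤ (0≤p*q (0≤p*q 0≤x (ℚ.<⇒≤ 0<p)) (ℚ.<⇒≤ 0<ε)) (0≤fromℕ n)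
             (ℚ.≤-trans cδ≤N (fromℕ-mono-≤ N≤n)) ℚ.≤-refl ⟩
      fromℕ n ℚ.* (x ℚ.* p ℚ.* ε)
        ≤⟨ p≤p+q (0≤p*q 0≤x (ℚ.<⇒≤ 0<ε)) ⟩
      fromℕ n ℚ.* (x ℚ.* p ℚ.* ε) ℚ.+ x ℚ.* ε
        ≡⟨ solve 4 (λ m x p e → m :* (x :* p :* e) :+ x :* e := (x :* (con 1ℚ :+ m :* p)) :* e) refl (fromℕ n) x p ε ⟩
      (x ℚ.* (1ℚ ℚ.+ fromℕ n ℚ.* p)) ℚ.* ε
        ≤⟨ *-mono-≤ (ℚ.<⇒≤ 0<ε) 0≤1 (bernoulli (ℚ.<⇒≤ 0<p) 0≤q n) ℚ.≤-refl ⟩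
      1ℚ ℚ.* ε
        ≡⟨ ℚ.*-identityˡ ε ⟩
      ε ∎
    where open ℚ.≤-Reasoning
          open +-*-Solver

-- Partial sums

module PartialSum {A : Set} (_∙_ : A → A → A) (ε : A) where

  Σ< : (ℕ → A) → ℕ → A
  Σ< f zero    = ε
  Σ< f (suc n) = Σ< f n ∙ f n

open PartialSum _⊕_ 0ᵢ public using (Σ<)
open PartialSum ℚ._+_ 0ℚ public using () renaming (Σ< to Σℚ<)

shift : ∀ {A : Set} → ℕ → (ℕ → A) → ℕ → A
shift p f k = f (p ℕ.+ k)

Σ<-cong : ∀ {f g} → (∀ k → f k ≡ g k) → ∀ n → Σ< f n ≡ Σ< g n
Σ<-cong f≡g zero    = refl
Σ<-cong f≡g (suc n) = cong₂ _⊕_ (Σ<-cong f≡g n) (f≡g n)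

Σ<-suc : ∀ f n → Σ< f (suc n) ≡ f 0 ⊕ Σ< (f ∘ suc) n
Σ<-suc f zero    = C.+-comm 0ᵢ (f 0)
Σ<-suc f (suc n) = trans (cong (_⊕ f (suc n)) (Σ<-suc f n)) (C.+-assoc (f 0) (Σ< (f ∘ suc) n) (f (suc n)))

Σ<-shift : ∀ f m n → Σ< f (m ℕ.+ n) ≡ Σ< f m ⊕ Σ< (shift m f) n
Σ<-shift f m zero    = trans (cong (Σ< f) (ℕ.+-identityʳ m)) (sym (C.+-identityʳ (Σ< f m)))
Σ<-shift f m (suc n) = trans (cong (Σ< f) (ℕ.+-suc m n)) (trans (cong (_⊕ f (m ℕ.+ n)) (Σ<-shift f m n))
  (C.+-assoc (Σ< f m) (Σ< (shift m f) n) (f (m ℕ.+ n))))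

Σℚ<-shift : ∀ f m n → Σℚ< f (m ℕ.+ n) ≡ Σℚ< f m ℚ.+ Σℚ< (shift m f) n
Σℚ<-shift f m zero    = trans (cong (Σℚ< f) (ℕ.+-identityʳ m)) (sym (ℚ.+-identityʳ (Σℚ< f m)))
Σℚ<-shift f m (suc n) = trans (cong (Σℚ< f) (ℕ.+-suc m n)) (trans (cong (ℚ._+ f (m ℕ.+ n)) (Σℚ<-shift f m n))
  (ℚ.+-assoc (Σℚ< f m) (Σℚ< (shift m f) n) (f (m ℕ.+ n))))

∥Σ<∥≤Σℚ< : ∀ {f g} → (∀ k → ∥ f k ∥ ℚ.≤ g k) → ∀ n → ∥ Σ< f n ∥ ℚ.≤ Σℚ< g n
∥Σ<∥≤Σℚ< f≤g zero    = ℚ.≤-refl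
∥Σ<∥≤Σℚ< {f} f≤g (suc n) = ∥⊕∥-mono (Σ< f n) (f n) (∥Σ<∥≤Σℚ< f≤g n) (f≤g n)

0≤Σℚ< : ∀ {f} → (∀ k → 0ℚ ℚ.≤ f k) → ∀ n → 0ℚ ℚ.≤ Σℚ< f n
0≤Σℚ< 0≤f zero    = ℚ.≤-refl
0≤Σℚ< 0≤f (suc n) = ℚ.+-mono-≤ (0≤Σℚ< 0≤f n) (0≤f n)

-- Telescoping: (1 - q) f k ≤ f k - f (k + 1). The bound f 0 / (1 - q) for the sum is kept free of
-- division, and the term `f n` is retained to carry the induction.
geometric : ∀ {f q} → (∀ k → f (suc k) ℚ.≤ q ℚ.* f k) →
            ∀ n → (1ℚ ℚ.- q) ℚ.* Σℚ< f n ℚ.+ f n ℚ.≤ f 0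
geometric {f} {q} ratio zero = ℚ.≤-reflexive
  (solve 2 (λ q x → (con 1ℚ :- q) :* con 0ℚ :+ x := x) refl q (f 0))
  where open +-*-Solver
geometric {f} {q} ratio (suc n) = begin
  (1ℚ ℚ.- q) ℚ.* (S ℚ.+ f n) ℚ.+ f (suc n)      ≤⟨ ℚ.+-monoʳ-≤ ((1ℚ ℚ.- q) ℚ.* (S ℚ.+ f n)) (ratio n) ⟩
  (1ℚ ℚ.- q) ℚ.* (S ℚ.+ f n) ℚ.+ q ℚ.* f n      ≡⟨ solve 3 (λ q s x → (con 1ℚ :- q) :* (s :+ x) :+ q :* x
                                                        := (con 1ℚ :- q) :* s :+ x) refl q S (f n) ⟩
  (1ℚ ℚ.- q) ℚ.* S ℚ.+ f n                      ≤⟨ geometric {f} {q} ratio n ⟩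
  f 0                                           ∎
  where open ℚ.≤-Reasoning
        open +-*-Solver
        S = Σℚ< f n

-- The exponential series and its majorant

1/suc : ℕ → ℚ
1/suc k = + 1 ℚ./ suc k

κ : ℚ → ℚ[i]
κ r = r , 0ℚ

∥κr∥≡r : ∀ {r} → 0ℚ ℚ.≤ r → ∥ κ r ∥ ≡ r
∥κr∥≡r {r} 0≤r = trans (ℚ.+-identityʳ (∣ r ∣)) (ℚ.0≤p⇒∣p∣≡p 0≤r)

κ-* : ∀ r s → κ r ⊗ κ s ≡ κ (r ℚ.* s)
κ-* r s = cong₂ _,_ (solve 2 (λ r s → r :* s :- con 0ℚ :* con 0ℚ := r :* s) refl r s)
                    (solve 2 (λ r s → r :* con 0ℚ :+ con 0ℚ :* s := con 0ℚ) refl r s)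
  where open +-*-Solver

-- The term z^k / k!, defined by its ratio to the previous one, which is all that the estimates and
-- the functional equation use. `t` is the same term for a real bound on the norm.
T : ℚ[i] → ℕ → ℚ[i]
T z zero    = 1ᵢ
T z (suc k) = κ (1/suc k) ⊗ (z ⊗ T z k)

t : ℚ → ℕ → ℚ
t x zero    = 1ℚ
t x (suc k) = 1/suc k ℚ.* (x ℚ.* t x k)

E : ℚ[i] → ℕ → ℚ[i]
E z = Σ< (T z)

κ[1+k]⊗T : ∀ z k → κ (fromℕ (suc k)) ⊗ T z (suc k) ≡ z ⊗ T z k
κ[1+k]⊗T z k = begin
  κ (fromℕ (suc k)) ⊗ (κ (1/suc k) ⊗ (z ⊗ T z k))
    ≡⟨ C.*-assoc (κ (fromℕ (suc k))) (κ (1/suc k)) (z ⊗ T z k) ⟨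
  (κ (fromℕ (suc k)) ⊗ κ (1/suc k)) ⊗ (z ⊗ T z k)
    ≡⟨ cong (_⊗ (z ⊗ T z k)) (trans (κ-* (fromℕ (suc k)) (1/suc k))
         (cong κ (trans (ℚ.*-comm (fromℕ (suc k)) (1/suc k)) (1/n*n≡1 (suc k))))) ⟩
  1ᵢ ⊗ (z ⊗ T z k)
    ≡⟨ C.*-identityˡ (z ⊗ T z k) ⟩
  z ⊗ T z k ∎
  where open ≡-Reasoning

[1+k]*t : ∀ x k → fromℕ (suc k) ℚ.* t x (suc k) ≡ x ℚ.* t x k
[1+k]*t x k = trans (solve 3 (λ m i y → m :* (i :* y) := (i :* m) :* y) refl (fromℕ (suc k)) (1/suc k) (x ℚ.* t x k))
  (trans (cong (ℚ._* (x ℚ.* t x k)) (1/n*n≡1 (suc k))) (ℚ.*-identityˡ (x ℚ.* t x k)))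
  where open +-*-Solver

0≤t : ∀ {x} → 0ℚ ℚ.≤ x → ∀ k → 0ℚ ℚ.≤ t x k
0≤t 0≤x zero    = 0≤1
0≤t 0≤x (suc k) = 0≤p*q (0≤1/n (suc k)) (0≤p*q 0≤x (0≤t 0≤x k))

∥T∥≤t : ∀ z {B} → ∥ z ∥ ℚ.≤ B → ∀ k → ∥ T z k ∥ ℚ.≤ t B k
∥T∥≤t z z≤B zero    = ℚ.≤-refl
∥T∥≤t z z≤B (suc k) = ∥⊗∥-mono (κ (1/suc k)) (z ⊗ T z k) (ℚ.≤-reflexive (∥κr∥≡r (0≤1/n (suc k))))
  (∥⊗∥-mono z (T z k) z≤B (∥T∥≤t z z≤B k))

-- Consecutive terms have ratio x / (k + 1).
t-ratio : ∀ {x q} k → 0ℚ ℚ.≤ x → x ℚ.≤ q ℚ.* fromℕ (suc k) → t x (suc k) ℚ.≤ q ℚ.* t x k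
t-ratio {x} {q} k 0≤x x≤q[1+k] = begin
  1/suc k ℚ.* (x ℚ.* t x k)
    ≤⟨ *-mono-≤ (0≤p*q 0≤x (0≤t 0≤x k)) (0≤1/n (suc k)) ℚ.≤-refl
         (*-mono-≤ (0≤t 0≤x k) (ℚ.≤-trans 0≤x x≤q[1+k]) x≤q[1+k] ℚ.≤-refl) ⟩
  1/suc k ℚ.* ((q ℚ.* fromℕ (suc k)) ℚ.* t x k)
    ≡⟨ solve 4 (λ i q m y → i :* ((q :* m) :* y) := (i :* m) :* (q :* y)) refl (1/suc k) q (fromℕ (suc k)) (t x k) ⟩
  (1/suc k ℚ.* fromℕ (suc k)) ℚ.* (q ℚ.* t x k)
    ≡⟨ trans (cong (ℚ._* (q ℚ.* t x k)) (1/n*n≡1 (suc k))) (ℚ.*-identityˡ (q ℚ.* t x k)) ⟩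
  q ℚ.* t x k ∎
  where open ℚ.≤-Reasoning
        open +-*-Solver

-- From an index K ≥ 2B on, the terms at least halve, so a tail is at most twice its first term; J
-- further halvings bring that term below ½ε.
t-tail : ∀ {B} → 0ℚ ℚ.≤ B → ∀ {ε} → 0ℚ ℚ.< ε →
         ∃ λ N → ∀ p → N ℕ.≤ p → ∀ n → Σℚ< (shift p (t B)) n ℚ.≤ ε
t-tail {B} 0≤B {ε} 0<ε = K ℕ.+ J , bound
  where
  open ℚ.≤-Reasoning
  open +-*-Solver
  K = proj₁ (archimedean (B ℚ.+ B))
  2B≤K = proj₂ (archimedean (B ℚ.+ B))
  ratio : ∀ k → K ℕ.≤ k → t B (suc k) ℚ.≤ ½ ℚ.* t B k
  ratio k K≤k = t-ratio {q = ½} k 0≤B (begin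
    B                           ≡⟨ solve 1 (λ b → b := con ½ :* (b :+ b)) refl B ⟩
    ½ ℚ.* (B ℚ.+ B)             ≤⟨ *-mono-≤ (0≤p+q 0≤B 0≤B) 0≤½ ℚ.≤-refl
                                     (ℚ.≤-trans 2B≤K (fromℕ-mono-≤ (ℕ.m≤n⇒m≤1+n K≤k))) ⟩
    ½ ℚ.* fromℕ (suc k)         ∎)
    where
    0≤½ = ℚ.<⇒≤ (ℚ.positive⁻¹ ½)
    0≤p+q : ∀ {p q} → 0ℚ ℚ.≤ p → 0ℚ ℚ.≤ q → 0ℚ ℚ.≤ p ℚ.+ q
    0≤p+q = ℚ.+-mono-≤
  small = pow-small {½} (ℚ.positive⁻¹ ½) (ℚ.<⇒≤ (ℚ.positive⁻¹ ½)) (0≤t 0≤B K) (0<½*ε 0<ε)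
  J = proj₁ small
  decay : ∀ j → t B (K ℕ.+ j) ℚ.≤ t B K ℚ.* pow ½ j
  decay zero    = ℚ.≤-reflexive (trans (cong (t B) (ℕ.+-identityʳ K)) (sym (ℚ.*-identityʳ (t B K))))
  decay (suc j) = begin
    t B (K ℕ.+ suc j)              ≡⟨ cong (t B) (ℕ.+-suc K j) ⟩
    t B (suc (K ℕ.+ j))            ≤⟨ ratio (K ℕ.+ j) (ℕ.m≤m+n K j) ⟩
    ½ ℚ.* t B (K ℕ.+ j)            ≤⟨ ℚ.*-monoˡ-≤-nonNeg ½ (decay j) ⟩
    ½ ℚ.* (t B K ℚ.* pow ½ j)      ≡⟨ solve 2 (λ x y → con ½ :* (x :* y) := x :* (con ½ :* y)) refl (t B K) (pow ½ j) ⟩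
    t B K ℚ.* pow ½ (suc j)        ∎
  bound : ∀ p → K ℕ.+ J ℕ.≤ p → ∀ n → Σℚ< (shift p (t B)) n ℚ.≤ ε
  bound p KJ≤p n = begin
    S                                   ≡⟨ solve 1 (λ s → s := con ½ :* s :+ con ½ :* s) refl S ⟩
    ½ ℚ.* S ℚ.+ ½ ℚ.* S                 ≤⟨ ℚ.+-mono-≤ ½S≤ ½S≤ ⟩
    t B p ℚ.+ t B p                     ≤⟨ ℚ.+-mono-≤ tp≤ tp≤ ⟩
    ½ ℚ.* ε ℚ.+ ½ ℚ.* ε                 ≡⟨ ½*ε+½*ε≡ε ε ⟩
    ε                                   ∎
    where
    S = Σℚ< (shift p (t B)) n
    K≤p = ℕ.m+n≤o⇒m≤o K KJ≤p
    ½S≤ : ½ ℚ.* S ℚ.≤ t B p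
    ½S≤ = ℚ.≤-trans (p≤p+q (0≤t 0≤B (p ℕ.+ n))) (ℚ.≤-trans
      (geometric {shift p (t B)} {½} (λ k → subst (λ m → t B m ℚ.≤ ½ ℚ.* t B (p ℕ.+ k)) (sym (ℕ.+-suc p k))
        (ratio (p ℕ.+ k) (ℕ.≤-trans K≤p (ℕ.m≤m+n p k)))) n)
      (ℚ.≤-reflexive (cong (t B) (ℕ.+-identityʳ p))))
    tp≤ : t B p ℚ.≤ ½ ℚ.* ε
    tp≤ = subst (λ m → t B m ℚ.≤ ½ ℚ.* ε) (ℕ.m+[n∸m]≡n K≤p)
      (ℚ.≤-trans (decay (p ℕ.∸ K)) (proj₂ small (p ℕ.∸ K) (ℕ.m+n≤o⇒m≤o∸n J (subst (ℕ._≤ p) (ℕ.+-comm K J) KJ≤p))))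

-- The bound is a partial sum up to a point after which the tail is at most 1. Sums are first
-- prolonged by `N` terms, which covers the indices below `N` too.
t-bounded : ∀ {B} → 0ℚ ℚ.≤ B → ∃ λ M → 0ℚ ℚ.< M × (∀ n → Σℚ< (t B) n ℚ.≤ M)
t-bounded {B} 0≤B =
  let N , h = t-tail 0≤B (ℚ.positive⁻¹ 1ℚ)
  in Σℚ< (t B) N ℚ.+ 1ℚ , ℚ.+-mono-≤-< (0≤Σℚ< (0≤t 0≤B) N) (ℚ.positive⁻¹ 1ℚ) , λ n → begin
    Σℚ< (t B) n                                 ≤⟨ p≤p+q (0≤Σℚ< (λ k → 0≤t 0≤B (n ℕ.+ k)) N) ⟩
    Σℚ< (t B) n ℚ.+ Σℚ< (shift n (t B)) N       ≡⟨ Σℚ<-shift (t B) n N ⟨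
    Σℚ< (t B) (n ℕ.+ N)                         ≡⟨ cong (Σℚ< (t B)) (ℕ.+-comm n N) ⟩
    Σℚ< (t B) (N ℕ.+ n)                         ≡⟨ Σℚ<-shift (t B) N n ⟩
    Σℚ< (t B) N ℚ.+ Σℚ< (shift N (t B)) n       ≤⟨ ℚ.+-monoʳ-≤ (Σℚ< (t B) N) (h N ℕ.≤-refl n) ⟩
    Σℚ< (t B) N ℚ.+ 1ℚ                          ∎
  where open ℚ.≤-Reasoning

-- The functional equation

-- The sum of f k ⊗ g (n - k) over k ≤ n. Shifting `f` in the recursion avoids subtraction of
-- indices.
cauchy-product : (ℕ → ℚ[i]) → (ℕ → ℚ[i]) → ℕ → ℚ[i]
cauchy-product f g zero    = f 0 ⊗ g 0
cauchy-product f g (suc n) = f 0 ⊗ g (suc n) ⊕ cauchy-product (f ∘ suc) g n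

cp-cong : ∀ {f f′} g → (∀ k → f k ≡ f′ k) → ∀ n → cauchy-product f g n ≡ cauchy-product f′ g n
cp-cong g f≡f′ zero    = cong (_⊗ g 0) (f≡f′ 0)
cp-cong g f≡f′ (suc n) = cong₂ _⊕_ (cong (_⊗ g (suc n)) (f≡f′ 0)) (cp-cong g (f≡f′ ∘ suc) n)

cp-⊕ : ∀ f f′ g n → cauchy-product (λ k → f k ⊕ f′ k) g n ≡ cauchy-product f g n ⊕ cauchy-product f′ g n
cp-⊕ f f′ g zero    = C.distribʳ (g 0) (f 0) (f′ 0)
cp-⊕ f f′ g (suc n) = trans (cong ((f 0 ⊕ f′ 0) ⊗ g (suc n) ⊕_) (cp-⊕ (f ∘ suc) (f′ ∘ suc) g n))
  (solve 5 (λ a a′ b c c′ → (a :+ a′) :* b :+ (c :+ c′) := (a :* b :+ c) :+ (a′ :* b :+ c′)) refl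
    (f 0) (f′ 0) (g (suc n)) (cauchy-product (f ∘ suc) g n) (cauchy-product (f′ ∘ suc) g n))
  where open C-Solver

cp-⊗ : ∀ z f g n → cauchy-product (λ k → z ⊗ f k) g n ≡ z ⊗ cauchy-product f g n
cp-⊗ z f g zero    = C.*-assoc z (f 0) (g 0)
cp-⊗ z f g (suc n) = trans (cong ((z ⊗ f 0) ⊗ g (suc n) ⊕_) (cp-⊗ z (f ∘ suc) g n))
  (solve 4 (λ z a b c → (z :* a) :* b :+ z :* c := z :* (a :* b :+ c)) refl
    z (f 0) (g (suc n)) (cauchy-product (f ∘ suc) g n))
  where open C-Solver

cp-suc : ∀ f g n → cauchy-product f g (suc n) ≡ cauchy-product f (g ∘ suc) n ⊕ f (suc n) ⊗ g 0
cp-suc f g zero    = refl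
cp-suc f g (suc n) = trans (cong (f 0 ⊗ g (suc (suc n)) ⊕_) (cp-suc (f ∘ suc) g n))
  (sym (C.+-assoc (f 0 ⊗ g (suc (suc n))) (cauchy-product (f ∘ suc) (g ∘ suc) n) (f (suc (suc n)) ⊗ g 0)))

cp-comm : ∀ f g n → cauchy-product f g n ≡ cauchy-product g f n
cp-comm f g zero    = C.*-comm (f 0) (g 0)
cp-comm f g (suc n) = trans (cong₂ _⊕_ (C.*-comm (f 0) (g (suc n))) (cp-comm (f ∘ suc) g n))
  (trans (C.+-comm (g (suc n) ⊗ f 0) (cauchy-product g (f ∘ suc) n)) (sym (cp-suc g f n)))

-- θ is a derivation for the Cauchy product and θ (T z) (suc n) ≡ z ⊗ T z n, so
-- the Cauchy product of T z and T w satisfies the recursion defining T (z ⊕ w).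
θ : (ℕ → ℚ[i]) → ℕ → ℚ[i]
θ f k = κ (fromℕ k) ⊗ f k

θ-suc : ∀ f k → θ f (suc k) ≡ θ (f ∘ suc) k ⊕ f (suc k)
θ-suc f k = solve 2 (λ m a → (con 1ᵢ :+ m) :* a := m :* a :+ a) refl (κ (fromℕ k)) (f (suc k))
  where open C-Solver

θ-cp : ∀ f g n → θ (cauchy-product f g) n ≡ cauchy-product (θ f) g n ⊕ cauchy-product f (θ g) n
θ-cp f g zero = solve 2 (λ a b → con 0ᵢ :* (a :* b) := (con 0ᵢ :* a) :* b :+ a :* (con 0ᵢ :* b)) refl (f 0) (g 0)
  where open C-Solver
θ-cp f g (suc n) = begin
  κ (fromℕ (suc n)) ⊗ (f 0 ⊗ g (suc n) ⊕ P)
    ≡⟨ solve 4 (λ m a b p → (con 1ᵢ :+ m) :* (a :* b :+ p)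
         := ((con 0ᵢ :* a) :* b :+ (m :* p :+ p)) :+ a :* ((con 1ᵢ :+ m) :* b)) refl
         (κ (fromℕ n)) (f 0) (g (suc n)) P ⟩
  ((θ f 0 ⊗ g (suc n)) ⊕ (θ (cauchy-product (f ∘ suc) g) n ⊕ P)) ⊕ f 0 ⊗ θ g (suc n)
    ≡⟨ cong (λ x → ((θ f 0 ⊗ g (suc n)) ⊕ (x ⊕ P)) ⊕ f 0 ⊗ θ g (suc n)) (θ-cp (f ∘ suc) g n) ⟩
  ((θ f 0 ⊗ g (suc n)) ⊕ ((P₁ ⊕ P₂) ⊕ P)) ⊕ f 0 ⊗ θ g (suc n)
    ≡⟨ solve 5 (λ a b p q r → (a :+ ((p :+ q) :+ r)) :+ b := (a :+ (p :+ r)) :+ (b :+ q)) refl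
         (θ f 0 ⊗ g (suc n)) (f 0 ⊗ θ g (suc n)) P₁ P₂ P ⟩
  ((θ f 0 ⊗ g (suc n)) ⊕ (P₁ ⊕ P)) ⊕ (f 0 ⊗ θ g (suc n) ⊕ P₂)
    ≡⟨ cong (λ x → ((θ f 0 ⊗ g (suc n)) ⊕ x) ⊕ (f 0 ⊗ θ g (suc n) ⊕ P₂))
         (trans (cp-cong g (θ-suc f) n) (cp-⊕ (θ (f ∘ suc)) (f ∘ suc) g n)) ⟨
  cauchy-product (θ f) g (suc n) ⊕ cauchy-product f (θ g) (suc n) ∎
  where
  open ≡-Reasoning
  open C-Solver
  P  = cauchy-product (f ∘ suc) g n
  P₁ = cauchy-product (θ (f ∘ suc)) g n
  P₂ = cauchy-product (f ∘ suc) (θ g) n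

T-⊕ : ∀ z h n → T (z ⊕ h) n ≡ cauchy-product (T z) (T h) n
T-⊕ z h zero    = refl
T-⊕ z h (suc n) = begin
  κ (1/suc n) ⊗ ((z ⊕ h) ⊗ T (z ⊕ h) n)
    ≡⟨ cong (λ x → κ (1/suc n) ⊗ ((z ⊕ h) ⊗ x)) (T-⊕ z h n) ⟩
  κ (1/suc n) ⊗ ((z ⊕ h) ⊗ P)
    ≡⟨ cong (κ (1/suc n) ⊗_) (C.distribʳ P z h) ⟩
  κ (1/suc n) ⊗ (z ⊗ P ⊕ h ⊗ P)
    ≡⟨ cong (κ (1/suc n) ⊗_) (cong₂ _⊕_ (derivative z h) (trans (cong (h ⊗_) (cp-comm (T z) (T h) n))
         (trans (derivative h z) (cp-comm (θ (T h)) (T z) (suc n))))) ⟩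
  κ (1/suc n) ⊗ (cauchy-product (θ (T z)) (T h) (suc n) ⊕ cauchy-product (T z) (θ (T h)) (suc n))
    ≡⟨ cong (κ (1/suc n) ⊗_) (θ-cp (T z) (T h) (suc n)) ⟨
  κ (1/suc n) ⊗ (κ (fromℕ (suc n)) ⊗ cauchy-product (T z) (T h) (suc n))
    ≡⟨ C.*-assoc (κ (1/suc n)) (κ (fromℕ (suc n))) (cauchy-product (T z) (T h) (suc n)) ⟨
  (κ (1/suc n) ⊗ κ (fromℕ (suc n))) ⊗ cauchy-product (T z) (T h) (suc n)
    ≡⟨ cong (_⊗ cauchy-product (T z) (T h) (suc n))
         (trans (κ-* (1/suc n) (fromℕ (suc n))) (cong κ (1/n*n≡1 (suc n)))) ⟩
  1ᵢ ⊗ cauchy-product (T z) (T h) (suc n)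
    ≡⟨ C.*-identityˡ (cauchy-product (T z) (T h) (suc n)) ⟩
  cauchy-product (T z) (T h) (suc n) ∎
  where
  open ≡-Reasoning
  P = cauchy-product (T z) (T h) n
  derivative : ∀ x y → x ⊗ cauchy-product (T x) (T y) n ≡ cauchy-product (θ (T x)) (T y) (suc n)
  derivative x y = sym (trans (cong₂ _⊕_
      (solve 1 (λ a → (con 0ᵢ :* con 1ᵢ) :* a := con 0ᵢ) refl (T y (suc n)))
      (trans (cp-cong (T y) (κ[1+k]⊗T x) n) (cp-⊗ x (T x) (T y) n)))
    (C.+-identityˡ (x ⊗ cauchy-product (T x) (T y) n)))
    where open C-Solver

-- The terms of the product of two partial sums that are missing from the
-- partial sum of the Cauchy product.
Δ : (ℕ → ℚ[i]) → (ℕ → ℚ[i]) → ℕ → ℚ[i]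
Δ f g n = Σ< f n ⊗ Σ< g n ⊕ ⊖ Σ< (cauchy-product f g) n

-- Index pairs are missing when their sum exceeds `n`. None of them involves `f 0`, so `f` may be
-- shifted; those with the last term `g n` then form the first summand.
Δ-suc : ∀ f g n → Δ f g (suc n) ≡ Σ< (f ∘ suc) n ⊗ g n ⊕ Δ (f ∘ suc) g n
Δ-suc f g n = trans (cong₂ (λ x y → x ⊗ Σ< g (suc n) ⊕ ⊖ y) (Σ<-suc f n) (Σ<-cp-suc n))
  (solve 5 (λ a s u b q → (a :+ s) :* (u :+ b) :+ (:- (a :* (u :+ b) :+ q)) := s :* b :+ (s :* u :+ (:- q))) refl
    (f 0) (Σ< (f ∘ suc) n) (Σ< g n) (g n) (Σ< (cauchy-product (f ∘ suc) g) n))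
  where
  open C-Solver
  Σ<-cp-suc : ∀ n → Σ< (cauchy-product f g) (suc n) ≡ f 0 ⊗ Σ< g (suc n) ⊕ Σ< (cauchy-product (f ∘ suc) g) n
  Σ<-cp-suc zero    = solve 2 (λ a b → con 0ᵢ :+ a :* b := a :* (con 0ᵢ :+ b) :+ con 0ᵢ) refl (f 0) (g 0)
  Σ<-cp-suc (suc n) = trans (cong (_⊕ cauchy-product f g (suc n)) (Σ<-cp-suc n))
    (solve 5 (λ a u q b p → (a :* u :+ q) :+ (a :* b :+ p) := a :* (u :+ b) :+ (q :+ p)) refl
      (f 0) (Σ< g (suc n)) (Σ< (cauchy-product (f ∘ suc) g) n) (g (suc n)) (cauchy-product (f ∘ suc) g n))

-- The missing terms containing `g j` amount to `g j` times a partial sum of `f` starting at p + m -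
-- j. For j < m this start lies beyond `p`, which gives the small bound α′; the remaining `p`
-- indices only have the bound α, but there the terms of `b` are far out.
Δ-bound : ∀ {f g b α α′} p m → (∀ s n → ∥ Σ< (shift s f) n ∥ ℚ.≤ α) →
          (∀ s n → ∥ Σ< (shift (p ℕ.+ s) f) n ∥ ℚ.≤ α′) → (∀ k → ∥ g k ∥ ℚ.≤ b k) →
          ∥ Δ f g (p ℕ.+ m) ∥ ℚ.≤ α ℚ.* Σℚ< (shift m b) p ℚ.+ α′ ℚ.* Σℚ< b m
Δ-bound {α = α} {α′} zero zero _ _ _ = ℚ.≤-reflexive
  (solve 2 (λ a a′ → con 0ℚ := a :* con 0ℚ :+ a′ :* con 0ℚ) refl α α′)
  where open +-*-Solver
Δ-bound {f} {g} {b} {α} {α′} zero (suc m) _ f≤α′ g≤b = begin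
  ∥ Δ f g (suc m) ∥                                        ≡⟨ cong ∥_∥ (Δ-suc f g m) ⟩
  ∥ Σ< (f ∘ suc) m ⊗ g m ⊕ Δ (f ∘ suc) g m ∥
    ≤⟨ ∥⊕∥-mono (Σ< (f ∘ suc) m ⊗ g m) (Δ (f ∘ suc) g m) (∥⊗∥-mono (Σ< (f ∘ suc) m) (g m) (f≤α′ 1 m) (g≤b m))
         (Δ-bound {f ∘ suc} zero m (f≤α′ ∘ suc) (f≤α′ ∘ suc) g≤b) ⟩
  α′ ℚ.* b m ℚ.+ (α′ ℚ.* 0ℚ ℚ.+ α′ ℚ.* Σℚ< b m)
    ≡⟨ solve 4 (λ a a′ x y → a′ :* x :+ (a′ :* con 0ℚ :+ a′ :* y) := a :* con 0ℚ :+ a′ :* (y :+ x)) refl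
         α α′ (b m) (Σℚ< b m) ⟩
  α ℚ.* 0ℚ ℚ.+ α′ ℚ.* Σℚ< b (suc m) ∎
  where open ℚ.≤-Reasoning
        open +-*-Solver
Δ-bound {f} {g} {b} {α} {α′} (suc p) m f≤α f≤α′ g≤b = begin
  ∥ Δ f g (suc (p ℕ.+ m)) ∥                                ≡⟨ cong ∥_∥ (Δ-suc f g (p ℕ.+ m)) ⟩
  ∥ Σ< (f ∘ suc) (p ℕ.+ m) ⊗ g (p ℕ.+ m) ⊕ Δ (f ∘ suc) g (p ℕ.+ m) ∥
    ≤⟨ ∥⊕∥-mono (Σ< (f ∘ suc) (p ℕ.+ m) ⊗ g (p ℕ.+ m)) (Δ (f ∘ suc) g (p ℕ.+ m))
         (∥⊗∥-mono (Σ< (f ∘ suc) (p ℕ.+ m)) (g (p ℕ.+ m)) (f≤α 1 (p ℕ.+ m)) (g≤b (p ℕ.+ m)))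
         (Δ-bound {f ∘ suc} p m (f≤α ∘ suc) f≤α′ g≤b) ⟩
  α ℚ.* b (p ℕ.+ m) ℚ.+ (α ℚ.* Σℚ< (shift m b) p ℚ.+ α′ ℚ.* Σℚ< b m)
    ≡⟨ cong (λ k → α ℚ.* b k ℚ.+ (α ℚ.* Σℚ< (shift m b) p ℚ.+ α′ ℚ.* Σℚ< b m)) (ℕ.+-comm p m) ⟩
  α ℚ.* b (m ℕ.+ p) ℚ.+ (α ℚ.* Σℚ< (shift m b) p ℚ.+ α′ ℚ.* Σℚ< b m)
    ≡⟨ solve 4 (λ a x y z → a :* x :+ (a :* y :+ z) := a :* (y :+ x) :+ z) refl
         α (b (m ℕ.+ p)) (Σℚ< (shift m b) p) (α′ ℚ.* Σℚ< b m) ⟩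
  α ℚ.* Σℚ< (shift m b) (suc p) ℚ.+ α′ ℚ.* Σℚ< b m ∎
  where open ℚ.≤-Reasoning
        open +-*-Solver

-- For n ≥ 2N, split as N + (n - N), one factor of each missing product lies in a tail of size δ
-- while the other is bounded by M, so the error is at most 2Mδ = ε. The index depends on `z` and
-- `h` only through `B`, as the diagonal values of `cis` require.
E-⊕ : ∀ {B} → 0ℚ ℚ.≤ B → ∀ {ε} → 0ℚ ℚ.< ε → ∃ λ N → ∀ n → N ℕ.≤ n → ∀ z h → ∥ z ∥ ℚ.≤ B → ∥ h ∥ ℚ.≤ B →
      ∥ E z n ⊗ E h n ⊕ ⊖ E (z ⊕ h) n ∥ ℚ.≤ ε
E-⊕ {B} 0≤B {ε} 0<ε =
  let M , 0<M , Σ≤M = t-bounded 0≤B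
      δ , 0<δ , 2Mδ≡ε = ∃-divide 0<ε (ℚ.+-mono-< 0<M 0<M)
      N , tail = t-tail 0≤B 0<δ
      Σ≤ : ∀ z → ∥ z ∥ ℚ.≤ B → ∀ s n → ∥ Σ< (shift s (T z)) n ∥ ℚ.≤ Σℚ< (shift s (t B)) n
      Σ≤ z z≤B s n = ∥Σ<∥≤Σℚ< (λ k → ∥T∥≤t z z≤B (s ℕ.+ k)) n
  in N ℕ.+ N , λ n 2N≤n z h z≤B h≤B →
    let N≤n = ℕ.m+n≤o⇒m≤o N 2N≤n
        m   = n ℕ.∸ N
    in begin
    ∥ E z n ⊗ E h n ⊕ ⊖ E (z ⊕ h) n ∥
      ≡⟨ cong (λ x → ∥ E z n ⊗ E h n ⊕ ⊖ x ∥) (Σ<-cong (T-⊕ z h) n) ⟩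
    ∥ Δ (T z) (T h) n ∥
      ≡⟨ cong (λ k → ∥ Δ (T z) (T h) k ∥) (ℕ.m+[n∸m]≡n N≤n) ⟨
    ∥ Δ (T z) (T h) (N ℕ.+ m) ∥
      ≤⟨ Δ-bound N m
           (λ s k → ℚ.≤-trans (Σ≤ z z≤B s k) (ℚ.≤-trans
             (ℚ.≤-trans (subst (Σℚ< (shift s (t B)) k ℚ.≤_) (ℚ.+-comm (Σℚ< (shift s (t B)) k) (Σℚ< (t B) s))
               (p≤p+q (0≤Σℚ< (0≤t 0≤B) s))) (ℚ.≤-reflexive (sym (Σℚ<-shift (t B) s k)))) (Σ≤M (s ℕ.+ k))))
           (λ s k → ℚ.≤-trans (Σ≤ z z≤B (N ℕ.+ s) k) (tail (N ℕ.+ s) (ℕ.m≤m+n N s) k))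
           (∥T∥≤t h h≤B) ⟩
    M ℚ.* Σℚ< (shift m (t B)) N ℚ.+ δ ℚ.* Σℚ< (t B) m
      ≤⟨ ℚ.+-mono-≤
           (*-mono-≤ (0≤Σℚ< (λ k → 0≤t 0≤B (m ℕ.+ k)) N) (ℚ.<⇒≤ 0<M) ℚ.≤-refl (tail m (ℕ.m+n≤o⇒m≤o∸n N 2N≤n) N))
           (*-mono-≤ (0≤Σℚ< (0≤t 0≤B) m) (ℚ.<⇒≤ 0<δ) ℚ.≤-refl (Σ≤M m)) ⟩
    M ℚ.* δ ℚ.+ δ ℚ.* M
      ≡⟨ solve 2 (λ m d → m :* d :+ d :* m := (m :+ m) :* d) refl M δ ⟩
    (M ℚ.+ M) ℚ.* δ
      ≡⟨ 2Mδ≡ε ⟩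
    ε ∎
  where
  open ℚ.≤-Reasoning
  open +-*-Solver

∥⊖∥-sym : ∀ z w → ∥ z ⊕ ⊖ w ∥ ≡ ∥ w ⊕ ⊖ z ∥
∥⊖∥-sym (a , b) (c , d) = cong₂ ℚ._+_ (∣p-q∣≡∣q-p∣ a c) (∣p-q∣≡∣q-p∣ b d)

∥⊖∥-triangle : ∀ z v w → ∥ z ⊕ ⊖ w ∥ ℚ.≤ ∥ z ⊕ ⊖ v ∥ ℚ.+ ∥ v ⊕ ⊖ w ∥
∥⊖∥-triangle z v w = subst (λ x → ∥ x ∥ ℚ.≤ ∥ z ⊕ ⊖ v ∥ ℚ.+ ∥ v ⊕ ⊖ w ∥)
  (solve 3 (λ z v w → (z :- v) :+ (v :- w) := z :- w) refl z v w)
  (∥z⊕w∥≤∥z∥+∥w∥ (z ⊕ ⊖ v) (v ⊕ ⊖ w))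
  where open C-Solver

-- Distances of partial sums

-- The majorant of the derivative of z^k / k! is the previous term of `t B`, so the Lipschitz
-- constants `s` are `t B` shifted by one place and sum to at most `M` again.
E-lipschitz : ∀ {B M} → 0ℚ ℚ.≤ B → (∀ n → Σℚ< (t B) n ℚ.≤ M) →
              ∀ z w → ∥ z ∥ ℚ.≤ B → ∥ w ∥ ℚ.≤ B → ∀ n → ∥ E w n ⊕ ⊖ E z n ∥ ℚ.≤ ∥ w ⊕ ⊖ z ∥ ℚ.* M
E-lipschitz {B} {M} 0≤B Σ≤M z w z≤B w≤B n = ℚ.≤-trans
  (subst₂ ℚ._≤_ (cong ∥_∥ (sym (E-diff n))) (Σ-factor n) (∥Σ<∥≤Σℚ< D≤ n))
  (*-mono-≤ (0≤Σℚ< 0≤s n) (0≤∥z∥ h) ℚ.≤-refl (Σs≤M n))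
  where
  open C-Solver
  h = w ⊕ ⊖ z
  D = λ k → T w k ⊕ ⊖ T z k
  s : ℕ → ℚ
  s zero    = 0ℚ
  s (suc k) = t B k
  0≤s : ∀ k → 0ℚ ℚ.≤ s k
  0≤s zero    = ℚ.≤-refl
  0≤s (suc k) = 0≤t 0≤B k
  Σs≤M : ∀ n → Σℚ< s n ℚ.≤ M
  Σs≤M zero    = Σ≤M 0
  Σs≤M (suc n) = ℚ.≤-trans (ℚ.≤-reflexive (trans (Σℚ<-shift s 1 n) (ℚ.+-identityˡ (Σℚ< (t B) n)))) (Σ≤M n)
  E-diff : ∀ n → E w n ⊕ ⊖ E z n ≡ Σ< D n
  E-diff zero    = refl
  E-diff (suc n) = trans (solve 4 (λ a b c d → (a :+ b) :- (c :+ d) := (a :- c) :+ (b :- d)) refl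
    (E w n) (T w n) (E z n) (T z n)) (cong (_⊕ D n) (E-diff n))
  Σ-factor : ∀ n → Σℚ< (λ k → ∥ h ∥ ℚ.* s k) n ≡ ∥ h ∥ ℚ.* Σℚ< s n
  Σ-factor zero    = sym (ℚ.*-zeroʳ (∥ h ∥))
  Σ-factor (suc n) = trans (cong (ℚ._+ ∥ h ∥ ℚ.* s n) (Σ-factor n)) (sym (ℚ.*-distribˡ-+ (∥ h ∥) (Σℚ< s n) (s n)))
  B*s : ∀ k → B ℚ.* s k ≡ fromℕ k ℚ.* t B k
  B*s zero    = trans (ℚ.*-zeroʳ B) (sym (ℚ.*-zeroˡ 1ℚ))
  B*s (suc k) = sym ([1+k]*t B k)
  D≤ : ∀ k → ∥ D k ∥ ℚ.≤ ∥ h ∥ ℚ.* s k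
  D≤ zero    = ℚ.≤-reflexive (sym (ℚ.*-zeroʳ (∥ h ∥)))
  D≤ (suc k) = begin
    ∥ D (suc k) ∥
      ≡⟨ cong ∥_∥ (solve 5 (λ i z w x y → i :* (w :* x) :- i :* (z :* y) := i :* (w :* (x :- y) :+ (w :- z) :* y))
           refl (κ (1/suc k)) z w (T w k) (T z k)) ⟩
    ∥ κ (1/suc k) ⊗ (w ⊗ D k ⊕ h ⊗ T z k) ∥
      ≤⟨ ∥⊗∥-mono (κ (1/suc k)) (w ⊗ D k ⊕ h ⊗ T z k) (ℚ.≤-reflexive (∥κr∥≡r (0≤1/n (suc k))))
           (∥⊕∥-mono (w ⊗ D k) (h ⊗ T z k) (∥⊗∥-mono w (D k) w≤B (D≤ k))
             (∥⊗∥-mono h (T z k) ℚ.≤-refl (∥T∥≤t z z≤B k))) ⟩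
    1/suc k ℚ.* (B ℚ.* (∥ h ∥ ℚ.* s k) ℚ.+ ∥ h ∥ ℚ.* t B k)
      ≡⟨ Q.solve 5 (λ i b h s t → i Q.:* (b Q.:* (h Q.:* s) Q.:+ h Q.:* t) Q.:= i Q.:* (h Q.:* (b Q.:* s Q.:+ t))) refl
           (1/suc k) B (∥ h ∥) (s k) (t B k) ⟩
    1/suc k ℚ.* (∥ h ∥ ℚ.* (B ℚ.* s k ℚ.+ t B k))
      ≡⟨ cong (λ x → 1/suc k ℚ.* (∥ h ∥ ℚ.* (x ℚ.+ t B k))) (B*s k) ⟩
    1/suc k ℚ.* (∥ h ∥ ℚ.* (fromℕ k ℚ.* t B k ℚ.+ t B k))
      ≡⟨ Q.solve 4 (λ i h m t → i Q.:* (h Q.:* (m Q.:* t Q.:+ t)) Q.:= (i Q.:* (Q.con 1ℚ Q.:+ m)) Q.:* (h Q.:* t)) refl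
           (1/suc k) (∥ h ∥) (fromℕ k) (t B k) ⟩
    (1/suc k ℚ.* fromℕ (suc k)) ℚ.* (∥ h ∥ ℚ.* t B k)
      ≡⟨ trans (cong (ℚ._* (∥ h ∥ ℚ.* t B k)) (1/n*n≡1 (suc k))) (ℚ.*-identityˡ (∥ h ∥ ℚ.* t B k)) ⟩
    ∥ h ∥ ℚ.* t B k ∎
    where open ℚ.≤-Reasoning
          module Q = +-*-Solver

E-tail : ∀ {B} → 0ℚ ℚ.≤ B → ∀ {ε} → 0ℚ ℚ.< ε → ∃ λ N → ∀ m n → N ℕ.≤ m → N ℕ.≤ n →
         ∀ z → ∥ z ∥ ℚ.≤ B → ∥ E z m ⊕ ⊖ E z n ∥ ℚ.≤ ε
E-tail {B} 0≤B {ε} 0<ε = N , λ m n N≤m N≤n z z≤B → case m n N≤m N≤n z z≤B (ℕ.≤-total m n)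
  where
  N = proj₁ (t-tail 0≤B 0<ε)
  ordered : ∀ m n → N ℕ.≤ m → m ℕ.≤ n → ∀ z → ∥ z ∥ ℚ.≤ B → ∥ E z n ⊕ ⊖ E z m ∥ ℚ.≤ ε
  ordered m n N≤m m≤n z z≤B = subst (λ k → ∥ E z k ⊕ ⊖ E z m ∥ ℚ.≤ ε) (ℕ.m+[n∸m]≡n m≤n) (begin
    ∥ E z (m ℕ.+ k) ⊕ ⊖ E z m ∥                      ≡⟨ cong (λ x → ∥ x ⊕ ⊖ E z m ∥) (Σ<-shift (T z) m k) ⟩
    ∥ (E z m ⊕ Σ< (shift m (T z)) k) ⊕ ⊖ E z m ∥     ≡⟨ cong ∥_∥ (solve 2 (λ a b → (a :+ b) :- a := b) refl
                                                          (E z m) (Σ< (shift m (T z)) k)) ⟩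
    ∥ Σ< (shift m (T z)) k ∥                         ≤⟨ ∥Σ<∥≤Σℚ< (λ j → ∥T∥≤t z z≤B (m ℕ.+ j)) k ⟩
    Σℚ< (shift m (t B)) k                            ≤⟨ proj₂ (t-tail 0≤B 0<ε) m N≤m k ⟩
    ε                                                ∎)
    where open ℚ.≤-Reasoning
          open C-Solver
          k = n ℕ.∸ m
  case : ∀ m n → N ℕ.≤ m → N ℕ.≤ n → ∀ z → ∥ z ∥ ℚ.≤ B → _ → ∥ E z m ⊕ ⊖ E z n ∥ ℚ.≤ ε
  case m n N≤m N≤n z z≤B (inj₁ m≤n) = subst (ℚ._≤ ε) (∥⊖∥-sym (E z n) (E z m)) (ordered m n N≤m m≤n z z≤B)
  case m n N≤m N≤n z z≤B (inj₂ n≤m) = ordered n m N≤n n≤m z z≤B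

-- Eventual closeness in the norm ∥_∥

infix 4 _≈ℂ[_]_

record _≈ℂ[_]_ (u : ℂ) (ε : ℚ) (v : ℂ) : Set where
  constructor eventually
  field
    from  : ℕ
    bound : ∀ n → from ℕ.≤ n → ∥ at n u ⊕ ⊖ at n v ∥ ℚ.≤ ε

∣a∣≤∥z∥ : ∀ z → ∣ proj₁ z ∣ ℚ.≤ ∥ z ∥
∣a∣≤∥z∥ (a , b) = p≤p+q (ℚ.0≤∣p∣ b)

∣b∣≤∥z∥ : ∀ z → ∣ proj₂ z ∣ ℚ.≤ ∥ z ∥
∣b∣≤∥z∥ (a , b) = subst (∣ b ∣ ℚ.≤_) (ℚ.+-comm (∣ b ∣) (∣ a ∣)) (p≤p+q (ℚ.0≤∣p∣ a))

≈ℂ⇒≈ : ∀ {u v} → (∀ ε → 0ℚ ℚ.< ε → u ≈ℂ[ ε ] v) → u ≈ v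
≈ℂ⇒≈ {u} {v} close =
  mk≈ℝ (λ ε 0<ε → let eventually N h = close ε 0<ε in N , λ n N≤n → ℚ.≤-trans (∣a∣≤∥z∥ (at n u ⊕ ⊖ at n v)) (h n N≤n)) ,≈
  mk≈ℝ (λ ε 0<ε → let eventually N h = close ε 0<ε in N , λ n N≤n → ℚ.≤-trans (∣b∣≤∥z∥ (at n u ⊕ ⊖ at n v)) (h n N≤n))

≈⇒≈ℂ : ∀ {u v} → u ≈ v → ∀ {ε} → 0ℚ ℚ.< ε → u ≈ℂ[ ε ] v
≈⇒≈ℂ (mk≈ℝ p ,≈ mk≈ℝ q) {ε} 0<ε =
  let M , h = p (½ ℚ.* ε) (0<½*ε 0<ε)
      N , k = q (½ ℚ.* ε) (0<½*ε 0<ε)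
  in eventually (M ℕ.⊔ N) λ n ≤n → ℚ.≤-trans
       (ℚ.+-mono-≤ (h n (ℕ.m⊔n≤o⇒m≤o M N ≤n)) (k n (ℕ.m⊔n≤o⇒n≤o M N ≤n))) (ℚ.≤-reflexive (½*ε+½*ε≡ε ε))

≈ℂ-trans : ∀ {u v w r s} → u ≈ℂ[ r ] v → v ≈ℂ[ s ] w → u ≈ℂ[ r ℚ.+ s ] w
≈ℂ-trans {u} {v} {w} (eventually M h) (eventually N k) = eventually (M ℕ.⊔ N) λ n ≤n → ℚ.≤-trans (∥⊖∥-triangle (at n u) (at n v) (at n w))
  (ℚ.+-mono-≤ (h n (ℕ.m⊔n≤o⇒m≤o M N ≤n)) (k n (ℕ.m⊔n≤o⇒n≤o M N ≤n)))

≈ℂ-weaken : ∀ {u v r s} → r ℚ.≤ s → u ≈ℂ[ r ] v → u ≈ℂ[ s ] v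
≈ℂ-weaken r≤s (eventually N h) = eventually N λ n N≤n → ℚ.≤-trans (h n N≤n) r≤s

-- The points of the unit circle

i* : ℚ → ℚ[i]
i* a = 0ℚ , a

∥i*a∥≡∣a∣ : ∀ a → ∥ i* a ∥ ≡ ∣ a ∣
∥i*a∥≡∣a∣ a = ℚ.+-identityˡ (∣ a ∣)

∥i*a⊖i*b∥≡∣a-b∣ : ∀ a b → ∥ i* a ⊕ ⊖ i* b ∥ ≡ ∣ a ℚ.- b ∣
∥i*a⊖i*b∥≡∣a-b∣ a b = ℚ.+-identityˡ (∣ a ℚ.- b ∣)

abstract
  -- Index and argument both change along the diagonal: the change of index is a uniform tail, the
  -- change of argument a Lipschitz estimate.
  cis-cauchy : ∀ α {ε} → 0ℚ ℚ.< ε → ∃ λ N → ∀ m n → N ℕ.≤ m → N ℕ.≤ n →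
               ∥ E (i* (seq α m)) m ⊕ ⊖ E (i* (seq α n)) n ∥ ℚ.≤ ε
  cis-cauchy α {ε} 0<ε =
    let B , K , 0<B , α≤B = eventually-bounded α
        0≤B = ℚ.<⇒≤ 0<B
        M , 0<M , Σ≤M = t-bounded 0≤B
        δ , 0<δ , Mδ≡½ε = ∃-divide (0<½*ε 0<ε) 0<M
        L , tail = E-tail 0≤B (0<½*ε 0<ε)
        N , near = cauchy α δ 0<δ
        bounded : ∀ n → K ℕ.≤ n → ∥ i* (seq α n) ∥ ℚ.≤ B
        bounded n K≤n = subst (ℚ._≤ B) (sym (∥i*a∥≡∣a∣ (seq α n))) (α≤B n K≤n)
    in K ℕ.⊔ (L ℕ.⊔ N) , λ m n ≤m ≤n →
      let K≤m = ℕ.m⊔n≤o⇒m≤o K (L ℕ.⊔ N) ≤m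
          K≤n = ℕ.m⊔n≤o⇒m≤o K (L ℕ.⊔ N) ≤n
          LN≤m = ℕ.m⊔n≤o⇒n≤o K (L ℕ.⊔ N) ≤m
          LN≤n = ℕ.m⊔n≤o⇒n≤o K (L ℕ.⊔ N) ≤n
          zₘ = i* (seq α m)
          zₙ = i* (seq α n)
      in begin
      ∥ E zₘ m ⊕ ⊖ E zₙ n ∥
        ≤⟨ ∥⊖∥-triangle (E zₘ m) (E zₘ n) (E zₙ n) ⟩
      ∥ E zₘ m ⊕ ⊖ E zₘ n ∥ ℚ.+ ∥ E zₘ n ⊕ ⊖ E zₙ n ∥
        ≤⟨ ℚ.+-mono-≤ (tail m n (ℕ.m⊔n≤o⇒m≤o L N LN≤m) (ℕ.m⊔n≤o⇒m≤o L N LN≤n) zₘ (bounded m K≤m))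
             (E-lipschitz 0≤B Σ≤M zₙ zₘ (bounded n K≤n) (bounded m K≤m) n) ⟩
      ½ ℚ.* ε ℚ.+ ∥ zₘ ⊕ ⊖ zₙ ∥ ℚ.* M
        ≤⟨ ℚ.+-monoʳ-≤ (½ ℚ.* ε) (*-mono-≤ (ℚ.<⇒≤ 0<M) (ℚ.<⇒≤ 0<δ)
             (ℚ.≤-trans (ℚ.≤-reflexive (∥i*a⊖i*b∥≡∣a-b∣ (seq α m) (seq α n)))
               (near m n (ℕ.m⊔n≤o⇒n≤o L N LN≤m) (ℕ.m⊔n≤o⇒n≤o L N LN≤n))) ℚ.≤-refl) ⟩
      ½ ℚ.* ε ℚ.+ δ ℚ.* M
        ≡⟨ cong (½ ℚ.* ε ℚ.+_) (trans (ℚ.*-comm δ M) Mδ≡½ε) ⟩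
      ½ ℚ.* ε ℚ.+ ½ ℚ.* ε
        ≡⟨ ½*ε+½*ε≡ε ε ⟩
      ε ∎
    where open ℚ.≤-Reasoning

-- The exponential series at iα, evaluated along the diagonal.
cis : ℝ → ℂ
cis α = mkℝ (λ n → proj₁ (E (i* (seq α n)) n)) (λ ε 0<ε → let N , h = cis-cauchy α 0<ε in
          N , λ m n N≤m N≤n → ℚ.≤-trans (∣a∣≤∥z∥ (diff m n)) (h m n N≤m N≤n))
     +i mkℝ (λ n → proj₂ (E (i* (seq α n)) n)) (λ ε 0<ε → let N , h = cis-cauchy α 0<ε in
          N , λ m n N≤m N≤n → ℚ.≤-trans (∣b∣≤∥z∥ (diff m n)) (h m n N≤m N≤n))
  where
  diff : ℕ → ℕ → ℚ[i]
  diff m n = E (i* (seq α m)) m ⊕ ⊖ E (i* (seq α n)) n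

cis-+ : ∀ α β → cis (α +ℝ β) ≈ cis α * cis β
cis-+ α β = ℂᵣ.sym (≈ℂ⇒≈ λ ε 0<ε →
  let B , K , 0<B , α≤B = eventually-bounded α
      C , L , 0<C , β≤C = eventually-bounded β
      N , h = E-⊕ (ℚ.<⇒≤ (ℚ.+-mono-< 0<B 0<C)) 0<ε
  in eventually (K ℕ.⊔ (L ℕ.⊔ N)) λ n ≤n →
    let LN≤n = ℕ.m⊔n≤o⇒n≤o K (L ℕ.⊔ N) ≤n
    in h n (ℕ.m⊔n≤o⇒n≤o L N LN≤n) (i* (seq α n)) (i* (seq β n))
      (ℚ.≤-trans (ℚ.≤-reflexive (∥i*a∥≡∣a∣ (seq α n)))
        (ℚ.≤-trans (α≤B n (ℕ.m⊔n≤o⇒m≤o K (L ℕ.⊔ N) ≤n)) (p≤p+q (ℚ.<⇒≤ 0<C))))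
      (ℚ.≤-trans (ℚ.≤-reflexive (∥i*a∥≡∣a∣ (seq β n)))
        (ℚ.≤-trans (β≤C n (ℕ.m⊔n≤o⇒m≤o L N LN≤n)) (subst (C ℚ.≤_) (ℚ.+-comm C B) (p≤p+q (ℚ.<⇒≤ 0<B))))))

conjᵢ-⊗ : ∀ z w → conjᵢ (z ⊗ w) ≡ conjᵢ z ⊗ conjᵢ w
conjᵢ-⊗ (a , b) (c , d) = cong₂ _,_
  (solve 4 (λ a b c d → a :* c :- b :* d := a :* c :- (:- b) :* (:- d)) refl a b c d)
  (solve 4 (λ a b c d → :- (a :* d :+ b :* c) := a :* (:- d) :+ (:- b) :* c) refl a b c d)
  where open +-*-Solver

E-conj : ∀ z n → E (conjᵢ z) n ≡ conjᵢ (E z n)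
E-conj z zero    = refl
E-conj z (suc n) = trans (cong₂ _⊕_ (E-conj z n) (T-conj n))
  (cong (proj₁ (E z n ⊕ T z n) ,_) (sym (ℚ.neg-distrib-+ (proj₂ (E z n)) (proj₂ (T z n)))))
  where
  T-conj : ∀ k → T (conjᵢ z) k ≡ conjᵢ (T z k)
  T-conj zero    = refl
  T-conj (suc k) = trans (cong (λ x → κ (1/suc k) ⊗ (conjᵢ z ⊗ x)) (T-conj k))
    (sym (trans (conjᵢ-⊗ (κ (1/suc k)) (z ⊗ T z k)) (cong (κ (1/suc k) ⊗_) (conjᵢ-⊗ z (T z k)))))

cis-neg : ∀ α → cis (-ℝ α) ≈ conj (cis α)
cis-neg α = ≈-pointwise λ n → E-conj (i* (seq α n)) n

cis-0 : cis 0ℝ ≈ 1ℂ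
-- Index 0 has to be skipped, because the empty partial sum is 0 and not 1.
cis-0 = ≈ℂ⇒≈ λ ε 0<ε → eventually 1 (near 0<ε)
  where
  E-0 : ∀ n → E (i* 0ℚ) (suc n) ≡ 1ᵢ
  E-0 zero    = refl
  E-0 (suc n) = trans (cong₂ _⊕_ (E-0 n) (solve 2 (λ k x → k :* (con 0ᵢ :* x) := con 0ᵢ) refl (κ (1/suc n)) (T (i* 0ℚ) n))) refl
    where open C-Solver
  near : ∀ {ε} → 0ℚ ℚ.< ε → ∀ n → 1 ℕ.≤ n → ∥ at n (cis 0ℝ) ⊕ ⊖ 1ᵢ ∥ ℚ.≤ ε
  near {ε} 0<ε (suc n) _ = subst (λ z → ∥ z ⊕ ⊖ 1ᵢ ∥ ℚ.≤ ε) (sym (E-0 n)) (ℚ.<⇒≤ 0<ε)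

cis-unit : ∀ α → conj (cis α) * cis α ≈ 1ℂ
cis-unit α = ℂᵣ.trans (ℂᵣ.*-congʳ (ℂᵣ.sym (cis-neg α))) (ℂᵣ.trans (ℂᵣ.sym (cis-+ (-ℝ α) α))
  (ℂᵣ.trans (≈-pointwise λ n → cong (λ a → E (i* a) n) (ℚ.+-inverseˡ (seq α n))) cis-0))

-- One rotation towards 1

¼ 5/4 3/2 9/8 : ℚ
¼   = + 1 ℚ./ 4
5/4 = + 5 ℚ./ 4
3/2 = + 3 ℚ./ 2
9/8 = + 9 ℚ./ 8

p≤∣p∣ : ∀ p → p ℚ.≤ ∣ p ∣
p≤∣p∣ p with ℚ.≤-total 0ℚ p
... | inj₁ 0≤p = ℚ.≤-reflexive (sym (ℚ.0≤p⇒∣p∣≡p 0≤p))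
... | inj₂ p≤0 = ℚ.≤-trans p≤0 (ℚ.0≤∣p∣ p)

0≤p*p : ∀ p → 0ℚ ℚ.≤ p ℚ.* p
0≤p*p p with ℚ.≤-total 0ℚ p
... | inj₁ 0≤p = 0≤p*q 0≤p 0≤p
... | inj₂ p≤0 = subst (0ℚ ℚ.≤_) (solve 1 (λ p → (:- p) :* (:- p) := p :* p) refl p) (0≤p*q 0≤-p 0≤-p)
  where open +-*-Solver
        0≤-p = ℚ.neg-antimono-≤ p≤0

∣p∣*∣p∣≡p*p : ∀ p → ∣ p ∣ ℚ.* ∣ p ∣ ≡ p ℚ.* p
∣p∣*∣p∣≡p*p p = trans (sym (ℚ.∣p*q∣≡∣p∣*∣q∣ p p)) (ℚ.0≤p⇒∣p∣≡p (0≤p*p p))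

-- From (|x| + |y|)² ≤ 2(x² + y²) and 2 · 9/8 = (3/2)². Arguing by contradiction replaces the square
-- root.
∥z∥≤3/2 : ∀ x y → x ℚ.* x ℚ.+ y ℚ.* y ℚ.≤ 9/8 → ∥ x , y ∥ ℚ.≤ 3/2
∥z∥≤3/2 x y x²+y²≤9/8 = ℚ.≮⇒≥ λ 3/2<s → ℚ.<-irrefl refl (begin-strict
  3/2 ℚ.* 3/2                     <⟨ ℚ.*-monoˡ-<-pos 3/2 3/2<s ⟩
  s ℚ.* 3/2                       ≤⟨ ℚ.*-monoˡ-≤-nonNeg s {{ℚ.nonNegative (0≤∥z∥ (x , y))}} (ℚ.<⇒≤ 3/2<s) ⟩
  s ℚ.* s                         ≤⟨ p≤p+q (0≤p*p (∣ x ∣ ℚ.- ∣ y ∣)) ⟩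
  s ℚ.* s ℚ.+ (∣ x ∣ ℚ.- ∣ y ∣) ℚ.* (∣ x ∣ ℚ.- ∣ y ∣)
    ≡⟨ solve 2 (λ a b → (a :+ b) :* (a :+ b) :+ (a :- b) :* (a :- b)
         := (a :* a :+ b :* b) :+ (a :* a :+ b :* b)) refl (∣ x ∣) (∣ y ∣) ⟩
  (∣ x ∣ ℚ.* ∣ x ∣ ℚ.+ ∣ y ∣ ℚ.* ∣ y ∣) ℚ.+ (∣ x ∣ ℚ.* ∣ x ∣ ℚ.+ ∣ y ∣ ℚ.* ∣ y ∣)
    ≡⟨ cong (λ p → p ℚ.+ p) (cong₂ ℚ._+_ (∣p∣*∣p∣≡p*p x) (∣p∣*∣p∣≡p*p y)) ⟩
  (x ℚ.* x ℚ.+ y ℚ.* y) ℚ.+ (x ℚ.* x ℚ.+ y ℚ.* y)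
    ≤⟨ ℚ.+-mono-≤ x²+y²≤9/8 x²+y²≤9/8 ⟩
  3/2 ℚ.* 3/2 ∎)
  where open ℚ.≤-Reasoning
        open +-*-Solver
        s = ∣ x ∣ ℚ.+ ∣ y ∣

-- The remainder starts with |d|³/6, and its ratios are at most |d|/4 ≤ 1/3. A geometric series with
-- ratio 1/3 contributes the factor 3/2, and 3/2 · 1/6 = ¼.
E-quadratic : ∀ d → ∣ d ∣ ℚ.≤ 5/4 → ∀ n →
              ∥ E (i* d) (3 ℕ.+ n) ⊕ ⊖ (1ℚ ℚ.- ½ ℚ.* (d ℚ.* d) , d) ∥ ℚ.≤ ¼ ℚ.* (∣ d ∣ ℚ.* (∣ d ∣ ℚ.* ∣ d ∣))
E-quadratic d d≤5/4 n = begin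
  ∥ E z (3 ℕ.+ n) ⊕ ⊖ u ∥
    ≡⟨ cong ∥_∥ (trans (cong (_⊕ ⊖ u) (trans (Σ<-shift (T z) 3 n) (cong (_⊕ Σ< (shift 3 (T z)) n) E₃≡u)))
         (S.solve 2 (λ u s → (u S.:+ s) S.:- u S.:= s) refl u (Σ< (shift 3 (T z)) n))) ⟩
  ∥ Σ< (shift 3 (T z)) n ∥
    ≤⟨ ∥Σ<∥≤Σℚ< (λ k → ∥T∥≤t z (ℚ.≤-reflexive (∥i*a∥≡∣a∣ d)) (3 ℕ.+ k)) n ⟩
  S
    ≡⟨ solve 1 (λ s → s := con 3/2 :* (con (1ℚ ℚ.- ⅓) :* s)) refl S ⟩
  3/2 ℚ.* ((1ℚ ℚ.- ⅓) ℚ.* S)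
    ≤⟨ ℚ.*-monoˡ-≤-nonNeg 3/2 ⅔S≤t ⟩
  3/2 ℚ.* t x 3
    ≡⟨ solve 1 (λ x → con 3/2 :* (con (1/suc 2) :* (x :* (con (1/suc 1) :* (x :* (con (1/suc 0) :* (x :* con 1ℚ))))))
         := con ¼ :* (x :* (x :* x))) refl x ⟩
  ¼ ℚ.* (x ℚ.* (x ℚ.* x)) ∎
  where
  open ℚ.≤-Reasoning
  open +-*-Solver
  module S = C-Solver
  ⅓ = + 1 ℚ./ 3
  z = i* d
  u = 1ℚ ℚ.- ½ ℚ.* (d ℚ.* d) , d
  x = ∣ d ∣
  0≤x = ℚ.0≤∣p∣ d
  S = Σℚ< (shift 3 (t x)) n
  ratio : ∀ k → shift 3 (t x) (suc k) ℚ.≤ ⅓ ℚ.* shift 3 (t x) k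
  ratio k = t-ratio {q = ⅓} (3 ℕ.+ k) 0≤x (ℚ.≤-trans d≤5/4 (ℚ.≤-trans (from-yes (5/4 ℚ.≤? ⅓ ℚ.* fromℕ 4))
    (ℚ.*-monoˡ-≤-nonNeg ⅓ (fromℕ-mono-≤ (ℕ.m≤m+n 4 k)))))
  ⅔S≤t : (1ℚ ℚ.- ⅓) ℚ.* S ℚ.≤ t x 3
  ⅔S≤t = ℚ.≤-trans (p≤p+q (0≤t 0≤x (3 ℕ.+ n))) (geometric {shift 3 (t x)} {⅓} ratio n)
  E₃≡u : E z 3 ≡ u
  E₃≡u = trans (S.solve 1 (λ z → ((S.con 0ᵢ S.:+ S.con 1ᵢ) S.:+ S.con (κ (1/suc 0)) S.:* (z S.:* S.con 1ᵢ))
      S.:+ S.con (κ (1/suc 1)) S.:* (z S.:* (S.con (κ (1/suc 0)) S.:* (z S.:* S.con 1ᵢ)))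
      S.:= (S.con 1ᵢ S.:+ z) S.:+ S.con (κ ½) S.:* (z S.:* z)) refl z)
    (cong₂ _,_
      (solve 1 (λ d → (con 1ℚ :+ con 0ℚ) :+ (con ½ :* (con 0ℚ :* con 0ℚ :- d :* d) :- con 0ℚ :* (con 0ℚ :* d :+ d :* con 0ℚ))
        := con 1ℚ :- con ½ :* (d :* d)) refl d)
      (solve 1 (λ d → (con 0ℚ :+ d) :+ (con ½ :* (con 0ℚ :* d :+ d :* con 0ℚ) :+ con 0ℚ :* (con 0ℚ :* con 0ℚ :- d :* d))
        := d) refl d))

∣p*q∣≤ : ∀ {p q a b} → ∣ p ∣ ℚ.≤ a → ∣ q ∣ ℚ.≤ b → ∣ p ℚ.* q ∣ ℚ.≤ a ℚ.* b
∣p*q∣≤ {p} p≤a q≤b = *-mono-≤-∣∣ {p} p≤a q≤b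

∣p+q∣≤ : ∀ p q {a b} → ∣ p ∣ ℚ.≤ a → ∣ q ∣ ℚ.≤ b → ∣ p ℚ.+ q ∣ ℚ.≤ a ℚ.+ b
∣p+q∣≤ p q p≤a q≤b = ℚ.≤-trans (ℚ.∣p+q∣≤∣p∣+∣q∣ p q) (ℚ.+-mono-≤ p≤a q≤b)

-- If z = x + iy has modulus 1 then z(1 - iy - y²/2) - 1 = ((1 - x)²/2) z, so
-- one rotation by -y reduces the distance to 1.  Here the modulus is 1 only
-- up to η, and the angle d is -y only up to η.
rotation-contracts : ∀ x y d ρ {r η} → r ℚ.≤ 5/4 → (+ 480 ℚ./ 1) ℚ.* η ≡ r → 0ℚ ℚ.≤ η →
  ∣ x ℚ.* x ℚ.+ y ℚ.* y ℚ.- 1ℚ ∣ ℚ.≤ η → ∣ d ℚ.+ y ∣ ℚ.≤ η → ∣ d ∣ ℚ.≤ r →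
  ∥ (x , y) ⊕ ⊖ 1ᵢ ∥ ℚ.≤ r → ∥ ρ ∥ ℚ.≤ ¼ ℚ.* (∣ d ∣ ℚ.* (∣ d ∣ ℚ.* ∣ d ∣)) →
  ∥ (x , y) ⊗ ((1ℚ ℚ.- ½ ℚ.* (d ℚ.* d) , d) ⊕ ρ) ⊕ ⊖ 1ᵢ ∥ ℚ.≤ (+ 19 ℚ./ 20) ℚ.* r
rotation-contracts x y d ρ@(ρ₁ , ρ₂) {r} {η} r≤5/4 480η≡r 0≤η e≤η τ≤η d≤r near ρ≤ = begin
  ∥ z ⊗ (u ⊕ ρ) ⊕ ⊖ 1ᵢ ∥
    ≡⟨ cong ∥_∥ decomposition ⟩
  ∥ ((κ c ⊗ z ⊕ e₁) ⊕ z ⊗ e₂) ⊕ z ⊗ ρ ∥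
    ≤⟨ ∥⊕∥-mono ((κ c ⊗ z ⊕ e₁) ⊕ z ⊗ e₂) (z ⊗ ρ)
         (∥⊕∥-mono (κ c ⊗ z ⊕ e₁) (z ⊗ e₂) (∥⊕∥-mono (κ c ⊗ z) e₁ cz≤ e₁≤) (∥⊗∥-mono z e₂ z≤3/2 e₂≤))
         (∥⊗∥-mono z ρ z≤3/2 ρ≤′) ⟩
  (((½ ℚ.* (X ℚ.* 5/4)) ℚ.* 3/2 ℚ.+ (η ℚ.* 9/8)) ℚ.+ 3/2 ℚ.* (½ ℚ.* (η ℚ.* (5/4 ℚ.+ 5/4)) ℚ.+ η))
    ℚ.+ 3/2 ℚ.* (¼ ℚ.* ((η ℚ.+ Y) ℚ.* (5/4 ℚ.* 5/4)))
    -- Padding to round coefficients: X already has ½ · 5/4 · 3/2 = 15/16, Y is raised from 75/128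
    -- to 15/16, and η to 6 = 480/80. Then 15/16 + 1/80 = 19/20.
    ≤⟨ p≤p+q (0≤p*q (from-yes (0ℚ ℚ.≤? ½)) (0≤p+q (0≤p*q (from-yes (0ℚ ℚ.≤? (+ 90 ℚ./ 128))) (ℚ.0≤∣p∣ y))
         (0≤p*q (from-yes (0ℚ ℚ.≤? (+ 234 ℚ./ 128))) 0≤η))) ⟩
  ((((½ ℚ.* (X ℚ.* 5/4)) ℚ.* 3/2 ℚ.+ (η ℚ.* 9/8)) ℚ.+ 3/2 ℚ.* (½ ℚ.* (η ℚ.* (5/4 ℚ.+ 5/4)) ℚ.+ η))
    ℚ.+ 3/2 ℚ.* (¼ ℚ.* ((η ℚ.+ Y) ℚ.* (5/4 ℚ.* 5/4))))
    ℚ.+ ½ ℚ.* ((+ 90 ℚ./ 128) ℚ.* Y ℚ.+ (+ 234 ℚ./ 128) ℚ.* η)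
    ≡⟨ solve 3 (λ X Y η →
         (((con ½ :* (X :* con 5/4)) :* con 3/2 :+ (η :* con 9/8)) :+ con 3/2 :* (con ½ :* (η :* (con 5/4 :+ con 5/4)) :+ η)
           :+ con 3/2 :* (con ¼ :* ((η :+ Y) :* (con 5/4 :* con 5/4))))
           :+ con ½ :* (con (+ 90 ℚ./ 128) :* Y :+ con (+ 234 ℚ./ 128) :* η)
         := con (+ 15 ℚ./ 16) :* (X :+ Y) :+ con (+ 1 ℚ./ 80) :* (con (+ 480 ℚ./ 1) :* η)) refl X Y η ⟩
  (+ 15 ℚ./ 16) ℚ.* (X ℚ.+ Y) ℚ.+ (+ 1 ℚ./ 80) ℚ.* ((+ 480 ℚ./ 1) ℚ.* η)
    ≤⟨ ℚ.+-mono-≤ (ℚ.*-monoˡ-≤-nonNeg (+ 15 ℚ./ 16) X+Y≤r) (ℚ.≤-reflexive (cong ((+ 1 ℚ./ 80) ℚ.*_) 480η≡r)) ⟩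
  (+ 15 ℚ./ 16) ℚ.* r ℚ.+ (+ 1 ℚ./ 80) ℚ.* r
    ≡⟨ ℚ.*-distribʳ-+ r (+ 15 ℚ./ 16) (+ 1 ℚ./ 80) ⟨
  (+ 19 ℚ./ 20) ℚ.* r ∎
  where
  open ℚ.≤-Reasoning
  open +-*-Solver
  z = x , y
  u = 1ℚ ℚ.- ½ ℚ.* (d ℚ.* d) , d
  X = ∣ 1ℚ ℚ.- x ∣
  Y = ∣ y ∣
  e = x ℚ.* x ℚ.+ y ℚ.* y ℚ.- 1ℚ
  τ = d ℚ.+ y
  c = ½ ℚ.* ((1ℚ ℚ.- x) ℚ.* (1ℚ ℚ.- x))
  e₁ = e ℚ.* (½ ℚ.+ ½ ℚ.* (1ℚ ℚ.- x)) , ℚ.- (½ ℚ.* (e ℚ.* y))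
  e₂ = ℚ.- (½ ℚ.* (τ ℚ.* (d ℚ.- y))) , τ

  0≤p+q : ∀ {p q} → 0ℚ ℚ.≤ p → 0ℚ ℚ.≤ q → 0ℚ ℚ.≤ p ℚ.+ q
  0≤p+q = ℚ.+-mono-≤

  -- The first term is the exact value on the circle for the angle -y. The term `e₁` corrects for
  -- the modulus, `e₂` for the use of `d` instead of -y, and `ρ` is the remainder of the series.
  decomposition : z ⊗ (u ⊕ ρ) ⊕ ⊖ 1ᵢ ≡ ((κ c ⊗ z ⊕ e₁) ⊕ z ⊗ e₂) ⊕ z ⊗ ρ
  decomposition = cong₂ _,_
    (solve 5 (λ x y d p q →
      let u = con 1ℚ :- con ½ :* (d :* d)
          e = x :* x :+ y :* y :- con 1ℚ
          τ = d :+ y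
          c = con ½ :* ((con 1ℚ :- x) :* (con 1ℚ :- x))
          b = :- (con ½ :* (τ :* (d :- y)))
      in (x :* (u :+ p) :- y :* (d :+ q)) :+ (:- con 1ℚ)
         := (((c :* x :- con 0ℚ :* y) :+ e :* (con ½ :+ con ½ :* (con 1ℚ :- x))) :+ (x :* b :- y :* τ)) :+ (x :* p :- y :* q))
      refl x y d ρ₁ ρ₂)
    (solve 5 (λ x y d p q →
      let u = con 1ℚ :- con ½ :* (d :* d)
          e = x :* x :+ y :* y :- con 1ℚ
          τ = d :+ y
          c = con ½ :* ((con 1ℚ :- x) :* (con 1ℚ :- x))
          b = :- (con ½ :* (τ :* (d :- y)))
      in (x :* (d :+ q) :+ y :* (u :+ p)) :+ (:- con 0ℚ)
         := (((c :* y :+ con 0ℚ :* x) :+ (:- (con ½ :* (e :* y)))) :+ (x :* τ :+ y :* b)) :+ (x :* q :+ y :* p))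
      refl x y d ρ₁ ρ₂)

  X+Y≤r : X ℚ.+ Y ℚ.≤ r
  X+Y≤r = ℚ.≤-trans (ℚ.≤-reflexive (cong₂ ℚ._+_ (∣p-q∣≡∣q-p∣ 1ℚ x) (cong ∣_∣ (sym (ℚ.+-identityʳ y))))) near
  X≤5/4 = ℚ.≤-trans (p≤p+q (ℚ.0≤∣p∣ y)) (ℚ.≤-trans X+Y≤r r≤5/4)
  Y≤5/4 = ℚ.≤-trans (subst (Y ℚ.≤_) (ℚ.+-comm Y X) (p≤p+q (ℚ.0≤∣p∣ (1ℚ ℚ.- x)))) (ℚ.≤-trans X+Y≤r r≤5/4)
  d≤5/4 = ℚ.≤-trans d≤r r≤5/4

  z≤3/2 : ∥ z ∥ ℚ.≤ 3/2
  z≤3/2 = ∥z∥≤3/2 x y (begin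
    x ℚ.* x ℚ.+ y ℚ.* y     ≡⟨ solve 2 (λ x y → x :* x :+ y :* y := (x :* x :+ y :* y :- con 1ℚ) :+ con 1ℚ) refl x y ⟩
    e ℚ.+ 1ℚ                ≤⟨ ℚ.+-monoˡ-≤ 1ℚ (p≤∣p∣ e) ⟩
    ∣ e ∣ ℚ.+ 1ℚ            ≤⟨ ℚ.+-monoˡ-≤ 1ℚ e≤η ⟩
    η ℚ.+ 1ℚ                ≡⟨ cong (ℚ._+ 1ℚ) (solve 1 (λ η → η := con (+ 1 ℚ./ 480) :* (con (+ 480 ℚ./ 1) :* η)) refl η) ⟩
    (+ 1 ℚ./ 480) ℚ.* ((+ 480 ℚ./ 1) ℚ.* η) ℚ.+ 1ℚ
                            ≤⟨ ℚ.+-monoˡ-≤ 1ℚ (ℚ.*-monoˡ-≤-nonNeg (+ 1 ℚ./ 480) (ℚ.≤-trans (ℚ.≤-reflexive 480η≡r) r≤5/4)) ⟩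
    (+ 1 ℚ./ 480) ℚ.* 5/4 ℚ.+ 1ℚ
                            ≤⟨ from-yes ((+ 1 ℚ./ 480) ℚ.* 5/4 ℚ.+ 1ℚ ℚ.≤? 9/8) ⟩
    9/8                     ∎)

  cz≤ : ∥ κ c ⊗ z ∥ ℚ.≤ (½ ℚ.* (X ℚ.* 5/4)) ℚ.* 3/2
  cz≤ = ∥⊗∥-mono (κ c) z (ℚ.≤-trans (ℚ.≤-reflexive (ℚ.+-identityʳ (∣ c ∣)))
    (∣p*q∣≤ {½} ℚ.≤-refl (∣p*q∣≤ {1ℚ ℚ.- x} ℚ.≤-refl X≤5/4))) z≤3/2

  e₁≤ : ∥ e₁ ∥ ℚ.≤ η ℚ.* 9/8
  e₁≤ = begin
    ∥ e₁ ∥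
      ≤⟨ ℚ.+-mono-≤ (∣p*q∣≤ {e} e≤η (∣p+q∣≤ ½ (½ ℚ.* (1ℚ ℚ.- x)) {½} ℚ.≤-refl (∣p*q∣≤ {½} {1ℚ ℚ.- x} ℚ.≤-refl ℚ.≤-refl)))
           (ℚ.≤-trans (ℚ.≤-reflexive (ℚ.∣-p∣≡∣p∣ (½ ℚ.* (e ℚ.* y)))) (∣p*q∣≤ {½} ℚ.≤-refl (∣p*q∣≤ {e} {y} e≤η ℚ.≤-refl))) ⟩
    η ℚ.* (½ ℚ.+ ½ ℚ.* X) ℚ.+ ½ ℚ.* (η ℚ.* Y)
      ≡⟨ solve 3 (λ η X Y → η :* (con ½ :+ con ½ :* X) :+ con ½ :* (η :* Y) := η :* (con ½ :+ con ½ :* (X :+ Y))) refl η X Y ⟩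
    η ℚ.* (½ ℚ.+ ½ ℚ.* (X ℚ.+ Y))
      ≤⟨ ℚ.*-monoˡ-≤-nonNeg η {{ℚ.nonNegative 0≤η}} (ℚ.+-monoʳ-≤ ½ (ℚ.*-monoˡ-≤-nonNeg ½ (ℚ.≤-trans X+Y≤r r≤5/4))) ⟩
    η ℚ.* 9/8 ∎

  e₂≤ : ∥ e₂ ∥ ℚ.≤ ½ ℚ.* (η ℚ.* (5/4 ℚ.+ 5/4)) ℚ.+ η
  e₂≤ = ℚ.+-mono-≤ (ℚ.≤-trans (ℚ.≤-reflexive (ℚ.∣-p∣≡∣p∣ (½ ℚ.* (τ ℚ.* (d ℚ.- y)))))
    (∣p*q∣≤ {½} ℚ.≤-refl (∣p*q∣≤ {τ} τ≤η (∣p+q∣≤ d (ℚ.- y) d≤5/4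
      (ℚ.≤-trans (ℚ.≤-reflexive (ℚ.∣-p∣≡∣p∣ y)) Y≤5/4))))) τ≤η

  ρ≤′ : ∥ ρ ∥ ℚ.≤ ¼ ℚ.* ((η ℚ.+ Y) ℚ.* (5/4 ℚ.* 5/4))
  ρ≤′ = ℚ.≤-trans ρ≤ (ℚ.*-monoˡ-≤-nonNeg ¼ (*-mono-≤ (0≤p*q 0≤d 0≤d) (0≤p+q 0≤η (ℚ.0≤∣p∣ y)) d≤η+Y
    (*-mono-≤ 0≤d (from-yes (0ℚ ℚ.≤? 5/4)) d≤5/4 d≤5/4)))
    where
    0≤d = ℚ.0≤∣p∣ d
    d≤η+Y : ∣ d ∣ ℚ.≤ η ℚ.+ Y
    d≤η+Y = ℚ.≤-trans (ℚ.≤-reflexive (cong ∣_∣ (solve 2 (λ d y → d := (d :+ y) :+ (:- y)) refl d y)))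
      (∣p+q∣≤ (d ℚ.+ y) (ℚ.- y) τ≤η (ℚ.≤-reflexive (ℚ.∣-p∣≡∣p∣ y)))

OnCircle : ℂ → Set
OnCircle z = conj z * z ≈ 1ℂ

OnCircle-* : ∀ {u v} → OnCircle u → OnCircle v → OnCircle (u * v)
OnCircle-* {u} {v} u-unit v-unit = ℂᵣ.trans (ℂᵣ.*-congʳ (conj-* u v)) (ℂᵣ.trans
  (CommutativeSemigroupProperties.interchange ℂᵣ.*-commutativeSemigroup (conj u) (conj v) u v)
  (ℂᵣ.trans (ℂᵣ.*-cong u-unit v-unit) (ℂᵣ.*-identityʳ 1ℂ)))

OnCircle⇒∣z∣² : ∀ {z} → OnCircle z → ∀ {ε} → 0ℚ ℚ.< ε → ∃ λ N → ∀ n → N ℕ.≤ n →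
  ∣ seq (re z) n ℚ.* seq (re z) n ℚ.+ seq (im z) n ℚ.* seq (im z) n ℚ.- 1ℚ ∣ ℚ.≤ ε
OnCircle⇒∣z∣² {z} (z-unit ,≈ _) 0<ε = let N , h = close z-unit _ 0<ε in N , λ n N≤n →
  subst (λ p → ∣ p ℚ.- 1ℚ ∣ ℚ.≤ _) (solve 2 (λ x y → x :* x :- (:- y) :* y := x :* x :+ y :* y) refl
    (seq (re z) n) (seq (im z) n)) (h n N≤n)
  where open +-*-Solver

-- The angle is minus a single term of the sequence `im z`, taken late enough to lie within η of all
-- later ones. Being rational, it can be added to a rational approximation of the final angle.
rotate-towards-1 : ∀ z r → 0ℚ ℚ.< r → r ℚ.≤ 5/4 → OnCircle z → z ≈ℂ[ r ] 1ℂ →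
                   ∃ λ d → ∣ d ∣ ℚ.≤ r × z * cis (fromℚ d) ≈ℂ[ (+ 19 ℚ./ 20) ℚ.* r ] 1ℂ
rotate-towards-1 z r 0<r r≤5/4 z-unit (eventually N₂ near) =
  let η , 0<η , 480η≡r = ∃-divide {r} {+ 480 ℚ./ 1} 0<r (ℚ.positive⁻¹ (+ 480 ℚ./ 1))
      N₁ , unit = OnCircle⇒∣z∣² z-unit 0<η
      N₃ , steady = cauchy (im z) η 0<η
      N = N₁ ℕ.⊔ (N₂ ℕ.⊔ N₃)
      N₁≤ : ∀ {n} → N ℕ.≤ n → N₁ ℕ.≤ n
      N₁≤ = ℕ.m⊔n≤o⇒m≤o N₁ (N₂ ℕ.⊔ N₃)
      N₂≤ : ∀ {n} → N ℕ.≤ n → N₂ ℕ.≤ n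
      N₂≤ ≤n = ℕ.m⊔n≤o⇒m≤o N₂ N₃ (ℕ.m⊔n≤o⇒n≤o N₁ (N₂ ℕ.⊔ N₃) ≤n)
      N₃≤ : ∀ {n} → N ℕ.≤ n → N₃ ℕ.≤ n
      N₃≤ ≤n = ℕ.m⊔n≤o⇒n≤o N₂ N₃ (ℕ.m⊔n≤o⇒n≤o N₁ (N₂ ℕ.⊔ N₃) ≤n)
      d = ℚ.- seq (im z) N
      d≤r : ∣ d ∣ ℚ.≤ r
      d≤r = ℚ.≤-trans (ℚ.≤-reflexive (trans (ℚ.∣-p∣≡∣p∣ (seq (im z) N)) (cong ∣_∣ (sym (ℚ.+-identityʳ (seq (im z) N))))))
        (ℚ.≤-trans (∣b∣≤∥z∥ (at N z ⊕ ⊖ 1ᵢ)) (near N (N₂≤ ℕ.≤-refl)))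
      u = 1ℚ ℚ.- ½ ℚ.* (d ℚ.* d) , d
      bound : ∀ n → N ℕ.≤ 3 ℕ.+ n → ∥ at (3 ℕ.+ n) (z * cis (fromℚ d)) ⊕ ⊖ 1ᵢ ∥ ℚ.≤ (+ 19 ℚ./ 20) ℚ.* r
      bound n ≤n = subst (λ w → ∥ at (3 ℕ.+ n) z ⊗ w ⊕ ⊖ 1ᵢ ∥ ℚ.≤ (+ 19 ℚ./ 20) ℚ.* r)
        (C-Solver.solve 2 (λ u e → u C-Solver.:+ (e C-Solver.:- u) C-Solver.:= e) refl u (E (i* d) (3 ℕ.+ n)))
        (rotation-contracts (seq (re z) (3 ℕ.+ n)) (seq (im z) (3 ℕ.+ n)) d (E (i* d) (3 ℕ.+ n) ⊕ ⊖ u)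
          r≤5/4 480η≡r (ℚ.<⇒≤ 0<η) (unit (3 ℕ.+ n) (N₁≤ ≤n))
          (subst (λ p → ∣ p ∣ ℚ.≤ η) (ℚ.+-comm (seq (im z) (3 ℕ.+ n)) d) (steady (3 ℕ.+ n) N (N₃≤ ≤n) (N₃≤ ℕ.≤-refl)))
          d≤r (near (3 ℕ.+ n) (N₂≤ ≤n)) (E-quadratic d (ℚ.≤-trans d≤r r≤5/4) n))
  -- The quadratic approximation of the series is available from three terms on, whence the shift of
  -- the index by 3.
  in d , d≤r , eventually (3 ℕ.+ N) λ n 3+N≤n →
       subst (λ m → ∥ at m (z * cis (fromℚ d)) ⊕ ⊖ 1ᵢ ∥ ℚ.≤ (+ 19 ℚ./ 20) ℚ.* r) (ℕ.m+[n∸m]≡n (ℕ.m+n≤o⇒m≤o 3 3+N≤n))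
         (bound (n ℕ.∸ 3) (ℕ.≤-trans (ℕ.m≤n+m N 3) (subst (3 ℕ.+ N ℕ.≤_) (sym (ℕ.m+[n∸m]≡n (ℕ.m+n≤o⇒m≤o 3 3+N≤n))) 3+N≤n)))

IsCis : ℂ → Set
IsCis w = ∃ λ α → cis α ≈ w

IsCis-* : ∀ {u v} → IsCis u → IsCis v → IsCis (u * v)
IsCis-* (α , p) (β , q) = α +ℝ β , ℂᵣ.trans (cis-+ α β) (ℂᵣ.*-cong p q)

IsCis-cong : ∀ {u v} → u ≈ v → IsCis u → IsCis v
IsCis-cong u≈v (α , p) = α , ℂᵣ.trans p u≈v

-- Iterating the rotation

module Iteration (w : ℂ) (w-unit : OnCircle w) (w-near : w ≈ℂ[ + 6 ℚ./ 5 ] 1ℂ) where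

  39/40 1/40 : ℚ
  39/40 = + 39 ℚ./ 40
  1/40  = + 1 ℚ./ 40

  radius : ℕ → ℚ
  radius k = 5/4 ℚ.* pow 39/40 k

  0<pow : ∀ k → 0ℚ ℚ.< pow 39/40 k
  0<pow zero    = ℚ.positive⁻¹ 1ℚ
  0<pow (suc k) = 0<p*q (ℚ.positive⁻¹ 39/40) (0<pow k)

  pow≤1 : ∀ k → pow 39/40 k ℚ.≤ 1ℚ
  pow≤1 zero    = ℚ.≤-refl
  pow≤1 (suc k) = ℚ.≤-trans (ℚ.*-monoˡ-≤-nonNeg 39/40 (pow≤1 k)) (from-yes (39/40 ℚ.* 1ℚ ℚ.≤? 1ℚ))

  0<radius : ∀ k → 0ℚ ℚ.< radius k
  0<radius k = 0<p*q (ℚ.positive⁻¹ 5/4) (0<pow k)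

  radius-suc : ∀ k → radius (suc k) ≡ 39/40 ℚ.* radius k
  radius-suc k = solve 1 (λ p → con 5/4 :* (con 39/40 :* p) := con 39/40 :* (con 5/4 :* p)) refl (pow 39/40 k)
    where open +-*-Solver

  Near : ℕ → ℚ → Set
  Near k b = w * cis (fromℚ b) ≈ℂ[ radius k ] 1ℂ

  abstract
    -- A rotation contracts by 19/20, but regrouping the two rotations into one by `b + d` is an
    -- equality of limits and costs some positive error. Allowing 1/40 of the radius for it makes
    -- the ratio 39/40.
    next : ∀ k b → Near k b → ∃ λ d → ∣ d ∣ ℚ.≤ radius k × Near (suc k) (b ℚ.+ d)
    next k b near =
      let d , d≤r , near′ = rotate-towards-1 (w * cis (fromℚ b)) (radius k) (0<radius k)
            (ℚ.≤-trans (ℚ.*-monoˡ-≤-nonNeg 5/4 (pow≤1 k)) (ℚ.≤-reflexive (ℚ.*-identityʳ 5/4)))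
            (OnCircle-* {w} {cis (fromℚ b)} w-unit (cis-unit (fromℚ b))) near
          split : w * cis (fromℚ (b ℚ.+ d)) ≈ (w * cis (fromℚ b)) * cis (fromℚ d)
          split = ℂᵣ.trans (ℂᵣ.*-congˡ {w} {cis (fromℚ (b ℚ.+ d))} {cis (fromℚ b) * cis (fromℚ d)} (ℂᵣ.trans {cis (fromℚ (b ℚ.+ d))} {cis (fromℚ b +ℝ fromℚ d)} {cis (fromℚ b) * cis (fromℚ d)} (≈-pointwise {cis (fromℚ (b ℚ.+ d))} {cis (fromℚ b +ℝ fromℚ d)} λ _ → refl) (cis-+ (fromℚ b) (fromℚ d))))
            (ℂᵣ.sym (ℂᵣ.*-assoc w (cis (fromℚ b)) (cis (fromℚ d))))
      in d , d≤r , ≈ℂ-weaken (ℚ.≤-reflexive (trans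
           (solve 1 (λ r → con 1/40 :* r :+ con (+ 19 ℚ./ 20) :* r := con 39/40 :* r) refl (radius k)) (sym (radius-suc k))))
         (≈ℂ-trans {v = (w * cis (fromℚ b)) * cis (fromℚ d)} (≈⇒≈ℂ {w * cis (fromℚ (b ℚ.+ d))} {(w * cis (fromℚ b)) * cis (fromℚ d)} split (0<p*q (ℚ.positive⁻¹ 1/40) (0<radius k))) near′)
      where open +-*-Solver

  near-0 : Near 0 0ℚ
  -- The initial radius 5/4 exceeds 6/5 by the 1/20 spent on replacing `w * cis 0` by `w`.
  near-0 = ≈ℂ-weaken (from-yes ((+ 1 ℚ./ 20) ℚ.+ (+ 6 ℚ./ 5) ℚ.≤? radius 0))
    (≈ℂ-trans {w * cis (fromℚ 0ℚ)} {w} {1ℂ} (≈⇒≈ℂ {w * cis (fromℚ 0ℚ)} {w} w*cis0≈w (ℚ.positive⁻¹ (+ 1 ℚ./ 20))) w-near)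
    where
    w*cis0≈w : w * cis (fromℚ 0ℚ) ≈ w
    w*cis0≈w = ℂᵣ.trans {w * cis (fromℚ 0ℚ)} {w * 1ℂ} {w} (ℂᵣ.*-congˡ {w} {cis (fromℚ 0ℚ)} {1ℂ} cis-0) (ℂᵣ.*-identityʳ w)

  improve : ∀ k → ∃ (Near k) → ∃ (Near (suc k))
  improve k (b , near) = let d , _ , near′ = next k b near in b ℚ.+ d , near′

  approximation : ∀ k → ∃ (Near k)
  approximation zero    = 0ℚ , near-0
  approximation (suc k) = improve k (approximation k)

  b : ℕ → ℚ
  b k = proj₁ (approximation k)

  b-step : ∀ k → ∣ b (suc k) ℚ.- b k ∣ ℚ.≤ radius k
  b-step k = let d , d≤r , _ = next k (proj₁ (approximation k)) (proj₂ (approximation k)) in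
    subst (λ p → ∣ p ∣ ℚ.≤ radius k) (sym (cancel (proj₁ (approximation k)) d)) d≤r
    where
    open +-*-Solver
    cancel : ∀ x d → (x ℚ.+ d) ℚ.- x ≡ d
    cancel = solve 2 (λ x d → (x :+ d) :- x := d) refl

  b-drift : ∀ m n → ∣ b (m ℕ.+ n) ℚ.- b m ∣ ℚ.≤ Σℚ< (shift m radius) n
  b-drift m zero    = ℚ.≤-reflexive (cong ∣_∣ (trans (cong (λ k → b k ℚ.- b m) (ℕ.+-identityʳ m)) (ℚ.+-inverseʳ (b m))))
  b-drift m (suc n) = subst (λ k → ∣ b k ℚ.- b m ∣ ℚ.≤ Σℚ< (shift m radius) (suc n)) (sym (ℕ.+-suc m n))
    (telescope (b (suc (m ℕ.+ n))) (b (m ℕ.+ n)) (b m) (b-drift m n) (b-step (m ℕ.+ n)))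
    where
    open +-*-Solver
    telescope : ∀ x y z {r s} → ∣ y ℚ.- z ∣ ℚ.≤ r → ∣ x ℚ.- y ∣ ℚ.≤ s → ∣ x ℚ.- z ∣ ℚ.≤ r ℚ.+ s
    telescope x y z {r} {s} y-z≤r x-y≤s = subst (λ p → ∣ p ∣ ℚ.≤ r ℚ.+ s)
      (solve 3 (λ x y z → (y :- z) :+ (x :- y) := x :- z) refl x y z) (∣p+q∣≤ (y ℚ.- z) (x ℚ.- y) y-z≤r x-y≤s)

  -- The steps are bounded by a geometric series of ratio 39/40, and 40 = 1/(1 - 39/40).
  b-near : ∀ {m n} → m ℕ.≤ n → ∣ b n ℚ.- b m ∣ ℚ.≤ (+ 40 ℚ./ 1) ℚ.* radius m
  b-near {m} {n} m≤n = subst (λ k → ∣ b k ℚ.- b m ∣ ℚ.≤ (+ 40 ℚ./ 1) ℚ.* radius m) (ℕ.m+[n∸m]≡n m≤n) (begin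
    ∣ b (m ℕ.+ k) ℚ.- b m ∣                  ≤⟨ b-drift m k ⟩
    S                                        ≡⟨ solve 1 (λ s → s := con (+ 40 ℚ./ 1) :* (con (1ℚ ℚ.- 39/40) :* s)) refl S ⟩
    (+ 40 ℚ./ 1) ℚ.* ((1ℚ ℚ.- 39/40) ℚ.* S)
      ≤⟨ ℚ.*-monoˡ-≤-nonNeg (+ 40 ℚ./ 1) S/40≤ ⟩
    (+ 40 ℚ./ 1) ℚ.* radius (m ℕ.+ 0)        ≡⟨ cong (λ j → (+ 40 ℚ./ 1) ℚ.* radius j) (ℕ.+-identityʳ m) ⟩
    (+ 40 ℚ./ 1) ℚ.* radius m                ∎)
    where
    open ℚ.≤-Reasoning
    open +-*-Solver
    k = n ℕ.∸ m
    S = Σℚ< (shift m radius) k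
    S/40≤ : (1ℚ ℚ.- 39/40) ℚ.* S ℚ.≤ radius (m ℕ.+ 0)
    S/40≤ = ℚ.≤-trans (p≤p+q (ℚ.<⇒≤ (0<radius (m ℕ.+ k))))
      (geometric {shift m radius} {39/40} (λ j → ℚ.≤-reflexive (trans (cong radius (ℕ.+-suc m j)) (radius-suc (m ℕ.+ j)))) k)

  radius-small : ∀ {c ε} → 0ℚ ℚ.≤ c → 0ℚ ℚ.< ε → ∃ λ N → ∀ n → N ℕ.≤ n → c ℚ.* radius n ℚ.≤ ε
  radius-small {c} {ε} 0≤c 0<ε =
    let N , h = pow-small {1/40} (ℚ.positive⁻¹ 1/40) (from-yes (0ℚ ℚ.≤? 39/40)) {c ℚ.* 5/4} {ε} (0≤p*q 0≤c (from-yes (0ℚ ℚ.≤? 5/4))) 0<ε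
    in N , λ n N≤n → subst (ℚ._≤ ε) (ℚ.*-assoc c 5/4 (pow 39/40 n)) (h n N≤n)

  -- The sum of all angles of rotation. Its partial sums are rational, so they serve directly as the
  -- representing sequence.
  β : ℝ
  β = mkℝ b λ ε 0<ε →
    let N , small = radius-small {+ 80 ℚ./ 1} {ε} (from-yes (0ℚ ℚ.≤? + 80 ℚ./ 1)) 0<ε
    in N , λ m n N≤m N≤n → begin
      ∣ b m ℚ.- b n ∣
        ≡⟨ cong ∣_∣ (solve 3 (λ x y z → x :- y := (x :- z) :+ (z :- y)) refl (b m) (b n) (b N)) ⟩
      ∣ (b m ℚ.- b N) ℚ.+ (b N ℚ.- b n) ∣
        ≤⟨ ∣p+q∣≤ (b m ℚ.- b N) (b N ℚ.- b n) (b-near N≤m)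
             (ℚ.≤-trans (ℚ.≤-reflexive (∣p-q∣≡∣q-p∣ (b N) (b n))) (b-near N≤n)) ⟩
      (+ 40 ℚ./ 1) ℚ.* radius N ℚ.+ (+ 40 ℚ./ 1) ℚ.* radius N
        ≡⟨ ℚ.*-distribʳ-+ (radius N) (+ 40 ℚ./ 1) (+ 40 ℚ./ 1) ⟨
      (+ 80 ℚ./ 1) ℚ.* radius N
        ≤⟨ small N ℕ.≤-refl ⟩
      ε ∎
    where open ℚ.≤-Reasoning
          open +-*-Solver

  ∥w∥-bounded : ∃ λ N → ∀ n → N ℕ.≤ n → ∥ at n w ∥ ℚ.≤ + 3 ℚ./ 1
  ∥w∥-bounded = let eventually N h = w-near in N , λ n N≤n → begin
      ∥ at n w ∥
        ≡⟨ cong ∥_∥ (solve 1 (λ z → z := (z :- con 1ᵢ) :+ con 1ᵢ) refl (at n w)) ⟩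
      ∥ (at n w ⊕ ⊖ 1ᵢ) ⊕ 1ᵢ ∥
        ≤⟨ ∥⊕∥-mono (at n w ⊕ ⊖ 1ᵢ) 1ᵢ (h n N≤n) ℚ.≤-refl ⟩
      (+ 6 ℚ./ 5) ℚ.+ ∥ 1ᵢ ∥
        ≤⟨ from-yes ((+ 6 ℚ./ 5) ℚ.+ ∥ 1ᵢ ∥ ℚ.≤? + 3 ℚ./ 1) ⟩
      + 3 ℚ./ 1 ∎
    where open ℚ.≤-Reasoning
          open C-Solver

  -- At index `n` the two sides evaluate the series at the angles `b n` and `b k`, which differ by
  -- at most 40 times the radius at `k`. The factor `M` is the Lipschitz constant, and 3 bounds the
  -- norm of `w`.
  drift : ∀ {B M} → 0ℚ ℚ.≤ B → 0ℚ ℚ.≤ M → (∀ n → Σℚ< (t B) n ℚ.≤ M) →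
          ∀ k → (∀ n → k ℕ.≤ n → ∣ b n ∣ ℚ.≤ B) →
          w * cis β ≈ℂ[ (+ 3 ℚ./ 1) ℚ.* (((+ 40 ℚ./ 1) ℚ.* radius k) ℚ.* M) ] w * cis (fromℚ (b k))
  drift {B} {M} 0≤B 0≤M Σ≤M k b≤B = eventually (W ℕ.⊔ k) bound
    where
    open ℚ.≤-Reasoning
    open C-Solver
    W = proj₁ ∥w∥-bounded
    bounded : ∀ n → k ℕ.≤ n → ∥ i* (b n) ∥ ℚ.≤ B
    bounded n k≤n = subst (ℚ._≤ B) (sym (∥i*a∥≡∣a∣ (b n))) (b≤B n k≤n)
    factor : ∀ w x y → w ⊗ x ⊕ ⊖ (w ⊗ y) ≡ w ⊗ (x ⊕ ⊖ y)
    factor = solve 3 (λ w x y → w :* x :- w :* y := w :* (x :- y)) refl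
    bound : ∀ n → W ℕ.⊔ k ℕ.≤ n → ∥ at n w ⊗ E (i* (b n)) n ⊕ ⊖ (at n w ⊗ E (i* (b k)) n) ∥
            ℚ.≤ (+ 3 ℚ./ 1) ℚ.* (((+ 40 ℚ./ 1) ℚ.* radius k) ℚ.* M)
    bound n ≤n = begin
      ∥ at n w ⊗ E (i* (b n)) n ⊕ ⊖ (at n w ⊗ E (i* (b k)) n) ∥
        ≡⟨ cong ∥_∥ (factor (at n w) (E (i* (b n)) n) (E (i* (b k)) n)) ⟩
      ∥ at n w ⊗ (E (i* (b n)) n ⊕ ⊖ E (i* (b k)) n) ∥
        ≤⟨ ∥⊗∥-mono (at n w) (E (i* (b n)) n ⊕ ⊖ E (i* (b k)) n) (proj₂ ∥w∥-bounded n (ℕ.m⊔n≤o⇒m≤o W k ≤n))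
             (E-lipschitz 0≤B Σ≤M (i* (b k)) (i* (b n)) (bounded k ℕ.≤-refl) (bounded n k≤n) n) ⟩
      (+ 3 ℚ./ 1) ℚ.* (∥ i* (b n) ⊕ ⊖ i* (b k) ∥ ℚ.* M)
        ≤⟨ ℚ.*-monoˡ-≤-nonNeg (+ 3 ℚ./ 1) {∥ i* (b n) ⊕ ⊖ i* (b k) ∥ ℚ.* M} {((+ 40 ℚ./ 1) ℚ.* radius k) ℚ.* M}
             (ℚ.*-monoʳ-≤-nonNeg M {{ℚ.nonNegative 0≤M}}
               (ℚ.≤-trans (ℚ.≤-reflexive (∥i*a⊖i*b∥≡∣a-b∣ (b n) (b k))) (b-near k≤n))) ⟩
      (+ 3 ℚ./ 1) ℚ.* (((+ 40 ℚ./ 1) ℚ.* radius k) ℚ.* M) ∎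
      where k≤n = ℕ.m⊔n≤o⇒n≤o W k ≤n

  w*cisβ≈1 : w * cis β ≈ 1ℂ
  w*cisβ≈1 = ≈ℂ⇒≈ {w * cis β} {1ℂ} near-1
    where
    open +-*-Solver
    B-bound = eventually-bounded β
    B = proj₁ B-bound
    K = proj₁ (proj₂ B-bound)
    0≤B : 0ℚ ℚ.≤ B
    0≤B = ℚ.<⇒≤ (proj₁ (proj₂ (proj₂ B-bound)))
    b≤B : ∀ n → K ℕ.≤ n → ∣ b n ∣ ℚ.≤ B
    b≤B = proj₂ (proj₂ (proj₂ B-bound))
    M-bound = t-bounded 0≤B
    M = proj₁ M-bound
    0≤M : 0ℚ ℚ.≤ M
    0≤M = ℚ.<⇒≤ (proj₁ (proj₂ M-bound))
    -- The total coefficient of `radius k`: the drift from `b k` to the limit, and 1 for the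
    -- distance that `approximation k` still leaves.
    c = (+ 3 ℚ./ 1) ℚ.* ((+ 40 ℚ./ 1) ℚ.* M) ℚ.+ 1ℚ
    0≤c : 0ℚ ℚ.≤ c
    0≤c = ℚ.+-mono-≤ (0≤p*q (from-yes (0ℚ ℚ.≤? + 3 ℚ./ 1)) (0≤p*q (from-yes (0ℚ ℚ.≤? + 40 ℚ./ 1)) 0≤M)) 0≤1
    collect : ∀ r m → (+ 3 ℚ./ 1) ℚ.* (((+ 40 ℚ./ 1) ℚ.* r) ℚ.* m) ℚ.+ r
              ≡ ((+ 3 ℚ./ 1) ℚ.* ((+ 40 ℚ./ 1) ℚ.* m) ℚ.+ 1ℚ) ℚ.* r
    collect = solve 2 (λ r m → con (+ 3 ℚ./ 1) :* ((con (+ 40 ℚ./ 1) :* r) :* m) :+ r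
                            := (con (+ 3 ℚ./ 1) :* (con (+ 40 ℚ./ 1) :* m) :+ con 1ℚ) :* r) refl
    close-at : ∀ {ε} k → K ℕ.≤ k → c ℚ.* radius k ℚ.≤ ε → w * cis β ≈ℂ[ ε ] 1ℂ
    close-at k K≤k small = ≈ℂ-weaken (ℚ.≤-trans (ℚ.≤-reflexive (collect (radius k) M)) small)
      (≈ℂ-trans {w * cis β} {w * cis (fromℚ (b k))} {1ℂ}
        (drift 0≤B 0≤M (proj₂ (proj₂ M-bound)) k (λ n k≤n → b≤B n (ℕ.≤-trans K≤k k≤n))) (proj₂ (approximation k)))
    near-1 : ∀ ε → 0ℚ ℚ.< ε → w * cis β ≈ℂ[ ε ] 1ℂ
    near-1 ε 0<ε = let N , small = radius-small {c} {ε} 0≤c 0<ε in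
      close-at (N ℕ.⊔ K) (ℕ.m≤n⊔m N K) (small (N ℕ.⊔ K) (ℕ.m≤m⊔n N K))

  w-isCis : IsCis w
  w-isCis = -ℝ β , (begin
    cis (-ℝ β)                     ≈⟨ cis-neg β ⟩
    conj (cis β)                   ≈⟨ ℂᵣ.*-identityˡ (conj (cis β)) ⟨
    1ℂ * conj (cis β)              ≈⟨ ℂᵣ.*-congʳ {conj (cis β)} {w * cis β} {1ℂ} w*cisβ≈1 ⟨
    (w * cis β) * conj (cis β)     ≈⟨ ℂᵣ.*-assoc w (cis β) (conj (cis β)) ⟩
    w * (cis β * conj (cis β))     ≈⟨ ℂᵣ.*-congˡ {w} {cis β * conj (cis β)} {1ℂ} cisβ*conj≈1 ⟩
    w * 1ℂ                         ≈⟨ ℂᵣ.*-identityʳ w ⟩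
    w                              ∎)
    where
    open import Relation.Binary.Reasoning.Setoid ℂᵣ.setoid
    cisβ*conj≈1 : cis β * conj (cis β) ≈ 1ℂ
    cisβ*conj≈1 = ℂᵣ.trans {cis β * conj (cis β)} {conj (cis β) * cis β} {1ℂ} (ℂᵣ.*-comm (cis β) (conj (cis β))) (cis-unit β)

-- Agreement with the exponential series of the statement

1/n-unique : ∀ {p q r} → p ℚ.* r ≡ 1ℚ → q ℚ.* r ≡ 1ℚ → p ≡ q
1/n-unique {p} {q} {r} pr≡1 qr≡1 = begin
  p                ≡⟨ ℚ.*-identityʳ p ⟨
  p ℚ.* 1ℚ         ≡⟨ cong (p ℚ.*_) qr≡1 ⟨
  p ℚ.* (q ℚ.* r)  ≡⟨ solve 3 (λ p q r → p :* (q :* r) := (p :* r) :* q) refl p q r ⟩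
  (p ℚ.* r) ℚ.* q  ≡⟨ cong (ℚ._* q) pr≡1 ⟩
  1ℚ ℚ.* q         ≡⟨ ℚ.*-identityˡ q ⟩
  q                ∎
  where open ≡-Reasoning
        open +-*-Solver

1/[1+k]! : ∀ k → 1/ suc k ! ≡ 1/suc k ℚ.* 1/ k !
1/[1+k]! k = 1/n-unique {r = fromℕ (suc k !)} (1/n*n≡1 (suc k !) {{suc k ℕ.!≢0}}) (begin
  (1/suc k ℚ.* 1/ k !) ℚ.* fromℕ (suc k ℕ.* k !)
    ≡⟨ cong ((1/suc k ℚ.* 1/ k !) ℚ.*_) (fromℕ-* (suc k) (k !)) ⟩
  (1/suc k ℚ.* 1/ k !) ℚ.* (fromℕ (suc k) ℚ.* fromℕ (k !))
    ≡⟨ solve 4 (λ a b c d → (a :* b) :* (c :* d) := (a :* c) :* (b :* d)) refl (1/suc k) (1/ k !) (fromℕ (suc k)) (fromℕ (k !)) ⟩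
  (1/suc k ℚ.* fromℕ (suc k)) ℚ.* (1/ k ! ℚ.* fromℕ (k !))
    ≡⟨ cong₂ ℚ._*_ (1/n*n≡1 (suc k)) (1/n*n≡1 (k !) {{k ℕ.!≢0}}) ⟩
  1ℚ ∎)
  where open ≡-Reasoning
        open +-*-Solver

at-expPartialSum : ∀ n z m → at n (expPartialSum z m) ≡ E (at n z) m
at-expPartialSum n z m = trans (at-sum (λ k → (fromℚ (1/ k !) +i 0ℝ) * z ^ k) m) (Σ<-cong at-term m)
  where
  at-sum : ∀ (f : ℕ → ℂ) m → at n (sum {m} λ k → f (toℕ k)) ≡ Σ< (at n ∘ f) m
  at-sum f zero    = refl
  at-sum f (suc m) = trans (cong (at n (f 0) ⊕_) (at-sum (f ∘ suc) m)) (sym (Σ<-suc (at n ∘ f) m))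
  at-term : ∀ k → at n ((fromℚ (1/ k !) +i 0ℝ) * z ^ k) ≡ T (at n z) k
  at-term zero    = refl
  at-term (suc k) = begin
    κ (1/ suc k !) ⊗ (at n z ⊗ at n (z ^ k))
      ≡⟨ cong (λ r → κ r ⊗ (at n z ⊗ at n (z ^ k))) (1/[1+k]! k) ⟩
    κ (1/suc k ℚ.* 1/ k !) ⊗ (at n z ⊗ at n (z ^ k))
      ≡⟨ cong (_⊗ (at n z ⊗ at n (z ^ k))) (κ-* (1/suc k) (1/ k !)) ⟨
    (κ (1/suc k) ⊗ κ (1/ k !)) ⊗ (at n z ⊗ at n (z ^ k))
      ≡⟨ solve 4 (λ a b z w → (a :* b) :* (z :* w) := a :* (z :* (b :* w))) refl
           (κ (1/suc k)) (κ (1/ k !)) (at n z) (at n (z ^ k)) ⟩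
    κ (1/suc k) ⊗ (at n z ⊗ (κ (1/ k !) ⊗ at n (z ^ k)))
      ≡⟨ cong (λ w → κ (1/suc k) ⊗ (at n z ⊗ w)) (at-term k) ⟩
    T (at n z) (suc k) ∎
    where open ≡-Reasoning
          open C-Solver

-- Convergence of the series compares a partial sum of fixed length `m` with `w` along the index `n`
-- of the reals. The tail estimate exchanges `m` for `n` uniformly in the argument, which leads to
-- the diagonal value `cis α`.
cis≈⇒≈exp : ∀ {α w} → cis α ≈ w → w ≈exp (0ℝ +i α)
cis≈⇒≈exp {α} {w} cis≈w ε 0<ε =
  let B , K , 0<B , α≤B = eventually-bounded α
      L , tail = E-tail (ℚ.<⇒≤ 0<B) (0<½*ε 0<ε)
      eventually N near = ≈⇒≈ℂ {cis α} {w} cis≈w (0<½*ε 0<ε)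
      bound : ∀ m → L ℕ.≤ m → ∀ n → K ℕ.⊔ (L ℕ.⊔ N) ℕ.≤ n → ∥ at n (expPartialSum (0ℝ +i α) m) ⊕ ⊖ at n w ∥ ℚ.≤ ε
      bound m L≤m n ≤n =
        let LN≤n = ℕ.m⊔n≤o⇒n≤o K (L ℕ.⊔ N) ≤n
            z = i* (seq α n)
        in begin
        ∥ at n (expPartialSum (0ℝ +i α) m) ⊕ ⊖ at n w ∥
          ≡⟨ cong (λ x → ∥ x ⊕ ⊖ at n w ∥) (at-expPartialSum n (0ℝ +i α) m) ⟩
        ∥ E z m ⊕ ⊖ at n w ∥
          ≤⟨ ∥⊖∥-triangle (E z m) (E z n) (at n w) ⟩
        ∥ E z m ⊕ ⊖ E z n ∥ ℚ.+ ∥ E z n ⊕ ⊖ at n w ∥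
          ≤⟨ ℚ.+-mono-≤ (tail m n L≤m (ℕ.m⊔n≤o⇒m≤o L N LN≤n) z
                (subst (ℚ._≤ B) (sym (∥i*a∥≡∣a∣ (seq α n))) (α≤B n (ℕ.m⊔n≤o⇒m≤o K (L ℕ.⊔ N) ≤n))))
               (near n (ℕ.m⊔n≤o⇒n≤o L N LN≤n)) ⟩
        ½ ℚ.* ε ℚ.+ ½ ℚ.* ε
          ≡⟨ ½*ε+½*ε≡ε ε ⟩
        ε ∎
  in L , λ m L≤m →
       (K ℕ.⊔ (L ℕ.⊔ N) , λ n ≤n → ℚ.≤-trans (∣a∣≤∥z∥ (at n (expPartialSum (0ℝ +i α) m) ⊕ ⊖ at n w)) (bound m L≤m n ≤n)) ,
       (K ℕ.⊔ (L ℕ.⊔ N) , λ n ≤n → ℚ.≤-trans (∣b∣≤∥z∥ (at n (expPartialSum (0ℝ +i α) m) ⊕ ⊖ at n w)) (bound m L≤m n ≤n))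
  where open ℚ.≤-Reasoning

-- Multiplication by i moves every point of the circle into the sector
-- |im z| ≤ re z, where the iteration starts.

iℂ : ℂ
iℂ = 0ℝ +i 1ℝ

-- i = (3 + 4i)/5 · (4 + 3i)/5
abstract
  iℂ-isCis : IsCis iℂ
  iℂ-isCis = IsCis-cong {p * q} {iℂ} (≈-pointwise {p * q} {iℂ} λ _ → refl) (IsCis-* {p} {q}
    -- In the norm used here i is at distance 2 from 1, too far for the iteration, while its two
    -- factors are at distances 6/5 and 4/5.
    (Iteration.w-isCis p (≈-pointwise {conj p * p} {1ℂ} λ _ → refl)
      (eventually 0 λ _ _ → from-yes (∥ ((+ 3 ℚ./ 5) , (+ 4 ℚ./ 5)) ⊕ ⊖ 1ᵢ ∥ ℚ.≤? + 6 ℚ./ 5)))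
    (Iteration.w-isCis q (≈-pointwise {conj q * q} {1ℂ} λ _ → refl)
      (eventually 0 λ _ _ → from-yes (∥ ((+ 4 ℚ./ 5) , (+ 3 ℚ./ 5)) ⊕ ⊖ 1ᵢ ∥ ℚ.≤? + 6 ℚ./ 5))))
    where
    p q : ℂ
    p = fromℚ (+ 3 ℚ./ 5) +i fromℚ (+ 4 ℚ./ 5)
    q = fromℚ (+ 4 ℚ./ 5) +i fromℚ (+ 3 ℚ./ 5)

-- Multiplication by i, written on components so that the sector conditions on a turned number are
-- literally conditions on the terms of `z`.
turn : ℂ → ℂ
turn z = (-ℝ im z) +i re z

turn⁻¹-isCis : ∀ {z} → IsCis (turn z) → IsCis z
turn⁻¹-isCis {z} turn-isCis = IsCis-cong {conj iℂ * turn z} {z} (≈-pointwise {conj iℂ * turn z} {z} λ n → cong₂ _,_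
    (solve 2 (λ x y → con 0ℚ :* (:- y) :- (:- con 1ℚ) :* x := x) refl (seq (re z) n) (seq (im z) n))
    (solve 2 (λ x y → con 0ℚ :* x :+ (:- con 1ℚ) :* (:- y) := y) refl (seq (re z) n) (seq (im z) n)))
  (IsCis-* {conj iℂ} {turn z} conj-isCis turn-isCis)
  where
  open +-*-Solver
  conj-isCis : IsCis (conj iℂ)
  conj-isCis = let α , cis≈i = iℂ-isCis in
    -ℝ α , ℂᵣ.trans {cis (-ℝ α)} {conj (cis α)} {conj iℂ} (cis-neg α) (conj-cong {cis α} {iℂ} cis≈i)

-- The sector of `z` is read off the rational term at `N`, where the order is decidable. The
-- tolerance 1/5 is what the starting distance 6/5 leaves, since the term itself will be within 1 of
-- 1.
Approximates : ℕ → ℂ → Set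
Approximates N z = (∀ n → N ℕ.≤ n → ∥ at n z ⊕ ⊖ at N z ∥ ℚ.≤ + 1 ℚ./ 5)
                 × seq (re z) N ℚ.* seq (re z) N ℚ.+ seq (im z) N ℚ.* seq (im z) N ℚ.≤ 9/8

OnCircle-turn : ∀ {z} → OnCircle z → OnCircle (turn z)
OnCircle-turn {z} z-unit = ℂᵣ.trans {conj (turn z) * turn z} {conj z * z} {1ℂ} (≈-pointwise {conj (turn z) * turn z} {conj z * z} λ n → cong₂ _,_
  (solve 2 (λ x y → (:- y) :* (:- y) :- (:- x) :* x := x :* x :- (:- y) :* y) refl (seq (re z) n) (seq (im z) n))
  (solve 2 (λ x y → (:- y) :* x :+ (:- x) :* (:- y) := x :* y :+ (:- y) :* x) refl (seq (re z) n) (seq (im z) n))) z-unit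
  where open +-*-Solver

Approximates-turn : ∀ {N z} → Approximates N z → Approximates N (turn z)
Approximates-turn {N} {z} (steady , modulus) =
  (λ n N≤n → ℚ.≤-trans (ℚ.≤-reflexive (trans (ℚ.+-comm (∣ (ℚ.- seq (im z) n) ℚ.- (ℚ.- seq (im z) N) ∣) (∣ seq (re z) n ℚ.- seq (re z) N ∣))
    (cong (∣ seq (re z) n ℚ.- seq (re z) N ∣ ℚ.+_) (trans (cong ∣_∣ (solve 2 (λ p q → (:- p) :- (:- q) := :- (p :- q)) refl (seq (im z) n) (seq (im z) N)))
      (ℚ.∣-p∣≡∣p∣ (seq (im z) n ℚ.- seq (im z) N)))))) (steady n N≤n)) ,
  ℚ.≤-trans (ℚ.≤-reflexive (solve 2 (λ x y → (:- y) :* (:- y) :+ x :* x := x :* x :+ y :* y) refl (seq (re z) N) (seq (im z) N))) modulus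
  where open +-*-Solver

-- If x ≤ 1, then (1 - x) + |y| ≤ (1 - x) + x = 1. If x ≥ 1, then x + |y| - 1 is at most 3/2 - 1 by
-- the bound on the modulus.
sector-isCis : ∀ {N z} → OnCircle z → Approximates N z → ∣ seq (im z) N ∣ ℚ.≤ seq (re z) N → IsCis z
sector-isCis {N} {z} z-unit (steady , modulus) y≤x = Iteration.w-isCis z z-unit (eventually N λ n N≤n → begin
  ∥ at n z ⊕ ⊖ 1ᵢ ∥
    ≤⟨ ∥⊖∥-triangle (at n z) (at N z) 1ᵢ ⟩
  ∥ at n z ⊕ ⊖ at N z ∥ ℚ.+ ∥ at N z ⊕ ⊖ 1ᵢ ∥
    ≤⟨ ℚ.+-mono-≤ (steady n N≤n) near ⟩
  (+ 1 ℚ./ 5) ℚ.+ 1ℚ ∎)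
  where
  open ℚ.≤-Reasoning
  open +-*-Solver
  x = seq (re z) N
  y = seq (im z) N
  0≤x = ℚ.≤-trans (ℚ.0≤∣p∣ y) y≤x
  near : ∣ x ℚ.- 1ℚ ∣ ℚ.+ ∣ y ℚ.- 0ℚ ∣ ℚ.≤ 1ℚ
  near with ℚ.≤-total x 1ℚ
  ... | inj₁ x≤1 = begin
    ∣ x ℚ.- 1ℚ ∣ ℚ.+ ∣ y ℚ.- 0ℚ ∣
      ≡⟨ cong₂ ℚ._+_ (trans (∣p-q∣≡∣q-p∣ x 1ℚ) (ℚ.0≤p⇒∣p∣≡p (subst (ℚ._≤ 1ℚ ℚ.- x) (ℚ.+-inverseʳ x) (ℚ.+-monoˡ-≤ (ℚ.- x) x≤1))))
                     (cong ∣_∣ (ℚ.+-identityʳ y)) ⟩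
    (1ℚ ℚ.- x) ℚ.+ ∣ y ∣       ≤⟨ ℚ.+-monoʳ-≤ (1ℚ ℚ.- x) y≤x ⟩
    (1ℚ ℚ.- x) ℚ.+ x           ≡⟨ solve 1 (λ x → (con 1ℚ :- x) :+ x := con 1ℚ) refl x ⟩
    1ℚ                         ∎
  ... | inj₂ 1≤x = begin
    ∣ x ℚ.- 1ℚ ∣ ℚ.+ ∣ y ℚ.- 0ℚ ∣
      ≡⟨ cong₂ ℚ._+_ (ℚ.0≤p⇒∣p∣≡p (subst (ℚ._≤ x ℚ.- 1ℚ) (ℚ.+-inverseʳ 1ℚ) (ℚ.+-monoˡ-≤ (ℚ.- 1ℚ) 1≤x))) (cong ∣_∣ (ℚ.+-identityʳ y)) ⟩
    (x ℚ.- 1ℚ) ℚ.+ ∣ y ∣       ≡⟨ solve 2 (λ x y → (x :- con 1ℚ) :+ y := (x :+ y) :- con 1ℚ) refl x (∣ y ∣) ⟩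
    (x ℚ.+ ∣ y ∣) ℚ.- 1ℚ       ≡⟨ cong (λ p → (p ℚ.+ ∣ y ∣) ℚ.- 1ℚ) (ℚ.0≤p⇒∣p∣≡p 0≤x) ⟨
    ∥ x , y ∥ ℚ.- 1ℚ           ≤⟨ ℚ.+-monoˡ-≤ (ℚ.- 1ℚ) (∥z∥≤3/2 x y modulus) ⟩
    3/2 ℚ.- 1ℚ                 ≤⟨ from-yes (3/2 ℚ.- 1ℚ ℚ.≤? 1ℚ) ⟩
    1ℚ                         ∎

OnCircle⇒IsCis : ∀ z → OnCircle z → IsCis z
OnCircle⇒IsCis z z-unit = quadrant (ℚ.≤-total (∣ y ∣) (∣ x ∣)) (ℚ.≤-total 0ℚ x) (ℚ.≤-total 0ℚ y)
  where
  -- The tolerances match `Approximates`: 1 + 1/8 = 9/8 for the squared modulus, and 1/10 for each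
  -- component adds up to 1/5.
  M = proj₁ (OnCircle⇒∣z∣² {z} z-unit (ℚ.positive⁻¹ (+ 1 ℚ./ 8)))
  K = proj₁ (cauchy (re z) (+ 1 ℚ./ 10) (ℚ.positive⁻¹ (+ 1 ℚ./ 10)))
  L = proj₁ (cauchy (im z) (+ 1 ℚ./ 10) (ℚ.positive⁻¹ (+ 1 ℚ./ 10)))
  N = M ℕ.⊔ (K ℕ.⊔ L)
  K≤N = ℕ.≤-trans (ℕ.m≤m⊔n K L) (ℕ.m≤n⊔m M (K ℕ.⊔ L))
  L≤N = ℕ.≤-trans (ℕ.m≤n⊔m K L) (ℕ.m≤n⊔m M (K ℕ.⊔ L))
  x = seq (re z) N
  y = seq (im z) N

  p-1≤q⇒p≤1+q : ∀ {p q} → ∣ p ℚ.- 1ℚ ∣ ℚ.≤ q → p ℚ.≤ q ℚ.+ 1ℚ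
  p-1≤q⇒p≤1+q {p} {q} h = ℚ.≤-trans (ℚ.≤-trans (p≤∣p∣ p) (∣p∣≤∣p-q∣+∣q∣ p 1ℚ)) (ℚ.+-monoˡ-≤ 1ℚ h)

  z-approx : Approximates N z
  z-approx =
    (λ n N≤n → ℚ.+-mono-≤
      (proj₂ (cauchy (re z) (+ 1 ℚ./ 10) (ℚ.positive⁻¹ (+ 1 ℚ./ 10))) n N (ℕ.≤-trans K≤N N≤n) K≤N)
      (proj₂ (cauchy (im z) (+ 1 ℚ./ 10) (ℚ.positive⁻¹ (+ 1 ℚ./ 10))) n N (ℕ.≤-trans L≤N N≤n) L≤N)) ,
    p-1≤q⇒p≤1+q (proj₂ (OnCircle⇒∣z∣² {z} z-unit (ℚ.positive⁻¹ (+ 1 ℚ./ 8))) N (ℕ.m≤m⊔n M (K ℕ.⊔ L)))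

  ∣p∣≡-p : ∀ {p} → p ℚ.≤ 0ℚ → ∣ p ∣ ≡ ℚ.- p
  ∣p∣≡-p {p} p≤0 = trans (sym (ℚ.∣-p∣≡∣p∣ p)) (ℚ.0≤p⇒∣p∣≡p (ℚ.neg-antimono-≤ p≤0))

  turn-unit : OnCircle (turn z)
  turn-unit = OnCircle-turn {z} z-unit
  turn²-unit : OnCircle (turn (turn z))
  turn²-unit = OnCircle-turn {turn z} turn-unit
  turn-approx : Approximates N (turn z)
  turn-approx = Approximates-turn {N} {z} z-approx
  turn²-approx : Approximates N (turn (turn z))
  turn²-approx = Approximates-turn {N} {turn z} turn-approx

  -- In the order of the clauses, 0, 2, 3 and 1 quarter turns bring the term at `N` into the sector.
  -- Overlaps of the cases are harmless, as any valid choice leads to an angle.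
  quadrant : ∣ y ∣ ℚ.≤ ∣ x ∣ ⊎ ∣ x ∣ ℚ.≤ ∣ y ∣ → 0ℚ ℚ.≤ x ⊎ x ℚ.≤ 0ℚ → 0ℚ ℚ.≤ y ⊎ y ℚ.≤ 0ℚ → IsCis z
  quadrant (inj₁ y≤x) (inj₁ 0≤x) _ = sector-isCis {N} {z} z-unit z-approx
    (ℚ.≤-trans y≤x (ℚ.≤-reflexive (ℚ.0≤p⇒∣p∣≡p 0≤x)))
  quadrant (inj₁ y≤x) (inj₂ x≤0) _ = turn⁻¹-isCis {z} (turn⁻¹-isCis {turn z}
    (sector-isCis {N} {turn (turn z)} turn²-unit turn²-approx
      (ℚ.≤-trans (ℚ.≤-reflexive (ℚ.∣-p∣≡∣p∣ y)) (ℚ.≤-trans y≤x (ℚ.≤-reflexive (∣p∣≡-p x≤0))))))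
  quadrant (inj₂ x≤y) _ (inj₁ 0≤y) = turn⁻¹-isCis {z} (turn⁻¹-isCis {turn z} (turn⁻¹-isCis {turn (turn z)}
    (sector-isCis {N} {turn (turn (turn z))} (OnCircle-turn {turn (turn z)} turn²-unit) (Approximates-turn {N} {turn (turn z)} turn²-approx)
      (ℚ.≤-trans (ℚ.≤-reflexive (ℚ.∣-p∣≡∣p∣ x)) (ℚ.≤-trans x≤y
        (ℚ.≤-reflexive (trans (ℚ.0≤p⇒∣p∣≡p 0≤y) (solve 1 (λ y → y := :- (:- y)) refl y))))))))
    where open +-*-Solver
  quadrant (inj₂ x≤y) _ (inj₂ y≤0) = turn⁻¹-isCis {z}
    (sector-isCis {N} {turn z} turn-unit turn-approx (ℚ.≤-trans x≤y (ℚ.≤-reflexive (∣p∣≡-p y≤0))))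

exp-surjective : ∀ w → conj w * w ≈ 1ℂ → ∃ λ α → w ≈exp (0ℝ +i α)
exp-surjective w w-unit = let α , cis≈w = OnCircle⇒IsCis w w-unit in α , cis≈⇒≈exp cis≈w

no-cardinality-7 : ¬ (∃ λ (Φ : QLS 6) → HasCardinality Φ 7)
no-cardinality-7 (Φ , card) = no-cardinality-1+n exp-surjective Φ card

-- Gaussian integers

ℤ[i] : Set
ℤ[i] = ℤ × ℤ

0ᵍ : ℤ[i]
0ᵍ = 0ℤ , 0ℤ

infixl 6 _+ᵍ_
infixl 7 _*ᵍ_

_+ᵍ_ _*ᵍ_ : ℤ[i] → ℤ[i] → ℤ[i]
(a , b) +ᵍ (c , d) = a ℤ.+ c , b ℤ.+ d
(a , b) *ᵍ (c , d) = a ℤ.* c ℤ.- b ℤ.* d , a ℤ.* d ℤ.+ b ℤ.* c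

conjᵍ : ℤ[i] → ℤ[i]
conjᵍ (a , b) = a , ℤ.- b

herm : ∀ {n} → (Fin n → ℤ[i]) → (Fin n → ℤ[i]) → ℤ[i]
herm {zero}  u v = 0ᵍ
herm {suc n} u v = conjᵍ (u zero) *ᵍ v zero +ᵍ herm (u ∘ suc) (v ∘ suc)

fromℤ : ℤ → ℚ
fromℤ i = i ℚ./ 1

toℚᵘ-fromℤ : ∀ i → ℚ.toℚᵘ (fromℤ i) ℚᵘ.≃ ℚᵘ.mkℚᵘ i 0
toℚᵘ-fromℤ i = ℚ.toℚᵘ-fromℚᵘ (ℚᵘ.mkℚᵘ i 0)

fromℤ-+ : ∀ i j → fromℤ (i ℤ.+ j) ≡ fromℤ i ℚ.+ fromℤ j
fromℤ-+ i j = ℚ.toℚᵘ-injective (ℚᵘ.≃-trans (toℚᵘ-fromℤ (i ℤ.+ j)) (ℚᵘ.≃-trans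
  (ℚᵘ.*≡* (cong (ℤ._* 1ℤ) (sym (cong₂ ℤ._+_ (ℤ.*-identityʳ i) (ℤ.*-identityʳ j)))))
  (ℚᵘ.≃-sym (ℚᵘ.≃-trans (ℚ.toℚᵘ-homo-+ (fromℤ i) (fromℤ j)) (ℚᵘ.+-cong (toℚᵘ-fromℤ i) (toℚᵘ-fromℤ j))))))

fromℤ-* : ∀ i j → fromℤ (i ℤ.* j) ≡ fromℤ i ℚ.* fromℤ j
fromℤ-* i j = ℚ.toℚᵘ-injective (ℚᵘ.≃-trans (toℚᵘ-fromℤ (i ℤ.* j))
  (ℚᵘ.≃-sym (ℚᵘ.≃-trans (ℚ.toℚᵘ-homo-* (fromℤ i) (fromℤ j)) (ℚᵘ.*-cong (toℚᵘ-fromℤ i) (toℚᵘ-fromℤ j)))))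

fromℤ-neg : ∀ i → fromℤ (ℤ.- i) ≡ ℚ.- fromℤ i
fromℤ-neg i = ℚ.toℚᵘ-injective (ℚᵘ.≃-trans (toℚᵘ-fromℤ (ℤ.- i))
  (ℚᵘ.≃-sym (ℚᵘ.≃-trans (ℚ.toℚᵘ-homo‿- (fromℤ i)) (ℚᵘ.-‿cong (toℚᵘ-fromℤ i)))))

fromℤ-injective : ∀ {i j} → fromℤ i ≡ fromℤ j → i ≡ j
fromℤ-injective {i} {j} eq = trans (sym (ℤ.*-identityʳ i)) (trans
  (ℚᵘ.drop-*≡* (ℚᵘ.≃-trans (ℚᵘ.≃-sym (toℚᵘ-fromℤ i)) (ℚᵘ.≃-trans (ℚ.toℚᵘ-cong eq) (toℚᵘ-fromℤ j))))
  (ℤ.*-identityʳ j))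

fromℤ≡fromℕ : ∀ n → fromℤ (+ n) ≡ fromℕ n
fromℤ≡fromℕ n = ℚ.toℚᵘ-injective (ℚᵘ.≃-trans (toℚᵘ-fromℤ (+ n)) (ℚᵘ.≃-sym (toℚᵘ-fromℕ n)))

J : ℤ[i] → ℚ[i]
J (a , b) = fromℤ a , fromℤ b

J-+ : ∀ x y → J (x +ᵍ y) ≡ J x ⊕ J y
J-+ (a , b) (c , d) = cong₂ _,_ (fromℤ-+ a c) (fromℤ-+ b d)

J-* : ∀ x y → J (x *ᵍ y) ≡ J x ⊗ J y
J-* (a , b) (c , d) = cong₂ _,_
  (trans (fromℤ-+ (a ℤ.* c) (ℤ.- (b ℤ.* d))) (cong₂ ℚ._+_ (fromℤ-* a c)
    (trans (fromℤ-neg (b ℤ.* d)) (cong ℚ.-_ (fromℤ-* b d)))))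
  (trans (fromℤ-+ (a ℤ.* d) (b ℤ.* c)) (cong₂ ℚ._+_ (fromℤ-* a d) (fromℤ-* b c)))

J-conj : ∀ x → J (conjᵍ x) ≡ conjᵢ (J x)
J-conj (a , b) = cong (fromℤ a ,_) (fromℤ-neg b)

-- Different constants stay at a fixed distance, which closeness up to half that distance excludes.
fromℚ-injective : ∀ {p q} → fromℚ p ≈ℝ fromℚ q → p ≡ q
fromℚ-injective {p} {q} (mk≈ℝ near) with p ℚ.≟ q
... | yes p≡q = p≡q
... | no p≢q = let N , h = near (½ ℚ.* d) (0<½*ε 0<d) in contradiction (ℚ.<-≤-trans ½d<d (h N ℕ.≤-refl)) (ℚ.<-irrefl refl)
  where
  d = ∣ p ℚ.- q ∣
  0<d : 0ℚ ℚ.< d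
  0<d = ℚ.≰⇒> λ d≤0 → p≢q (GroupProperties.x∙y⁻¹≈ε⇒x≈y ℚ.+-0-group p q
    (ℚ.∣p∣≡0⇒p≡0 (p ℚ.- q) (ℚ.≤-antisym d≤0 (ℚ.0≤∣p∣ (p ℚ.- q)))))
  ½d<d : ½ ℚ.* d ℚ.< d
  ½d<d = subst₂ ℚ._<_ (ℚ.+-identityʳ (½ ℚ.* d)) (½*ε+½*ε≡ε d) (ℚ.+-monoʳ-< (½ ℚ.* d) (0<½*ε 0<d))

-- For constant representatives, equality in the limit is exact equality. This brings equations in ℂ
-- back to Gaussian integers.
at-injective : ∀ {z w x y} → (∀ n → at n z ≡ x) → (∀ n → at n w ≡ y) → z ≈ w → x ≡ y
at-injective {z} {w} {a , b} {c , d} z≡x w≡y (re≈ ,≈ im≈) = cong₂ _,_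
  (fromℚ-injective (≈ℝ-trans {y = re z} (≈ℝ-pointwise λ n → sym (cong proj₁ (z≡x n)))
    (≈ℝ-trans {y = re w} re≈ (≈ℝ-pointwise λ n → cong proj₁ (w≡y n)))))
  (fromℚ-injective (≈ℝ-trans {y = im z} (≈ℝ-pointwise λ n → sym (cong proj₂ (z≡x n)))
    (≈ℝ-trans {y = im w} im≈ (≈ℝ-pointwise λ n → cong proj₂ (w≡y n)))))

J-injective : ∀ {x y} → J x ≡ J y → x ≡ y
J-injective eq = cong₂ _,_ (fromℤ-injective (cong proj₁ eq)) (fromℤ-injective (cong proj₂ eq))

-- Orthonormality of the transpose replaces a dimension count: it makes the
-- coefficients ⟨ b i , v ⟩ reproduce v.
unitary⇒basis : ∀ {n} {b : Fin n → ℂ^ n} →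
  (∀ i → IsUnit (b i)) → (∀ i j → i ≢ j → ⟨ b i , b j ⟩ ≈ 0ℂ) →
  (∀ k → IsUnit (flip b k)) → (∀ k l → k ≢ l → ⟨ flip b k , flip b l ⟩ ≈ 0ℂ) →
  IsOrthonormalBasis b
unitary⇒basis {b = b} b-unit b-orthogonal bᵀ-unit bᵀ-orthogonal = record
  { unit = b-unit
  ; orthogonal = b-orthogonal
  ; spanning = λ v → (λ i → ⟨ b i , v ⟩) , λ k → begin
      v k
        ≈⟨ ℂᵣ.*-identityʳ (v k) ⟨
      v k * 1ℂ
        ≈⟨ ℂᵣ.*-congˡ (bᵀ-unit k) ⟨
      v k * ⟨ flip b k , flip b k ⟩
        ≈⟨ sum-single k (λ l → v l * ⟨ flip b l , flip b k ⟩) (λ l l≢k →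
             ℂᵣ.trans (ℂᵣ.*-congˡ (bᵀ-orthogonal l k l≢k)) (ℂᵣ.zeroʳ (v l))) ⟨
      (sum λ l → v l * ⟨ flip b l , flip b k ⟩)
        ≈⟨ ∑.sum-cong-≋ (λ l → ∑.*-distribˡ-sum (v l) (λ i → conj (b i l) * b i k)) ⟩
      (sum λ l → sum λ i → v l * (conj (b i l) * b i k))
        ≈⟨ ∑.∑-comm (λ l i → v l * (conj (b i l) * b i k)) ⟩
      (sum λ i → sum λ l → v l * (conj (b i l) * b i k))
        ≈⟨ ∑.sum-cong-≋ (λ i → ∑.sum-cong-≋ λ l → ℂᵣ.trans
             (ℂᵣ.sym (ℂᵣ.*-assoc (v l) (conj (b i l)) (b i k)))
             (ℂᵣ.*-congʳ (ℂᵣ.*-comm (v l) (conj (b i l))))) ⟩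
      (sum λ i → sum λ l → conj (b i l) * v l * b i k)
        ≈⟨ ∑.sum-cong-≋ (λ i → ∑.*-distribʳ-sum (b i k) (λ l → conj (b i l) * v l)) ⟨
      (sum λ i → ⟨ b i , v ⟩ * b i k) ∎
  }
  where open import Relation.Binary.Reasoning.Setoid ℂᵣ.setoid

-- Checking a square by integer arithmetic

scalar : ∀ {m} → ℤ → Fin m → Fin m → ℤ[i]
scalar N i j = if does (i Fin.≟ j) then (N , 0ℤ) else 0ᵍ

Orthonormal : ℤ → ∀ {n} → (Fin n → Fin n → ℤ[i]) → Set
Orthonormal N b = ∀ i j → herm (b i) (b j) ≡ scalar N i j

infix 4 _≟ᵍ_

_≟ᵍ_ : (x y : ℤ[i]) → Dec (x ≡ y)
(a , b) ≟ᵍ (c , d) = map′ (λ (p , q) → cong₂ _,_ p q) (λ eq → cong proj₁ eq , cong proj₂ eq)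
  (a ℤ.≟ c ×-dec b ℤ.≟ d)

orthonormal? : ∀ N {n} (b : Fin n → Fin n → ℤ[i]) → Dec (Orthonormal N b)
orthonormal? N b = all? λ i → all? λ j → herm (b i) (b j) ≟ᵍ scalar N i j

-- Some 2 × 2 minor of the pair does not vanish, so the vectors are not proportional.
Distinct : ∀ {n} → (Fin n → ℤ[i]) → (Fin n → ℤ[i]) → Set
Distinct u v = ∃₂ λ k l → u k *ᵍ v l ≢ u l *ᵍ v k

distinct? : ∀ {n} (u v : Fin n → ℤ[i]) → Dec (Distinct u v)
distinct? u v = any? λ k → any? λ l → ¬? (u k *ᵍ v l ≟ᵍ u l *ᵍ v k)

-- A vector u of Gaussian integers with ⟨ u , u ⟩ = D² stands for the unit
-- vector u / D.
module Scaled (D : ℕ) .{{_ : ℕ.NonZero D}} where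

  s : ℚ
  s = + 1 ℚ./ D

  N : ℤ
  N = + (D ℕ.* D)

  s²N≡1 : s ℚ.* s ℚ.* fromℤ N ≡ 1ℚ
  s²N≡1 = begin
    s ℚ.* s ℚ.* fromℤ N                  ≡⟨ cong (s ℚ.* s ℚ.*_) (trans (fromℤ≡fromℕ (D ℕ.* D)) (fromℕ-* D D)) ⟩
    s ℚ.* s ℚ.* (fromℕ D ℚ.* fromℕ D)    ≡⟨ solve 2 (λ s d → s :* s :* (d :* d) := (s :* d) :* (s :* d)) refl s (fromℕ D) ⟩
    (s ℚ.* fromℕ D) ℚ.* (s ℚ.* fromℕ D)  ≡⟨ cong₂ ℚ._*_ (1/n*n≡1 D) (1/n*n≡1 D) ⟩
    1ℚ ℚ.* 1ℚ                            ≡⟨ ℚ.*-identityˡ 1ℚ ⟩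
    1ℚ                                   ∎
    where open +-*-Solver
          open ≡-Reasoning

  ι : ℤ[i] → ℂ
  ι (a , b) = fromℚ (s ℚ.* fromℤ a) +i fromℚ (s ℚ.* fromℤ b)

  at-conj-* : ∀ n x y → at n (conj (ι x) * ι y) ≡ κ (s ℚ.* s) ⊗ J (conjᵍ x *ᵍ y)
  at-conj-* n x@(a , b) y@(c , d) = trans
    (cong₂ _,_
      (solve 5 (λ s a b c d → s :* a :* (s :* c) :- (:- (s :* b)) :* (s :* d) :=
        s :* s :* (a :* c :- (:- b) :* d) :- con 0ℚ :* (a :* d :+ (:- b) :* c)) refl
        s (fromℤ a) (fromℤ b) (fromℤ c) (fromℤ d))
      (solve 5 (λ s a b c d → s :* a :* (s :* d) :+ (:- (s :* b)) :* (s :* c) :=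
        s :* s :* (a :* d :+ (:- b) :* c) :+ con 0ℚ :* (a :* c :- (:- b) :* d)) refl
        s (fromℤ a) (fromℤ b) (fromℤ c) (fromℤ d)))
    (cong (κ (s ℚ.* s) ⊗_) (sym (trans (J-* (conjᵍ x) y) (cong (_⊗ J y) (J-conj x)))))
    where open +-*-Solver

  at-* : ∀ n x y → at n (ι x * ι y) ≡ κ (s ℚ.* s) ⊗ J (x *ᵍ y)
  at-* n x@(a , b) y@(c , d) = trans
    (cong₂ _,_
      (solve 5 (λ s a b c d → s :* a :* (s :* c) :- s :* b :* (s :* d) :=
        s :* s :* (a :* c :- b :* d) :- con 0ℚ :* (a :* d :+ b :* c)) refl
        s (fromℤ a) (fromℤ b) (fromℤ c) (fromℤ d))
      (solve 5 (λ s a b c d → s :* a :* (s :* d) :+ s :* b :* (s :* c) :=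
        s :* s :* (a :* d :+ b :* c) :+ con 0ℚ :* (a :* c :- b :* d)) refl
        s (fromℤ a) (fromℤ b) (fromℤ c) (fromℤ d)))
    (cong (κ (s ℚ.* s) ⊗_) (sym (J-* x y)))
    where open +-*-Solver

  at-⟨⟩ : ∀ n {m} (u v : Fin m → ℤ[i]) → at n ⟨ ι ∘ u , ι ∘ v ⟩ ≡ κ (s ℚ.* s) ⊗ J (herm u v)
  at-⟨⟩ n {zero} u v = sym (C.zeroʳ (κ (s ℚ.* s)))
  at-⟨⟩ n {suc m} u v = trans
    (cong₂ _⊕_ (at-conj-* n (u zero) (v zero)) (at-⟨⟩ n (u ∘ suc) (v ∘ suc)))
    (trans (sym (C.distribˡ (κ (s ℚ.* s)) (J (conjᵍ (u zero) *ᵍ v zero)) (J (herm (u ∘ suc) (v ∘ suc)))))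
      (cong (κ (s ℚ.* s) ⊗_) (sym (J-+ (conjᵍ (u zero) *ᵍ v zero) (herm (u ∘ suc) (v ∘ suc))))))

  ⟨⟩≈1 : ∀ {m} (u v : Fin m → ℤ[i]) → herm u v ≡ (N , 0ℤ) → ⟨ ι ∘ u , ι ∘ v ⟩ ≈ 1ℂ
  ⟨⟩≈1 u v eq = ≈-pointwise λ n → trans (at-⟨⟩ n u v) (trans (cong (λ x → κ (s ℚ.* s) ⊗ J x) eq)
    (trans (κ-* (s ℚ.* s) (fromℤ N)) (cong κ s²N≡1)))

  ⟨⟩≈0 : ∀ {m} (u v : Fin m → ℤ[i]) → herm u v ≡ 0ᵍ → ⟨ ι ∘ u , ι ∘ v ⟩ ≈ 0ℂ
  ⟨⟩≈0 u v eq = ≈-pointwise λ n → trans (at-⟨⟩ n u v) (trans (cong (λ x → κ (s ℚ.* s) ⊗ J x) eq)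
    (C.zeroʳ (κ (s ℚ.* s))))

  orthonormal⇒unit : ∀ {m} {b : Fin m → Fin m → ℤ[i]} → Orthonormal N b → ∀ i → IsUnit (ι ∘ b i)
  orthonormal⇒unit {b = b} h i = ⟨⟩≈1 (b i) (b i) (trans (h i i)
    (cong (λ d → if d then (N , 0ℤ) else 0ᵍ) (dec-true (i Fin.≟ i) refl)))

  orthonormal⇒orthogonal : ∀ {m} {b : Fin m → Fin m → ℤ[i]} → Orthonormal N b →
                           ∀ i j → i ≢ j → ⟨ ι ∘ b i , ι ∘ b j ⟩ ≈ 0ℂ
  orthonormal⇒orthogonal {b = b} h i j i≢j = ⟨⟩≈0 (b i) (b j) (trans (h i j)
    (cong (λ d → if d then (N , 0ℤ) else 0ᵍ) (dec-false (i Fin.≟ j) i≢j)))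

  orthonormal⇒basis : ∀ {m} {b : Fin m → Fin m → ℤ[i]} → Orthonormal N b → Orthonormal N (flip b) →
                      IsOrthonormalBasis (λ i → ι ∘ b i)
  orthonormal⇒basis h hᵀ = unitary⇒basis (orthonormal⇒unit h) (orthonormal⇒orthogonal h)
    (orthonormal⇒unit hᵀ) (orthonormal⇒orthogonal hᵀ)

  κs²-cancel : ∀ {x y} → κ (s ℚ.* s) ⊗ x ≡ κ (s ℚ.* s) ⊗ y → x ≡ y
  κs²-cancel {x} {y} eq = trans (sym (undo x)) (trans (cong (κ (fromℤ N) ⊗_) eq) (undo y))
    where
    undo : ∀ z → κ (fromℤ N) ⊗ (κ (s ℚ.* s) ⊗ z) ≡ z
    undo z = trans (sym (C.*-assoc (κ (fromℤ N)) (κ (s ℚ.* s)) z)) (trans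
      (cong (_⊗ z) (trans (C.*-comm (κ (fromℤ N)) (κ (s ℚ.* s))) (trans (κ-* (s ℚ.* s) (fromℤ N)) (cong κ s²N≡1))))
      (C.*-identityˡ z))

  ι*ι-injective : ∀ x y z w → ι x * ι y ≈ ι z * ι w → x *ᵍ y ≡ z *ᵍ w
  ι*ι-injective x y z w eq = J-injective (κs²-cancel
    (at-injective {ι x * ι y} {ι z * ι w} (λ n → at-* n x y) (λ n → at-* n z w) eq))

  -- If u = w v, then u k · v l = w · v k · v l = u l · v k, so every minor vanishes, exactly and
  -- already over the Gaussian integers.
  distinct⇒≁ : ∀ {m} {u v : Fin m → ℤ[i]} → Distinct u v → ¬ (ι ∘ u ∼ ι ∘ v)
  distinct⇒≁ {u = u} {v} (k , l , ≢) (_ , w , _ , u≈wv) = ≢ (ι*ι-injective (u k) (v l) (u l) (v k) (begin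
    ι (u k) * ι (v l)        ≈⟨ ℂᵣ.*-congʳ (u≈wv k) ⟩
    w * ι (v k) * ι (v l)    ≈⟨ ℂᵣ.*-assoc w (ι (v k)) (ι (v l)) ⟩
    w * (ι (v k) * ι (v l))  ≈⟨ ℂᵣ.*-congˡ (ℂᵣ.*-comm (ι (v k)) (ι (v l))) ⟩
    w * (ι (v l) * ι (v k))  ≈⟨ ℂᵣ.*-assoc w (ι (v l)) (ι (v k)) ⟨
    w * ι (v l) * ι (v k)    ≈⟨ ℂᵣ.*-congʳ (u≈wv l) ⟨
    ι (u l) * ι (v k)        ∎))
    where open import Relation.Binary.Reasoning.Setoid ℂᵣ.setoid

  module _ {n c} .{{_ : ℕ.NonZero c}} (rays : Vec (Vec ℤ[i] n) c) (table : Vec (Vec ℕ n) n) where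

    ray : Fin c → Fin n → ℤ[i]
    ray p k = lookup (lookup rays p) k

    -- Reducing modulo `c` only turns numerals into elements of `Fin c`; the tables below contain no
    -- number as large as `c`.
    class : Fin n × Fin n → Fin c
    class (i , j) = lookup (lookup table i) j mod c

    cell : Fin n → Fin n → Fin n → ℤ[i]
    cell i j = ray (class (i , j))

    Unitary : (Fin n → Fin n → ℤ[i]) → Set
    Unitary b = Orthonormal N b × Orthonormal N (flip b)

    unitary? : ∀ b → Dec (Unitary b)
    unitary? b = orthonormal? N b ×-dec orthonormal? N (flip b)

    Valid : Set
    Valid = (∀ i → Unitary (cell i)) × (∀ j → Unitary (flip cell j))
          × (∀ p q → p ≡ q ⊎ Distinct (ray p) (ray q))
          × (∀ p → ∃₂ λ i j → class (i , j) ≡ p)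

    valid? : Dec Valid
    valid? = all? (λ i → unitary? (cell i)) ×-dec all? (λ j → unitary? (flip cell j))
       ×-dec all? (λ p → all? λ q → p Fin.≟ q ⊎-dec distinct? (ray p) (ray q))
       ×-dec all? (λ p → any? λ i → any? λ j → class (i , j) Fin.≟ p)

    square : Valid → QLS n
    square (rows , columns , _) = record
      { entry  = λ i j → ι ∘ cell i j
      ; unit   = λ i → orthonormal⇒unit (proj₁ (rows i))
      ; row    = λ i → orthonormal⇒basis (proj₁ (rows i)) (proj₂ (rows i))
      ; column = λ j → orthonormal⇒basis (proj₁ (columns j)) (proj₂ (columns j))
      }

    square-cardinality : (v : Valid) → HasCardinality (square v) c
    square-cardinality v@(_ , _ , distinct , hits) =
      class , (λ {x} {y} → class-cong {x} {y}) , (λ {x} {y} → class-inj {x} {y}) , class-surj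
      where
      class-cong : ∀ {x y} → EntryEquiv (square v) x y → class x ≡ class y
      class-cong {x} {y} x∼y = [ (λ eq → eq) , (λ ≢ → contradiction x∼y (distinct⇒≁ {u = ray (class x)} {v = ray (class y)} ≢)) ]′
        (distinct (class x) (class y))
      class-inj : ∀ {x y} → class x ≡ class y → EntryEquiv (square v) x y
      -- Equal classes refer to the same stored vector, so the factor 1 with angle 0 relates the
      -- entries.
      class-inj {x} {y} eq = 0ℝ , 1ℂ , cis≈⇒≈exp cis-0 , λ k → ℂᵣ.trans
        (ℂᵣ.reflexive (cong (λ p → ι (ray p k)) eq)) (ℂᵣ.sym (ℂᵣ.*-identityˡ (ι (ray (class y) k))))
      class-surj : ∀ p → ∃ λ x → ∀ {y} → EntryEquiv (square v) y x → class y ≡ p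
      class-surj p = let i , j , eq = hits p in (i , j) , λ {y} y∼x → trans (class-cong {y} {i , j} y∼x) eq

    -- The implicit argument is filled by evaluating `valid?`, so that type checking a square below
    -- amounts to verifying it.
    realize : {valid : True valid?} → ∃ λ (Φ : QLS n) → HasCardinality Φ c
    realize {valid} = square (toWitness valid) , square-cardinality (toWitness valid)

-- The squares

six : ∀ {A : Set} → A → A → A → A → A → A → Vec A 6
six a b c d e f = a ∷ b ∷ c ∷ d ∷ e ∷ f ∷ []

infix 8 −_

−_ : ℕ → ℤ
− n = ℤ.- (+ n)

-- Named by compass direction, with north along the imaginary axis.
o e n w s ne nw sw se ee nn ww ss : ℤ[i]
o  = + 0 , + 0
e  = + 1 , + 0
n  = + 0 , + 1
w  = − 1 , + 0
s  = + 0 , − 1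
ne = + 1 , + 1
nw = − 1 , + 1
sw = − 1 , − 1
se = + 1 , − 1
ee = + 2 , + 0
nn = + 0 , + 2
ww = − 2 , + 0
ss = + 0 , − 2

real : ∀ {n} → Vec ℤ n → Vec ℤ[i] n
real = Vec.map (_, 0ℤ)

-- A classical Latin square: six rays in dimension 6 leave room for only one basis, which every row
-- and column permutes.
square₆ : ∃ λ (Φ : QLS 6) → HasCardinality Φ 6
square₆ = Scaled.realize 2
  (six o e w e w o
  ∷ six e e o o e w
  ∷ six e o w w o e
  ∷ six o e e w w o
  ∷ six e w o o w w
  ∷ six e o e e o e ∷ [])
  (six (six 0 1 2 3 4 5)
       (six 3 2 1 5 0 4)
       (six 5 0 3 4 1 2)
       (six 1 4 0 2 5 3)
       (six 4 3 5 1 2 0)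
       (six 2 5 4 0 3 1))

square₈ : ∃ λ (Φ : QLS 6) → HasCardinality Φ 8
square₈ = Scaled.realize 2
  (six e o o n s e
  ∷ six o e w s o e
  ∷ six o ne ne o o o
  ∷ six o e w n o w
  ∷ six e o o s s w
  ∷ six ne o o o nw o
  ∷ six e n n o n o
  ∷ six e s s o n o ∷ [])
  (six (six 0 1 2 3 4 5)
       (six 6 7 4 1 3 0)
       (six 4 3 5 0 2 1)
       (six 1 4 3 5 0 2)
       (six 3 0 1 2 5 4)
       (six 7 6 0 4 1 3))

square₉ : ∃ λ (Φ : QLS 6) → HasCardinality Φ 9
square₉ = Scaled.realize 2
  (six e o e o e s
  ∷ six o e o n w s
  ∷ six o ne o se o o
  ∷ six e o e o w n
  ∷ six ne o sw o o o
  ∷ six o e o n e n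
  ∷ six o e o e n w
  ∷ six o e o e s e
  ∷ six o ne o sw o o ∷ [])
  (six (six 0 1 2 3 4 5)
       (six 6 3 0 7 8 4)
       (six 4 5 1 0 3 2)
       (six 8 0 4 6 7 3)
       (six 3 2 5 4 0 1)
       (six 7 4 3 8 6 0))

square₁₀ : ∃ λ (Φ : QLS 6) → HasCardinality Φ 10
square₁₀ = Scaled.realize 2
  (six o o o o ne ne
  ∷ six o e o e e w
  ∷ six ne o nw o o o
  ∷ six o ne o sw o o
  ∷ six ne o se o o o
  ∷ six o e o e w e
  ∷ six e o n o w w
  ∷ six e o n o e e
  ∷ six o e o e n s
  ∷ six o e o e s n ∷ [])
  (six (six 0 1 2 3 4 5)
       (six 3 6 4 7 5 1)
       (six 4 5 3 1 7 6)
       (six 2 3 0 5 1 4)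
       (six 8 4 9 6 3 7)
       (six 9 7 8 4 6 3))

square₁₁ : ∃ λ (Φ : QLS 6) → HasCardinality Φ 11
square₁₁ = Scaled.realize 2
  (six o o o ee o o
  ∷ six e o n o s w
  ∷ six e o s o n w
  ∷ six ne o o o o ne
  ∷ six o o ne o ne o
  ∷ six o ee o o o o
  ∷ six e s o e o e
  ∷ six e n o w o e
  ∷ six ne o o o o sw
  ∷ six o ne o se o o
  ∷ six o o ne o sw o ∷ [])
  (six (six 0 1 2 3 4 5)
       (six 3 4 1 5 2 0)
       (six 4 6 7 8 9 10)
       (six 8 7 9 10 6 4)
       (six 5 2 4 0 1 3)
       (six 10 9 6 4 7 8))

square₁₂ : ∃ λ (Φ : QLS 6) → HasCardinality Φ 12
square₁₂ = Scaled.realize 2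
  (six e w o o n n
  ∷ six e w o o s s
  ∷ six e e n w o o
  ∷ six o o ne se o o
  ∷ six e e s e o o
  ∷ six o o o o ne sw
  ∷ six e e w s o o
  ∷ six o o e s e w
  ∷ six o o e s w e
  ∷ six e w o o w w
  ∷ six e w o o e e
  ∷ six e e e n o o ∷ [])
  (six (six 0 1 2 3 4 5)
       (six 5 0 4 2 3 1)
       (six 6 7 8 9 10 11)
       (six 11 6 9 10 5 3)
       (six 1 8 7 4 2 0)
       (six 3 11 10 5 9 6))

square₁₃ : ∃ λ (Φ : QLS 6) → HasCardinality Φ 13
square₁₃ = Scaled.realize 2
  (six o o ne se o o
  ∷ six e o e n n o
  ∷ six o ne o o o sw
  ∷ six o ne o o o ne
  ∷ six ne o o o se o
  ∷ six e o w s n o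
  ∷ six o e e s o e
  ∷ six o e w n o e
  ∷ six o e n w o w
  ∷ six ne o o o nw o
  ∷ six o e s e o w
  ∷ six e o s e s o
  ∷ six e o n w s o ∷ [])
  (six (six 0 1 2 3 4 5)
       (six 4 5 6 2 7 1)
       (six 8 3 9 0 10 4)
       (six 3 0 11 12 9 2)
       (six 10 4 7 9 8 6)
       (six 9 2 12 11 6 7))

square₁₄ : ∃ λ (Φ : QLS 6) → HasCardinality Φ 14
square₁₄ = Scaled.realize 2
  (six o e s n n o
  ∷ six e o w w o n
  ∷ six e s o o w s
  ∷ six e o e e o n
  ∷ six e n o o e s
  ∷ six o e n s n o
  ∷ six e o n n o n
  ∷ six o ne o o se o
  ∷ six ne o o o o se
  ∷ six e o s s o n
  ∷ six o ne o o nw o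
  ∷ six o o ne sw o o
  ∷ six e w o o n s
  ∷ six e e o o s s ∷ [])
  (six (six 0 1 2 3 4 5)
       (six 6 7 5 8 0 9)
       (six 9 10 4 11 2 6)
       (six 5 8 9 7 6 0)
       (six 12 3 0 1 5 13)
       (six 13 11 6 10 9 12))

square₁₅ : ∃ λ (Φ : QLS 6) → HasCardinality Φ 15
square₁₅ = Scaled.realize 2
  (six n e o o ne o
  ∷ six e n w e o o
  ∷ six o o ne ne o o
  ∷ six e n e w o o
  ∷ six s w o o ne o
  ∷ six o o o o o ee
  ∷ six e n w w o o
  ∷ six o o o o ee o
  ∷ six o o ne sw o o
  ∷ six e n e e o o
  ∷ six ne se o o o o
  ∷ six o o s n o ne
  ∷ six w s o o ne o
  ∷ six o o n s o ne
  ∷ six e n o o ne o ∷ [])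
  (six (six 0 1 2 3 4 5)
       (six 6 7 8 5 9 10)
       (six 4 3 5 1 0 2)
       (six 11 2 12 10 13 14)
       (six 13 10 14 2 11 12)
       (six 9 5 10 7 6 8))

square₁₆ : ∃ λ (Φ : QLS 6) → HasCardinality Φ 16
square₁₆ = Scaled.realize 2
  (six o ne o o se o
  ∷ six ne o o se o o
  ∷ six e s o n e o
  ∷ six e n o n w o
  ∷ six o o ne o o ne
  ∷ six o o ne o o sw
  ∷ six o e e o n e
  ∷ six e o e n o w
  ∷ six e e o s s o
  ∷ six e w o s n o
  ∷ six e o w n o e
  ∷ six o e w o n w
  ∷ six o o ne o o nw
  ∷ six o o ne o o se
  ∷ six o ne o o nw o
  ∷ six ne o o nw o o ∷ [])
  (six (six 0 1 2 3 4 5)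
       (six 6 7 8 9 10 11)
       (six 11 10 9 8 7 6)
       (six 5 4 3 2 9 8)
       (six 1 0 12 13 14 15)
       (six 15 14 13 12 8 9))

square₁₇ : ∃ λ (Φ : QLS 6) → HasCardinality Φ 17
square₁₇ = Scaled.realize 2
  (six e o e o s s
  ∷ six e e o n n o
  ∷ six e o w o s n
  ∷ six e w o s n o
  ∷ six o ne o se o o
  ∷ six o o ne o o nw
  ∷ six e o w o n s
  ∷ six e o e o n n
  ∷ six o o ne o o se
  ∷ six o ne o nw o o
  ∷ six ne o o o se o
  ∷ six o ne o ne o o
  ∷ six e o s o s e
  ∷ six o ne o sw o o
  ∷ six e o n o s w
  ∷ six e o w o n n
  ∷ six e o e o n s ∷ [])
  (six (six 0 1 2 3 4 5)
       (six 2 3 0 1 5 4)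
       (six 6 4 7 8 9 10)
       (six 11 12 13 14 15 16)
       (six 13 14 11 12 16 15)
       (six 7 8 6 4 10 9))

-- The first three rows consist of eighteen different rays, and each of the last three rows
-- rearranges one of them.
square₁₈ : ∃ λ (Φ : QLS 6) → HasCardinality Φ 18
square₁₈ = Scaled.realize 2
  (six o e o w w e
  ∷ six o e o e w w
  ∷ six o e o e e e
  ∷ six ee o o o o o
  ∷ six o e o w e w
  ∷ six o o ee o o o
  ∷ six e e e o e o
  ∷ six e w e o w o
  ∷ six e e w o w o
  ∷ six o o o o o ee
  ∷ six e w w o e o
  ∷ six o o o ee o o
  ∷ six e o w w o w
  ∷ six e o w e o e
  ∷ six e o e w o e
  ∷ six o o o o ee o
  ∷ six e o e e o w
  ∷ six o ee o o o o ∷ [])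
  (six (six 0 1 2 3 4 5)
       (six 6 7 8 9 10 11)
       (six 12 13 14 15 16 17)
       (six 1 0 4 5 2 3)
       (six 7 6 10 11 8 9)
       (six 13 12 16 17 14 15))

square₁₉ : ∃ λ (Φ : QLS 6) → HasCardinality Φ 19
square₁₉ = Scaled.realize 2
  (six o o o ne sw o
  ∷ six e s s o o e
  ∷ six o w ne o o e
  ∷ six ne w o o o w
  ∷ six e e n o o s
  ∷ six o o o ne ne o
  ∷ six e ne w o o o
  ∷ six s o s o o ne
  ∷ six n o n o o ne
  ∷ six w ne e o o o
  ∷ six o o o ne se o
  ∷ six o o o ne nw o
  ∷ six e o e o o ne
  ∷ six e n s o o w
  ∷ six ne e o o o e
  ∷ six o e ne o o w
  ∷ six e w n o o n
  ∷ six n ne s o o o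
  ∷ six s ne n o o o ∷ [])
  (six (six 0 1 2 3 4 5)
       (six 6 5 7 8 9 0)
       (six 9 4 10 11 12 13)
       (six 5 0 14 15 13 16)
       (six 8 3 11 17 10 15)
       (six 7 2 18 10 11 14))

square₂₀ : ∃ λ (Φ : QLS 6) → HasCardinality Φ 20
square₂₀ = Scaled.realize 2
  (six n o o o e ne
  ∷ six s o ne o e o
  ∷ six e o e o w n
  ∷ six o ee o o o o
  ∷ six o o o ee o o
  ∷ six e o s o e w
  ∷ six ne o w o o w
  ∷ six o ne o ne o o
  ∷ six o ne o sw o o
  ∷ six o o s o ne n
  ∷ six e o e o e s
  ∷ six e o s o w e
  ∷ six ne o e o o e
  ∷ six e o w o e n
  ∷ six o o n o ne s
  ∷ six e o n o w w
  ∷ six n o ne o w o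
  ∷ six s o o o w ne
  ∷ six e o w o w s
  ∷ six e o n o e e ∷ [])
  (six (six 0 1 2 3 4 5)
       (six 6 7 8 9 10 11)
       (six 3 12 13 14 15 4)
       (six 16 17 18 4 3 19)
       (six 14 8 7 12 13 15)
       (six 4 9 10 6 11 3))

square₂₁ : ∃ λ (Φ : QLS 6) → HasCardinality Φ 21
square₂₁ = Scaled.realize 2
  (six o e ne o s o
  ∷ six o w o o s ne
  ∷ six o e s o e e
  ∷ six o o o ee o o
  ∷ six ee o o o o o
  ∷ six o e w o w n
  ∷ six o e o o n ne
  ∷ six o o e o ne w
  ∷ six o ne s o o s
  ∷ six o ne w o o w
  ∷ six o o n o ne s
  ∷ six o e e o w s
  ∷ six o e s o w w
  ∷ six o ne n o o n
  ∷ six o e w o e s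
  ∷ six o e n o e w
  ∷ six o ne e o o e
  ∷ six o o s o ne n
  ∷ six o e n o w e
  ∷ six o o w o ne e
  ∷ six o e e o e n ∷ [])
  (six (six 0 1 2 3 4 5)
       (six 6 0 4 7 8 3)
       (six 4 2 3 9 10 11)
       (six 7 3 12 4 13 14)
       (six 3 5 15 16 17 4)
       (six 8 4 18 19 3 20))

square₂₂ : ∃ λ (Φ : QLS 6) → HasCardinality Φ 22
square₂₂ = Scaled.realize 2
  (six e w o o n s
  ∷ six o o ne se o o
  ∷ six e s o o s w
  ∷ six e n o o s e
  ∷ six o o ne nw o o
  ∷ six e e o o n n
  ∷ six o o ne sw o o
  ∷ six e s o o e s
  ∷ six e n o o w s
  ∷ six e s o o w n
  ∷ six e n o o e n
  ∷ six o o ne ne o o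
  ∷ six e w o o s n
  ∷ six e n o o n w
  ∷ six o o ee o o o
  ∷ six o o o ee o o
  ∷ six e s o o n e
  ∷ six e e o o s s
  ∷ six e e o o w w
  ∷ six e w o o w e
  ∷ six e e o o e e
  ∷ six e w o o e w ∷ [])
  (six (six 0 1 2 3 4 5)
       (six 6 7 8 9 10 11)
       (six 12 13 14 15 16 17)
       (six 18 4 10 7 1 19)
       (six 20 9 15 14 8 21)
       (six 11 3 16 13 2 6))

square₂₃ : ∃ λ (Φ : QLS 6) → HasCardinality Φ 23
square₂₃ = Scaled.realize 2
  (six o e ne o s o
  ∷ six o w o o s ne
  ∷ six o e s o e e
  ∷ six ne o o sw o o
  ∷ six ne o o ne o o
  ∷ six o e w o w n
  ∷ six o e o o n ne
  ∷ six ee o o o o o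
  ∷ six o o e o ne w
  ∷ six o ne s o o s
  ∷ six o o o ee o o
  ∷ six o ne w o o w
  ∷ six o o n o ne s
  ∷ six o e e o w s
  ∷ six o e s o w w
  ∷ six o ne n o o n
  ∷ six o e w o e s
  ∷ six o e n o e w
  ∷ six o ne e o o e
  ∷ six o o s o ne n
  ∷ six o e n o w e
  ∷ six o o w o ne e
  ∷ six o e e o e n ∷ [])
  (six (six 0 1 2 3 4 5)
       (six 6 0 7 8 9 10)
       (six 7 2 10 11 12 13)
       (six 8 3 14 4 15 16)
       (six 10 5 17 18 19 7)
       (six 9 4 20 21 3 22))

square₂₄ : ∃ λ (Φ : QLS 6) → HasCardinality Φ 24
square₂₄ = Scaled.realize 2
  (six o e s w n o
  ∷ six o e s e s o
  ∷ six o o o ne nw o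
  ∷ six ne o o o o sw
  ∷ six e e n o o e
  ∷ six e w s o o e
  ∷ six o e e n s o
  ∷ six ne o o o o nw
  ∷ six e s n o o s
  ∷ six o e e s n o
  ∷ six e n s o o s
  ∷ six o o o ne ne o
  ∷ six o e w s s o
  ∷ six ne o o o o se
  ∷ six e s s o o n
  ∷ six o e w n n o
  ∷ six o o o ne sw o
  ∷ six e n n o o n
  ∷ six o e n e n o
  ∷ six o e n w s o
  ∷ six o o o ne se o
  ∷ six ne o o o o ne
  ∷ six e w n o o w
  ∷ six e e s o o w ∷ [])
  (six (six 0 1 2 3 4 5)
       (six 6 7 8 9 10 11)
       (six 12 13 14 15 16 17)
       (six 18 19 20 21 22 23)
       (six 13 15 17 12 14 16)
       (six 7 9 10 6 11 8))

square₂₅ : ∃ λ (Φ : QLS 6) → HasCardinality Φ 25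
square₂₅ = Scaled.realize 2
  (six o o ne o o nw
  ∷ six o ne o o ne o
  ∷ six ee o o o o o
  ∷ six o o e ne o s
  ∷ six o ne o o sw o
  ∷ six o o w ne o n
  ∷ six o o s ne o e
  ∷ six e o s w o s
  ∷ six ne o w o o n
  ∷ six e o e e o w
  ∷ six o o n ne o e
  ∷ six e o w s o e
  ∷ six ne o n o o w
  ∷ six e o s n o s
  ∷ six o o s ne o w
  ∷ six e o n n o n
  ∷ six e o e s o w
  ∷ six ne o s o o e
  ∷ six o o w ne o s
  ∷ six o o ne o o se
  ∷ six o o e ne o n
  ∷ six ne o e o o s
  ∷ six o o n ne o w
  ∷ six e o w e o e
  ∷ six e o n w o n ∷ [])
  (six (six 0 1 2 3 4 5)
       (six 1 4 6 7 8 9)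
       (six 10 11 4 12 13 1)
       (six 14 15 1 4 16 17)
       (six 2 18 19 1 20 4)
       (six 4 21 22 23 1 24))

square₂₆ : ∃ λ (Φ : QLS 6) → HasCardinality Φ 26
square₂₆ = Scaled.realize 2
  (six o o o ne e w
  ∷ six o o ne o s s
  ∷ six o o e n o ne
  ∷ six o o e s ne o
  ∷ six ee o o o o o
  ∷ six o ee o o o o
  ∷ six o o e w n e
  ∷ six o o e e n w
  ∷ six o o ne o se o
  ∷ six o o o ne o ne
  ∷ six o o e w s w
  ∷ six o o e e s e
  ∷ six o o ne o nw o
  ∷ six o o o ne o sw
  ∷ six o o e e w s
  ∷ six o o e w w n
  ∷ six o o o ne o nw
  ∷ six o o ne o ne o
  ∷ six o o ne o n n
  ∷ six o o o ne w e
  ∷ six o o w n ne o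
  ∷ six o o w s o ne
  ∷ six o o e e e n
  ∷ six o o e w e s
  ∷ six o o o ne o se
  ∷ six o o ne o sw o ∷ [])
  (six (six 0 1 2 3 4 5)
       (six 4 6 7 5 8 9)
       (six 10 5 4 11 12 13)
       (six 14 4 5 15 16 17)
       (six 18 19 20 21 5 4)
       (six 5 22 23 4 24 25))

square₂₇ : ∃ λ (Φ : QLS 6) → HasCardinality Φ 27
square₂₇ = Scaled.realize 2
  (six o o ne o se o
  ∷ six o ee o o o o
  ∷ six w o o ne o n
  ∷ six ne o o o o nw
  ∷ six e o o ne o s
  ∷ six o o ne o nw o
  ∷ six o ne o ne o o
  ∷ six o o ee o o o
  ∷ six ne o o o o se
  ∷ six o o o o ee o
  ∷ six o ne o sw o o
  ∷ six ne o o o o ne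
  ∷ six e s o e o w
  ∷ six o ne o se o o
  ∷ six e n o w o w
  ∷ six e s o n o w
  ∷ six n o o ne o e
  ∷ six e ne o o o n
  ∷ six e w o w o e
  ∷ six e w o n o e
  ∷ six o ne o nw o o
  ∷ six e e o s o e
  ∷ six ne o o o o sw
  ∷ six e n o s o w
  ∷ six s o o ne o w
  ∷ six w ne o o o s
  ∷ six e e o e o e ∷ [])
  (six (six 0 1 2 3 4 5)
       (six 6 3 7 8 9 10)
       (six 11 5 12 13 14 0)
       (six 15 16 17 9 7 18)
       (six 5 0 19 20 21 22)
       (six 23 24 9 7 25 26))

square₂₈ : ∃ λ (Φ : QLS 6) → HasCardinality Φ 28
square₂₈ = Scaled.realize 2
  (six ne o o o sw o
  ∷ six o ne o nw o o
  ∷ six o e n s o e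
  ∷ six o e s s o w
  ∷ six e o n o e w
  ∷ six e o s o e e
  ∷ six o o o ne o se
  ∷ six o o ne o se o
  ∷ six e e s o e o
  ∷ six e e n o w o
  ∷ six e w o s o e
  ∷ six e w o n o w
  ∷ six o ee o o o o
  ∷ six ee o o o o o
  ∷ six o o o ne o nw
  ∷ six o o ne o nw o
  ∷ six e w n o e o
  ∷ six e w s o w o
  ∷ six e e o n o e
  ∷ six e e o s o w
  ∷ six ne o o o ne o
  ∷ six o ne o se o o
  ∷ six o e n n o w
  ∷ six o e s n o e
  ∷ six e o s o w w
  ∷ six e o n o w e
  ∷ six o o ee o o o
  ∷ six o o o o o ee ∷ [])
  (six (six 0 1 2 3 4 5)
       (six 6 7 8 9 10 11)
       (six 12 13 6 14 15 7)
       (six 14 15 16 17 18 19)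
       (six 20 21 22 23 24 25)
       (six 26 27 0 20 21 1))

square₃₀ : ∃ λ (Φ : QLS 6) → HasCardinality Φ 30
square₃₀ = Scaled.realize 2
  (six ne o o ne o o
  ∷ six o e e o w w
  ∷ six o e w o s n
  ∷ six o e e o e e
  ∷ six o e w o n s
  ∷ six ne o o sw o o
  ∷ six o o o o o ee
  ∷ six e o e s e o
  ∷ six e o w w n o
  ∷ six e o e n w o
  ∷ six e o w e s o
  ∷ six o ee o o o o
  ∷ six o o ne o ne o
  ∷ six e n o n o n
  ∷ six e s o e o w
  ∷ six e n o s o s
  ∷ six e s o w o e
  ∷ six o o ne o sw o
  ∷ six e s o n o s
  ∷ six e n o e o e
  ∷ six e s o s o n
  ∷ six e n o w o w
  ∷ six e o w s w o
  ∷ six e o e w s o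
  ∷ six e o w n e o
  ∷ six e o e e n o
  ∷ six o e w o e w
  ∷ six o e e o n n
  ∷ six o e w o w e
  ∷ six o e e o s s ∷ [])
  (six (six 0 1 2 3 4 5)
       (six 6 7 8 9 10 11)
       (six 12 13 14 15 16 17)
       (six 17 18 19 20 21 12)
       (six 11 22 23 24 25 6)
       (six 5 26 27 28 29 0))

-- Every vector consists of three blocks of two coordinates. Up to powers of i, each block is one of
-- (3 + i, 1 - i), (1 + i, -3 + i), (2, -2 - 2i), (2 + 2i, 2i), which form two mutually unbiased
-- bases of ℂ². Each block has squared norm 12, and 3 · 12 = 6².
square₃₁ : ∃ λ (Φ : QLS 6) → HasCardinality Φ 31
square₃₁ = Scaled.realize 6
  (six (+ 3 , + 1) (+ 1 , − 1) (+ 3 , + 1) (+ 1 , − 1) (+ 3 , + 1) (+ 1 , − 1)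
  ∷ six (+ 1 , + 1) (− 3 , + 1) (+ 1 , − 1) (+ 1 , + 3) (− 1 , − 1) (+ 3 , − 1)
  ∷ six (+ 3 , + 1) (+ 1 , − 1) (− 2 , + 0) (+ 2 , + 2) (+ 0 , − 2) (− 2 , + 2)
  ∷ six (+ 1 , + 1) (− 3 , + 1) (− 2 , − 2) (+ 0 , − 2) (+ 2 , + 2) (+ 0 , + 2)
  ∷ six (+ 2 , + 0) (− 2 , − 2) (− 2 , + 2) (− 2 , + 0) (− 1 , + 1) (− 1 , − 3)
  ∷ six (+ 2 , + 2) (+ 0 , + 2) (+ 2 , + 0) (− 2 , − 2) (− 3 , − 1) (− 1 , + 1)
  ∷ six (+ 1 , + 1) (− 3 , + 1) (− 1 , + 1) (− 1 , − 3) (+ 1 , − 1) (+ 1 , + 3)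
  ∷ six (+ 3 , + 1) (+ 1 , − 1) (+ 3 , + 1) (+ 1 , − 1) (− 1 , + 3) (+ 1 , + 1)
  ∷ six (+ 1 , + 1) (− 3 , + 1) (+ 2 , − 2) (+ 2 , + 0) (− 2 , − 2) (+ 0 , − 2)
  ∷ six (+ 3 , + 1) (+ 1 , − 1) (+ 0 , − 2) (− 2 , + 2) (+ 0 , − 2) (− 2 , + 2)
  ∷ six (+ 2 , + 2) (+ 0 , + 2) (− 2 , + 0) (+ 2 , + 2) (+ 3 , + 1) (+ 1 , − 1)
  ∷ six (+ 2 , + 2) (+ 0 , + 2) (− 2 , + 0) (+ 2 , + 2) (+ 1 , − 3) (− 1 , − 1)
  ∷ six (+ 2 , + 2) (+ 0 , + 2) (+ 1 , + 1) (− 3 , + 1) (− 2 , + 0) (+ 2 , + 2)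
  ∷ six (+ 2 , + 0) (− 2 , − 2) (+ 3 , + 1) (+ 1 , − 1) (+ 2 , − 2) (+ 2 , + 0)
  ∷ six (+ 3 , + 1) (+ 1 , − 1) (+ 1 , − 3) (− 1 , − 1) (+ 1 , + 1) (− 3 , + 1)
  ∷ six (+ 1 , + 1) (− 3 , + 1) (− 1 , − 1) (+ 3 , − 1) (− 1 , + 3) (+ 1 , + 1)
  ∷ six (+ 2 , + 2) (+ 0 , + 2) (+ 2 , + 0) (− 2 , − 2) (+ 1 , − 3) (− 1 , − 1)
  ∷ six (+ 2 , + 0) (− 2 , − 2) (+ 1 , − 3) (− 1 , − 1) (+ 2 , + 2) (+ 0 , + 2)
  ∷ six (+ 2 , + 2) (+ 0 , + 2) (+ 1 , − 1) (+ 1 , + 3) (+ 0 , + 2) (+ 2 , − 2)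
  ∷ six (+ 1 , + 1) (− 3 , + 1) (− 1 , − 1) (+ 3 , − 1) (− 3 , − 1) (− 1 , + 1)
  ∷ six (+ 3 , + 1) (+ 1 , − 1) (− 1 , + 3) (+ 1 , + 1) (+ 1 , − 1) (+ 1 , + 3)
  ∷ six (+ 2 , + 0) (− 2 , − 2) (+ 1 , − 1) (+ 1 , + 3) (− 2 , + 0) (+ 2 , + 2)
  ∷ six (+ 2 , + 2) (+ 0 , + 2) (− 3 , − 1) (− 1 , + 1) (+ 2 , + 2) (+ 0 , + 2)
  ∷ six (+ 2 , + 2) (+ 0 , + 2) (+ 0 , + 2) (+ 2 , − 2) (− 3 , − 1) (− 1 , + 1)
  ∷ six (+ 1 , + 1) (− 3 , + 1) (+ 2 , + 0) (− 2 , − 2) (+ 2 , − 2) (+ 2 , + 0)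
  ∷ six (+ 3 , + 1) (+ 1 , − 1) (+ 2 , − 2) (+ 2 , + 0) (+ 2 , + 0) (− 2 , − 2)
  ∷ six (+ 2 , + 2) (+ 0 , + 2) (+ 1 , − 3) (− 1 , − 1) (− 2 , + 2) (− 2 , + 0)
  ∷ six (+ 2 , + 0) (− 2 , − 2) (− 1 , − 1) (+ 3 , − 1) (+ 0 , − 2) (− 2 , + 2)
  ∷ six (+ 2 , + 2) (+ 0 , + 2) (+ 0 , + 2) (+ 2 , − 2) (+ 3 , + 1) (+ 1 , − 1)
  ∷ six (+ 3 , + 1) (+ 1 , − 1) (+ 2 , + 2) (+ 0 , + 2) (− 2 , + 0) (+ 2 , + 2)
  ∷ six (+ 1 , + 1) (− 3 , + 1) (+ 0 , − 2) (− 2 , + 2) (+ 2 , − 2) (+ 2 , + 0) ∷ [])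
  (six (six 0 1 2 3 4 5)
       (six 6 7 8 9 10 4)
       (six 11 4 12 13 14 15)
       (six 4 16 17 18 19 20)
       (six 21 22 4 23 24 25)
       (six 26 27 28 4 29 30))

square₃₂ : ∃ λ (Φ : QLS 6) → HasCardinality Φ 32
square₃₂ = Scaled.realize 2
  (six e o e o s n
  ∷ six o e n n o e
  ∷ six o e s n o w
  ∷ six ne o o o nw o
  ∷ six e o w o s s
  ∷ six o ne o se o o
  ∷ six ne o o o se o
  ∷ six o o o o o ee
  ∷ six o ne o nw o o
  ∷ six o o ee o o o
  ∷ six e e w n o o
  ∷ six e o o s s e
  ∷ six e o o s n w
  ∷ six o ne ne o o o
  ∷ six e w e n o o
  ∷ six o o o o ne se
  ∷ six e w w s o o
  ∷ six e o o n s w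
  ∷ six e o o n n e
  ∷ six o ne sw o o o
  ∷ six e e e s o o
  ∷ six o o o o ne nw
  ∷ six e o e o n s
  ∷ six o e n s o w
  ∷ six o e s s o e
  ∷ six e o w o n n
  ∷ six o o o o ne ne
  ∷ six o ne se o o o
  ∷ six o ne nw o o o
  ∷ six o o o ee o o
  ∷ six o o o o ne sw
  ∷ six ee o o o o o ∷ [])
  (six (six 0 1 2 3 4 5)
       (six 5 3 6 7 8 9)
       (six 10 11 12 13 14 15)
       (six 16 17 18 19 20 21)
       (six 22 23 24 6 25 8)
       (six 26 27 28 29 30 31))

-- The blocks of two coordinates are those of `square₃₁`, again up to powers of i.
square₃₃ : ∃ λ (Φ : QLS 6) → HasCardinality Φ 33
square₃₃ = Scaled.realize 6
  (six (+ 3 , + 1) (+ 1 , − 1) (+ 3 , + 1) (+ 1 , − 1) (+ 3 , + 1) (+ 1 , − 1)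
  ∷ six (+ 1 , + 1) (− 3 , + 1) (− 1 , + 1) (− 1 , − 3) (− 1 , + 1) (− 1 , − 3)
  ∷ six (+ 2 , + 0) (− 2 , − 2) (− 3 , − 1) (− 1 , + 1) (+ 2 , + 2) (+ 0 , + 2)
  ∷ six (+ 2 , + 2) (+ 0 , + 2) (− 1 , − 1) (+ 3 , − 1) (+ 0 , − 2) (− 2 , + 2)
  ∷ six (+ 2 , + 2) (+ 0 , + 2) (+ 0 , − 2) (− 2 , + 2) (− 1 , − 1) (+ 3 , − 1)
  ∷ six (+ 2 , + 0) (− 2 , − 2) (+ 2 , + 2) (+ 0 , + 2) (− 3 , − 1) (− 1 , + 1)
  ∷ six (+ 1 , + 1) (− 3 , + 1) (− 1 , + 1) (− 1 , − 3) (+ 1 , − 1) (+ 1 , + 3)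
  ∷ six (+ 3 , + 1) (+ 1 , − 1) (− 3 , − 1) (− 1 , + 1) (+ 3 , + 1) (+ 1 , − 1)
  ∷ six (+ 2 , + 2) (+ 0 , + 2) (+ 1 , − 1) (+ 1 , + 3) (+ 0 , − 2) (− 2 , + 2)
  ∷ six (+ 2 , + 0) (− 2 , − 2) (+ 1 , − 3) (− 1 , − 1) (− 2 , − 2) (+ 0 , − 2)
  ∷ six (+ 2 , + 0) (− 2 , − 2) (+ 2 , + 2) (+ 0 , + 2) (− 1 , + 3) (+ 1 , + 1)
  ∷ six (+ 2 , + 2) (+ 0 , + 2) (+ 0 , + 2) (+ 2 , − 2) (− 1 , + 1) (− 1 , − 3)
  ∷ six (+ 2 , + 2) (+ 0 , + 2) (− 2 , + 0) (+ 2 , + 2) (+ 1 , − 3) (− 1 , − 1)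
  ∷ six (+ 2 , + 0) (− 2 , − 2) (+ 2 , − 2) (+ 2 , + 0) (+ 1 , + 1) (− 3 , + 1)
  ∷ six (+ 3 , + 1) (+ 1 , − 1) (+ 2 , + 0) (− 2 , − 2) (+ 2 , − 2) (+ 2 , + 0)
  ∷ six (+ 1 , + 1) (− 3 , + 1) (+ 2 , + 2) (+ 0 , + 2) (− 2 , + 0) (+ 2 , + 2)
  ∷ six (+ 3 , + 1) (+ 1 , − 1) (− 3 , − 1) (− 1 , + 1) (− 1 , + 3) (+ 1 , + 1)
  ∷ six (+ 2 , + 0) (− 2 , − 2) (− 2 , + 2) (− 2 , + 0) (− 1 , + 1) (− 1 , − 3)
  ∷ six (+ 2 , + 2) (+ 0 , + 2) (− 2 , + 0) (+ 2 , + 2) (− 3 , − 1) (− 1 , + 1)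
  ∷ six (+ 1 , + 1) (− 3 , + 1) (+ 2 , − 2) (+ 2 , + 0) (+ 0 , + 2) (+ 2 , − 2)
  ∷ six (+ 3 , + 1) (+ 1 , − 1) (+ 0 , − 2) (− 2 , + 2) (+ 2 , + 2) (+ 0 , + 2)
  ∷ six (+ 3 , + 1) (+ 1 , − 1) (+ 3 , + 1) (+ 1 , − 1) (+ 1 , − 3) (− 1 , − 1)
  ∷ six (+ 2 , + 0) (− 2 , − 2) (+ 1 , − 1) (+ 1 , + 3) (− 2 , + 0) (+ 2 , + 2)
  ∷ six (+ 2 , + 2) (+ 0 , + 2) (+ 3 , + 1) (+ 1 , − 1) (+ 2 , − 2) (+ 2 , + 0)
  ∷ six (+ 1 , + 1) (− 3 , + 1) (− 1 , + 1) (− 1 , − 3) (− 3 , − 1) (− 1 , + 1)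
  ∷ six (+ 3 , + 1) (+ 1 , − 1) (− 1 , + 3) (+ 1 , + 1) (− 1 , + 1) (− 1 , − 3)
  ∷ six (+ 3 , + 1) (+ 1 , − 1) (− 2 , − 2) (+ 0 , − 2) (+ 2 , + 2) (+ 0 , + 2)
  ∷ six (+ 1 , + 1) (− 3 , + 1) (+ 0 , − 2) (− 2 , + 2) (+ 2 , + 0) (− 2 , − 2)
  ∷ six (+ 2 , + 2) (+ 0 , + 2) (+ 1 , − 3) (− 1 , − 1) (− 2 , + 2) (− 2 , + 0)
  ∷ six (+ 2 , + 0) (− 2 , − 2) (+ 1 , + 1) (− 3 , + 1) (− 2 , + 0) (+ 2 , + 2)
  ∷ six (+ 1 , + 1) (− 3 , + 1) (− 1 , + 1) (− 1 , − 3) (+ 3 , + 1) (+ 1 , − 1)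
  ∷ six (+ 1 , + 1) (− 3 , + 1) (− 2 , + 0) (+ 2 , + 2) (+ 0 , − 2) (− 2 , + 2)
  ∷ six (+ 3 , + 1) (+ 1 , − 1) (+ 2 , − 2) (+ 2 , + 0) (+ 2 , − 2) (+ 2 , + 0) ∷ [])
  (six (six 0 1 2 3 4 5)
       (six 6 7 8 9 10 11)
       (six 12 13 14 15 1 16)
       (six 17 18 19 20 21 6)
       (six 22 23 24 25 26 27)
       (six 28 29 25 30 31 32))

-- Divided by 125 = 5³, the nonzero coordinates are, up to sign, products of at most three factors
-- 3/5 and 4/5, the sine and cosine of the 3-4-5 triangle.
square₃₄ : ∃ λ (Φ : QLS 6) → HasCardinality Φ 34
square₃₄ = Scaled.realize 125
  (real (six (+ 0) (+ 36) (+ 64) (− 48) (− 75) (+ 48))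
  ∷ real (six (+ 80) (− 45) (+ 0) (+ 0) (− 60) (− 60))
  ∷ real (six (+ 0) (+ 80) (− 45) (− 60) (+ 0) (− 60))
  ∷ real (six (+ 60) (+ 0) (+ 60) (− 45) (+ 80) (+ 0))
  ∷ real (six (+ 75) (+ 48) (− 48) (+ 36) (+ 0) (+ 64))
  ∷ real (six (+ 0) (+ 60) (+ 60) (+ 80) (+ 0) (− 45))
  ∷ real (six (+ 60) (+ 0) (− 60) (+ 0) (− 80) (− 45))
  ∷ real (six (+ 75) (+ 0) (+ 0) (+ 0) (+ 0) (+ 100))
  ∷ real (six (+ 0) (+ 75) (+ 0) (+ 100) (+ 0) (+ 0))
  ∷ real (six (+ 0) (+ 0) (+ 100) (+ 0) (− 75) (+ 0))
  ∷ real (six (+ 80) (+ 0) (+ 45) (+ 0) (+ 60) (− 60))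
  ∷ real (six (+ 0) (+ 100) (+ 0) (− 75) (+ 0) (+ 0))
  ∷ real (six (+ 0) (+ 60) (− 60) (+ 45) (+ 0) (+ 80))
  ∷ real (six (+ 0) (+ 0) (+ 75) (+ 100) (+ 0) (+ 0))
  ∷ real (six (+ 75) (+ 0) (+ 0) (+ 0) (+ 100) (+ 0))
  ∷ real (six (+ 0) (+ 100) (+ 0) (+ 0) (+ 0) (− 75))
  ∷ real (six (+ 0) (+ 45) (+ 80) (− 60) (+ 0) (+ 60))
  ∷ real (six (+ 100) (+ 0) (+ 0) (+ 0) (− 75) (+ 0))
  ∷ real (six (+ 80) (+ 45) (+ 0) (− 60) (+ 60) (+ 0))
  ∷ real (six (+ 0) (+ 100) (+ 0) (+ 0) (− 75) (+ 0))
  ∷ real (six (+ 0) (+ 0) (+ 100) (+ 0) (+ 0) (− 75))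
  ∷ real (six (+ 75) (+ 0) (+ 0) (+ 100) (+ 0) (+ 0))
  ∷ real (six (+ 60) (− 60) (+ 0) (− 45) (− 80) (+ 0))
  ∷ real (six (+ 0) (+ 0) (+ 75) (+ 0) (+ 0) (+ 100))
  ∷ real (six (+ 75) (− 48) (+ 48) (+ 64) (+ 0) (+ 36))
  ∷ real (six (+ 60) (+ 60) (+ 0) (+ 0) (+ 80) (− 45))
  ∷ real (six (+ 0) (+ 60) (+ 60) (− 45) (+ 0) (+ 80))
  ∷ real (six (+ 80) (+ 0) (− 45) (− 60) (− 60) (+ 0))
  ∷ real (six (+ 0) (+ 64) (+ 36) (+ 48) (− 75) (− 48))
  ∷ real (six (+ 0) (+ 45) (− 80) (+ 60) (+ 0) (+ 60))
  ∷ real (six (+ 0) (+ 80) (+ 45) (+ 60) (+ 0) (− 60))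
  ∷ real (six (+ 0) (+ 0) (+ 100) (− 75) (+ 0) (+ 0))
  ∷ real (six (+ 0) (+ 75) (+ 0) (+ 0) (+ 0) (+ 100))
  ∷ real (six (+ 0) (+ 60) (− 60) (− 80) (+ 0) (− 45)) ∷ [])
  (six (six 0 1 2 3 4 5)
       (six 6 7 8 9 10 11)
       (six 12 13 14 15 16 17)
       (six 18 19 20 21 22 23)
       (six 24 25 26 27 28 29)
       (six 30 31 17 32 33 14))

-- A single ray, number 26, occurs twice. The coordinates are as in `square₃₄` except for 21 = 48 -
-- 27 and 72 = 36 + 36, differences and sums of such products.
square₃₅ : ∃ λ (Φ : QLS 6) → HasCardinality Φ 35
square₃₅ = Scaled.realize 125
  (real (six (+ 45) (+ 0) (− 80) (+ 0) (+ 60) (+ 60))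
  ∷ real (six (+ 64) (+ 0) (+ 36) (− 75) (+ 48) (− 48))
  ∷ real (six (+ 48) (+ 48) (+ 21) (− 36) (− 72) (+ 64))
  ∷ real (six (+ 48) (− 75) (− 48) (+ 0) (− 64) (− 36))
  ∷ real (six (+ 36) (− 64) (+ 72) (+ 48) (+ 21) (+ 48))
  ∷ real (six (+ 60) (+ 60) (+ 0) (+ 80) (+ 0) (− 45))
  ∷ real (six (+ 0) (+ 80) (+ 45) (− 60) (+ 0) (+ 60))
  ∷ real (six (+ 72) (− 36) (+ 64) (+ 48) (− 21) (+ 48))
  ∷ real (six (+ 48) (+ 75) (− 48) (+ 64) (+ 36) (+ 0))
  ∷ real (six (+ 21) (− 48) (− 48) (− 36) (+ 72) (+ 64))
  ∷ real (six (+ 64) (+ 0) (+ 36) (− 48) (+ 48) (− 75))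
  ∷ real (six (+ 60) (+ 0) (− 60) (− 45) (− 80) (+ 0))
  ∷ real (six (+ 100) (+ 0) (+ 0) (+ 0) (− 75) (+ 0))
  ∷ real (six (+ 0) (+ 80) (+ 45) (+ 60) (+ 0) (− 60))
  ∷ real (six (+ 60) (+ 0) (+ 60) (− 45) (+ 80) (+ 0))
  ∷ real (six (+ 0) (+ 60) (− 60) (− 80) (+ 0) (− 45))
  ∷ real (six (+ 45) (+ 0) (− 80) (+ 60) (+ 60) (+ 0))
  ∷ real (six (+ 0) (+ 75) (+ 0) (+ 0) (+ 0) (+ 100))
  ∷ real (six (+ 0) (+ 60) (− 60) (− 45) (+ 0) (− 80))
  ∷ real (six (+ 21) (− 48) (− 48) (+ 64) (+ 72) (− 36))
  ∷ real (six (+ 36) (+ 0) (+ 64) (+ 48) (− 48) (− 75))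
  ∷ real (six (+ 72) (+ 64) (− 36) (+ 48) (− 21) (+ 48))
  ∷ real (six (+ 48) (− 75) (− 48) (− 36) (− 64) (+ 0))
  ∷ real (six (+ 80) (+ 0) (+ 45) (− 60) (+ 60) (+ 0))
  ∷ real (six (+ 0) (+ 75) (+ 0) (+ 100) (+ 0) (+ 0))
  ∷ real (six (+ 60) (+ 0) (− 60) (+ 0) (− 80) (− 45))
  ∷ real (six (+ 45) (− 80) (+ 0) (+ 60) (+ 0) (+ 60))
  ∷ real (six (+ 80) (+ 0) (+ 45) (+ 0) (+ 60) (− 60))
  ∷ real (six (+ 60) (+ 60) (+ 0) (− 45) (+ 0) (+ 80))
  ∷ real (six (+ 0) (+ 0) (+ 100) (+ 0) (− 75) (+ 0))
  ∷ real (six (+ 60) (+ 0) (+ 60) (+ 0) (+ 80) (− 45))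
  ∷ real (six (+ 48) (+ 75) (− 48) (+ 0) (+ 36) (+ 64))
  ∷ real (six (+ 64) (− 36) (− 72) (− 48) (− 21) (− 48))
  ∷ real (six (+ 36) (+ 0) (+ 64) (− 75) (− 48) (+ 48))
  ∷ real (six (+ 48) (+ 48) (+ 21) (+ 64) (− 72) (− 36)) ∷ [])
  (six (six 0 1 2 3 4 5)
       (six 6 7 8 9 10 11)
       (six 12 13 14 15 16 17)
       (six 18 19 20 21 22 23)
       (six 24 25 26 27 28 29)
       (six 30 31 32 33 34 26))

-- All entries are real, with two coordinates 0 and four coordinates ±1/2.
square₃₆ : ∃ λ (Φ : QLS 6) → HasCardinality Φ 36
square₃₆ = Scaled.realize 2
  (six e o w w o w
  ∷ six o e o w e e
  ∷ six e w e o e o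
  ∷ six e e e o w o
  ∷ six o e o e e w
  ∷ six e o w e o e
  ∷ six o e e o w w
  ∷ six e w e w o o
  ∷ six e o o e w e
  ∷ six e o o e e w
  ∷ six e e w w o o
  ∷ six o e e o e e
  ∷ six e o e w o e
  ∷ six o e o w w w
  ∷ six e e w o e o
  ∷ six e w w o w o
  ∷ six o e o e w e
  ∷ six e o e e o w
  ∷ six o e w o w e
  ∷ six e e e e o o
  ∷ six e o o w w w
  ∷ six e o o w e e
  ∷ six e w w e o o
  ∷ six o e w o e w
  ∷ six e w o e w o
  ∷ six e o w o e w
  ∷ six o e e e o w
  ∷ six o e w e o e
  ∷ six e o e o e e
  ∷ six e e o w w o
  ∷ six e e o e e o
  ∷ six e o w o w e
  ∷ six o e e w o e
  ∷ six o e w w o w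
  ∷ six e o e o w w
  ∷ six e w o w e o ∷ [])
  (six (six 0 1 2 3 4 5)
       (six 6 7 8 9 10 11)
       (six 12 13 14 15 16 17)
       (six 18 19 20 21 22 23)
       (six 24 25 26 27 28 29)
       (six 30 31 32 33 34 35))

-- Collecting the cardinalities

cardinalities : List ℕ
cardinalities =
    6 ∷ 8 ∷ 9 ∷ 10 ∷ 11 ∷ 12 ∷ 13 ∷ 14 ∷ 15 ∷ 16
  ∷ 17 ∷ 18 ∷ 19 ∷ 20 ∷ 21 ∷ 22 ∷ 23 ∷ 24 ∷ 25 ∷ 26
  ∷ 27 ∷ 28 ∷ 30 ∷ 31 ∷ 32 ∷ 33 ∷ 34 ∷ 35 ∷ 36 ∷ []

realized : All (λ c → ∃ λ (Φ : QLS 6) → HasCardinality Φ c) cardinalities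
realized =
    square₆ ∷ square₈ ∷ square₉ ∷ square₁₀ ∷ square₁₁ ∷ square₁₂ ∷ square₁₃ ∷ square₁₄ ∷ square₁₅ ∷ square₁₆
  ∷ square₁₇ ∷ square₁₈ ∷ square₁₉ ∷ square₂₀ ∷ square₂₁ ∷ square₂₂ ∷ square₂₃ ∷ square₂₄ ∷ square₂₅ ∷ square₂₆
  ∷ square₂₇ ∷ square₂₈ ∷ square₃₀ ∷ square₃₁ ∷ square₃₂ ∷ square₃₃ ∷ square₃₄ ∷ square₃₅ ∷ square₃₆ ∷ []

∈-cardinalities : ∀ {c} → c ℕ.< 37 → 6 ≤ c → c ≢ 7 → c ≢ 29 → c ∈ cardinalities
∈-cardinalities = from-yes (ℕ.allUpTo? (λ c →
  6 ℕ.≤? c →-dec ¬? (c ℕ.≟ 7) →-dec ¬? (c ℕ.≟ 29) →-dec c ∈? cardinalities) 37)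

corollary1 :
    (∀ (c : ℕ) → 6 ≤ c → c ≤ 36 → c ≢ 7 → c ≢ 29 →
      ∃ λ (Φ : QLS 6) → HasCardinality Φ c)
    × ¬ (∃ λ (Φ : QLS 6) → HasCardinality Φ 7)
corollary1 =
  (λ c 6≤c c≤36 c≢7 c≢29 → All.lookup realized (∈-cardinalities (s≤s c≤36) 6≤c c≢7 c≢29)) ,
  no-cardinality-7
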